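{- Let $e\ge 3$ be an odd integer, $q=2^e$, and let $\mathcal{V}^4_\varepsilon\subset\mathrm{PG}(4,q^2)$ be the hypersurface defined in the context (with $r=4$). Then its cutting gaps satisfy $$\tau_1(\mathcal{V}^4_\varepsilon)=2,\qquad \tau_2(\mathcal{V}^4_\varepsilon)=2,\qquad \tau_3(\mathcal{V}^4_\varepsilon)=0.$$
   Context: Let $e\ge 3$ be odd, $q=2^e$, $r\ge 2$. Points of $\mathrm{PG}(r,q^2)$ (projective space of projective dimension $r$ over $\mathbb{F}_{q^2}$) have homogeneous coordinates $(X_0,\dots,X_r)$; $\Pi_\infty$ is the hyperplane $X_0=0$, and affine coordinates on the complement $\mathrm{AG}(r,q^2)$ are $x_i=X_i/X_0$. For an exponent involving $\sigma$, $\sigma$ stands for $2^{(e+1)/2}$, i.e. $x^{\sigma}=x^{2^{(e+1)/2}}$ and $x^{\sigma+2}=x^{2^{(e+1)/2}+2}$. Fix $\varepsilon\in\mathbb{F}_{q^2}\setminus\mathbb{F}_q$ such that $\varepsilon^2+\varepsilon+\delta=0$ for some $\delta\in\mathbb{F}_q\setminus\{1\}$ with absolute trace $\mathrm{Tr}_{q/2}(\delta)=\sum_{i=0}^{e-1}\delta^{2^i}=1$. Put $$\Gamma_{\varepsilon}(x)=[x+(x^q+x)\varepsilon]^{\sigma+2}+(x^q+x)^{\sigma}+(x^{2q}+x^2)\varepsilon+x^{q+1}+x^2.$$ $\mathcal{V}^r_\varepsilon$ is the projective hypersurface of $\mathrm{PG}(r,q^2)$ with affine equation $x_r^q+x_r=\Gamma_{\varepsilon}(x_1)+\dots+\Gamma_{\varepsilon}(x_{r-1})$,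 i.e. the zero locus of the homogenization (with respect to $X_0$) of the corresponding polynomial; it is identified with its set of $\mathbb{F}_{q^2}$-rational points. Dimensions are projective, with the convention $\dim(\emptyset)=-1$. For a non-empty set $\Omega$ of points of $\mathrm{PG}(r,\mathbb{K})$ and $0\le k\le r$, the $k$-th cutting gap of $\Omega$ is $$\tau_k(\Omega)=k-\min\{\dim\langle\Pi\cap\Omega\rangle : \Pi \text{ a subspace of } \mathrm{PG}(r,\mathbb{K}),\ \dim\Pi=k\}.$$ -}

module Defs where

open import Algebra.Bundles using (CommutativeRing; Semiring)
import Algebra.Definitions.RawSemiring as RawSemiringOps
open import Data.Fin.Base using (Fin; toℕ; fromℕ; inject₁)
import Data.Fin.Properties as Fin
open import Data.Integer.Base as ℤ using (ℤ; 1ℤ)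
open import Data.List.Base as List using (List; []; _∷_; _++_; filter; foldr; cartesianProductWith)
open import Data.Nat.Base as ℕ using (ℕ; zero; suc; _⊔_; _∸_; _/_)
import Data.Nat.Properties as ℕ
open import Data.Product.Base using (Σ; ∃; _×_; _,_; proj₁; proj₂)
open import Data.Vec.Base as Vec using (Vec; lookup; replicate; zipWith; _[_]≔_)
import Data.Vec.Properties as Vec
open import Data.Vec.Functional as Vector using (Vector)
import Data.Vec.Functional.Relation.Binary.Equality.Setoid as VectorEquality
open import Function.Base using (_∘_)
open import Function.Bundles using (Inverse)
open import Function.Properties.Inverse using (Inverse⇒Injection)
import Function.Construct.Symmetry as Symmetry
open import Level using (Level)
open import Relation.Binary.Definitions using (Decidable)
open import Relation.Binary.PropositionalEquality.Core using (_≡_)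
open import Relation.Binary.PropositionalEquality.Properties using (setoid)
open import Relation.Nullary using (¬_)
open import Relation.Nullary.Decidable using (¬?; via-injection)
open import Relation.Unary using (Pred)

record FiniteField (c ℓ : Level) (N : ℕ) : Set (Level.suc (c Level.⊔ ℓ)) where
  field
    commutativeRing : CommutativeRing c ℓ

  open CommutativeRing commutativeRing public hiding (setoid)

  field
    1≉0         : ¬ 1# ≈ 0#
    invertible  : ∀ x → ¬ x ≈ 0# → ∃ λ y → x * y ≈ 1#
    enumeration : Inverse (setoid (Fin N)) (CommutativeRing.setoid commutativeRing)

  infix 4 _≟_
  _≟_ : Decidable _≈_
  _≟_ = via-injection (Inverse⇒Injection (Symmetry.inverse enumeration)) Fin._≟_

-- Polynomials are formal sums of terms (coefficient , exponents).  An exponent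
-- vector may occur several times, so only `coefficient` is meaningful.
module Polynomials {c ℓ} (R : CommutativeRing c ℓ)
                   (_≟_ : Decidable (CommutativeRing._≈_ R)) where

  open CommutativeRing R using (Carrier; _≈_; 0#; 1#; _+_; _*_; -_)
  open RawSemiringOps (Semiring.rawSemiring (CommutativeRing.semiring R)) using (_^_; product)

  Term : ℕ → Set c
  Term n = Carrier × Vec ℕ n

  Polynomial : ℕ → Set c
  Polynomial n = List (Term n)

  infixl 6 _⊞_ _⊟_
  infixl 7 _⊠_
  infixr 8 _⊠^_

  con : ∀ {n} → Carrier → Polynomial n
  con {n} a = (a , replicate n 0) ∷ []

  var : ∀ {n} → Fin n → Polynomial n
  var {n} i = (1# , replicate n 0 [ i ]≔ 1) ∷ []

  _⊞_ : ∀ {n} → Polynomial n → Polynomial n → Polynomial n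
  _⊞_ = _++_

  _⊠_ : ∀ {n} → Polynomial n → Polynomial n → Polynomial n
  _⊠_ = cartesianProductWith λ (a , α) (b , β) → a * b , zipWith ℕ._+_ α β

  _⊟_ : ∀ {n} → Polynomial n → Polynomial n → Polynomial n
  f ⊟ g = f ⊞ con (- 1#) ⊠ g

  _⊠^_ : ∀ {n} → Polynomial n → ℕ → Polynomial n
  f ⊠^ zero  = con 1#
  f ⊠^ suc k = f ⊠ f ⊠^ k

  ⊞-sum : ∀ {n k} → Vector (Polynomial n) k → Polynomial n
  ⊞-sum = Vector.foldr _⊞_ []

  coefficient : ∀ {n} → Polynomial n → Vec ℕ n → Carrier
  coefficient f α =
    foldr _+_ 0# (List.map proj₁ (filter (λ t → Vec.≡-dec ℕ._≟_ (proj₂ t) α) f))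

  support : ∀ {n} → Polynomial n → Polynomial n
  support f = filter (λ t → ¬? (coefficient f (proj₂ t) ≟ 0#)) f

  -- Total degree; the zero polynomial gets degree 0.
  degree : ∀ {n} → Polynomial n → ℕ
  degree f = foldr _⊔_ 0 (List.map (Vec.sum ∘ proj₂) (support f))

  -- X₀ ^ degree f · f (X₁ / X₀ , … , Xₙ / X₀).  Restricting to the support makes
  -- every remaining term have degree at most `degree f`, so that ∸ never truncates.
  homogenize : ∀ {n} → Polynomial n → Polynomial (suc n)
  homogenize f = List.map (λ (a , α) → a , (degree f ∸ Vec.sum α) Vec.∷ α) (support f)

  eval : ∀ {n} → Polynomial n → Vector Carrier n → Carrier
  eval f x = foldr _+_ 0# (List.map (λ (a , α) → a * product (λ i → x i ^ lookup α i)) f)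

module ProjectiveGeometry {c ℓ} (K : CommutativeRing c ℓ) where

  open CommutativeRing K using (Carrier; _≈_; 0#; _+_; _*_)
  open RawSemiringOps (Semiring.rawSemiring (CommutativeRing.semiring K)) using (sum)
  open VectorEquality (CommutativeRing.setoid K) using (_≋_)

  0ᵥ : ∀ {n} → Vector Carrier n
  0ᵥ _ = 0#

  infixl 6 _+ᵥ_
  _+ᵥ_ : ∀ {n} → Vector Carrier n → Vector Carrier n → Vector Carrier n
  (v +ᵥ w) i = v i + w i

  infixl 7 _*ᵥ_
  _*ᵥ_ : ∀ {n} → Carrier → Vector Carrier n → Vector Carrier n
  (a *ᵥ v) i = a * v i

  combination : ∀ {n d} → Vector Carrier d → Vector (Vector Carrier n) d → Vector Carrier n
  combination a b i = sum (λ j → a j * b j i)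

  record LinearSubspace (n : ℕ) : Set (Level.suc (c Level.⊔ ℓ)) where
    field
      member   : Pred (Vector Carrier n) (c Level.⊔ ℓ)
      resp-≋   : ∀ {v w} → v ≋ w → member v → member w
      0-closed : member 0ᵥ
      +-closed : ∀ {v w} → member v → member w → member (v +ᵥ w)
      *-closed : ∀ a {v} → member v → member (a *ᵥ v)

  open LinearSubspace public using (member)

  record IsBasis {n d} (U : LinearSubspace n) (b : Vector (Vector Carrier n) d)
                 : Set (c Level.⊔ ℓ) where
    field
      members     : ∀ j → member U (b j)
      independent : ∀ a → combination a b ≋ 0ᵥ → ∀ j → a j ≈ 0#
      generates   : ∀ v → member U v → ∃ λ a → v ≋ combination a b

  -- A point of PG(r,K) is given by a homogeneous coordinate vector; proportional
  -- vectors represent the same point, and are not identified.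
  record Point (r : ℕ) : Set (c Level.⊔ ℓ) where
    field
      coordinates : Vector Carrier (suc r)
      nonzero     : ¬ coordinates ≋ 0ᵥ

  open Point public using (coordinates)

  PointSet : ℕ → Set (Level.suc (c Level.⊔ ℓ))
  PointSet r = Pred (Point r) (c Level.⊔ ℓ)

  -- A subspace of PG(r,K), as the linear subspace of K^(r+1) underlying it.
  Subspace : ℕ → Set (Level.suc (c Level.⊔ ℓ))
  Subspace r = LinearSubspace (suc r)

  HasDim : ∀ {r} → Subspace r → ℤ → Set (c Level.⊔ ℓ)
  HasDim {r} U n = ∃ λ d → (Σ (Vector (Vector Carrier (suc r)) d) (IsBasis U))
                           × n ≡ ℤ.+ d ℤ.- 1ℤ

  infixr 7 _∩_
  _∩_ : ∀ {r} → Subspace r → PointSet r → PointSet r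
  (Π ∩ Ω) P = member Π (coordinates P) × Ω P

  data Span {r} (Ω : PointSet r) : Pred (Vector Carrier (suc r)) (c Level.⊔ ℓ) where
    point : ∀ P → Ω P → Span Ω (coordinates P)
    resp  : ∀ {v w} → v ≋ w → Span Ω v → Span Ω w
    zeroᵥ : Span Ω 0ᵥ
    plus  : ∀ {v w} → Span Ω v → Span Ω w → Span Ω (v +ᵥ w)
    scale : ∀ a {v} → Span Ω v → Span Ω (a *ᵥ v)

  ⟨_⟩ : ∀ {r} → PointSet r → Subspace r
  ⟨ Ω ⟩ = record
    { member   = Span Ω
    ; resp-≋   = resp
    ; 0-closed = zeroᵥ
    ; +-closed = plus
    ; *-closed = scale
    }

  IsMinimum : ∀ {p} → Pred ℤ p → ℤ → Set p
  IsMinimum S m = S m × (∀ n → S n → m ℤ.≤ n)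

  SectionDim : ∀ {r} → ℕ → PointSet r → Pred ℤ (Level.suc (c Level.⊔ ℓ))
  SectionDim {r} k Ω n =
    Σ (Subspace r) λ Π → HasDim Π (ℤ.+ k) × HasDim ⟨ Π ∩ Ω ⟩ n

  -- τₖ(Ω) = t.  The minimum is required to exist, which forces k ≤ r.
  CuttingGap : ∀ {r} → ℕ → PointSet r → ℤ → Set (Level.suc (c Level.⊔ ℓ))
  CuttingGap k Ω t = ∃ λ m → IsMinimum (SectionDim k Ω) m × t ≡ ℤ.+ k ℤ.- m

module Hypersurface {c ℓ} (e : ℕ) (K : FiniteField c ℓ ((2 ℕ.^ e) ℕ.^ 2)) where

  open FiniteField K using (Carrier; _≈_; 0#; 1#; _+_; _*_; semiring; commutativeRing; _≟_)
  open RawSemiringOps (Semiring.rawSemiring semiring) using (_^_; sum)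
  open Polynomials commutativeRing _≟_
  open ProjectiveGeometry commutativeRing public

  q : ℕ
  q = 2 ℕ.^ e

  σ : ℕ
  σ = 2 ℕ.^ ((e ℕ.+ 1) / 2)

  -- The subfield of order q of the field K of order q².
  𝔽q : Pred Carrier ℓ
  𝔽q x = x ^ q ≈ x

  Tr : Carrier → Carrier
  Tr x = sum {e} (λ i → x ^ (2 ℕ.^ toℕ i))

  record Admissible (ε : Carrier) : Set (c Level.⊔ ℓ) where
    field
      ε∉𝔽q     : ¬ 𝔽q ε
      δ        : Carrier
      δ∈𝔽q     : 𝔽q δ
      δ≉1      : ¬ δ ≈ 1#
      trace-δ  : Tr δ ≈ 1#
      equation : ε ^ 2 + ε + δ ≈ 0#

  Γ : ∀ {n} → Carrier → Polynomial n → Polynomial n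
  Γ ε x = (x ⊞ (x ⊠^ q ⊞ x) ⊠ con ε) ⊠^ (σ ℕ.+ 2)
        ⊞ (x ⊠^ q ⊞ x) ⊠^ σ
        ⊞ (x ⊠^ (2 ℕ.* q) ⊞ x ⊠^ 2) ⊠ con ε
        ⊞ x ⊠^ (q ℕ.+ 1)
        ⊞ x ⊠^ 2

  -- With r = suc m, the affine coordinates x₁ , … , xᵣ₋₁ are the variables
  -- inject₁ i (i : Fin m) and xᵣ is the last variable.
  affineEquation : ∀ m → Carrier → Polynomial (suc m)
  affineEquation m ε = (xᵣ ⊠^ q ⊞ xᵣ) ⊟ ⊞-sum (λ (i : Fin m) → Γ ε (var (inject₁ i)))
    where
    xᵣ : Polynomial (suc m)
    xᵣ = var (fromℕ m)

  𝒱 : ∀ r → .{{ℕ.NonZero r}} → Carrier → PointSet r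
  𝒱 (suc m) ε P = Level.Lift c (eval (homogenize (affineEquation m ε)) (coordinates P) ≈ 0#)

{-# OPTIONS --safe #-}
module Submission where

-- Write x = a + b ε with a , b ∈ F_q, q = 2 s². Then Γ_ε(x) = a^(σ+2) + b^σ + a b, and at infinity the
-- hypersurface is the cone with vertex (0,0,0,0,1) over the curve N(x) + N(y) + N(z) = 0, where N(x) = x^(s+1).
--
-- Small sections: the curve has an external line. If N is not onto, some 1 + N(a) is not a norm, and
-- z = a x is external; if N is bijective, a non-injective map on a suitable pencil of lines misses a value. The
-- line is disjoint from the hypersurface, and its join with the vertex meets it in the vertex only.
--
-- Lower bounds for all sections: along b ↦ b + t β with β ∈ F_q³ the equation of the hypersurface becomes c t^σ + d t = v,
-- with d adjustable through the base point. Hence every affine plane of (x₁ , x₂ , x₃)-space lifts to a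
-- point of the hypersurface, so that no plane misses it, and no plane inside a hyperplane
-- contains the whole section by that hyperplane.

open import Defs
open import Algebra.Bundles using (CommutativeMonoid; CommutativeRing)
import Algebra.Properties.CommutativeMonoid.Sum as MonoidSum
import Algebra.Properties.CommutativeSemigroup as CommutativeSemigroupProperties
import Algebra.Properties.CommutativeSemiring.Exp as Exp
import Algebra.Properties.Ring as RingProperties
import Algebra.Properties.Semiring.Mult as SemiringMult
import Algebra.Properties.Semiring.Sum as SemiringSum
import Algebra.Solver.Ring as RingSolver
open import Algebra.Solver.Ring.AlmostCommutativeRing using (fromCommutativeRing; _-Raw-AlmostCommutative⟶_)
open import Data.Bool.Base using (Bool; false; true)
open import Data.Bool.Properties using (xor-∧-commutativeRing)
open import Data.Empty using (⊥)
open import Data.Fin.Base using (Fin; zero; suc; fromℕ; inject₁; punchIn; punchOut)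
open import Data.Fin.Patterns using (0F; 1F; 2F; 3F; 4F)
open import Data.Fin.Permutation using (Permutation; permutation)
import Data.Fin.Properties as Fin
import Data.Integer.Base as ℤ
import Data.Integer.Properties as ℤ
import Data.List.Base as List
import Data.List.Properties as List
import Data.List.Relation.Unary.All as All
import Data.List.Relation.Unary.All.Properties as AllProperties
open import Data.Maybe.Base using (Maybe; just; nothing)
open import Data.Nat.Base as ℕ using (ℕ; zero; suc)
open import Data.Nat.Divisibility using (_∤_; divides)
import Data.Nat.DivMod as ℕ
import Data.Nat.Properties as ℕ
import Data.Nat.Solver as ℕ
open import Data.Product.Base using (∃; _×_; _,_; proj₁; proj₂)
open import Data.Sum.Base using (_⊎_; inj₁; inj₂; [_,_]′)
open import Data.Vec.Base as Vec using (Vec; lookup; replicate; zipWith; _[_]≔_)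
open import Data.Vec.Functional as Vector using (Vector)
import Data.Vec.Properties as Vec
open import Function.Base using (_∘_; id)
open import Function.Bundles using (Inverse)
open import Function.Definitions using (Injective)
open import Level using (Level; lift; lower)
open import Relation.Binary.Definitions using () renaming (Decidable to Decidable₂)
open import Relation.Binary.PropositionalEquality as ≡ using (_≡_)
import Relation.Binary.Reasoning.Setoid as SetoidReasoning
open import Relation.Nullary using (¬_; Dec; yes; no; contradiction)
open import Relation.Nullary.Decidable using (¬?; _×-dec_; decidable-stable; map′)
open import Relation.Unary using (Pred; Decidable)

-- In affine space the equation compares two elements of F_q: the trace of the last coordinate and
-- the sum of the Γ_ε. Directions ε β t with β, t over F_q move only the components b, in which Γ_ε
-- is affine up to the twist by σ. On F_q the additive map t ↦ c t^σ + d t can have a kernel, so a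
-- line chosen carelessly may miss the hypersurface. The base point therefore makes d = 0 if c ≠ 0,
-- where σ-th roots exist since (v^s)^σ = v^q = v, and d = 1 if c = 0. Whether N is bijective
-- depends on e = 2 f + 1: gcd(s + 1, q² - 1) is 3 for odd f and 1 for even f. The gcd is not
-- computed; a search through the finite field decides between the two constructions of an external
-- line. `homogenize` uses the degree left after cancellation, which a formal sum does not display.
-- It is bounded above term by term, and below by a point at infinity where the form of degree (σ +
-- 2) q does not vanish. Points are then normalised to X₀ = 0 or X₀ = 1, where all positive powers
-- of X₀ coincide and exponents of X₀ need no tracking.

Fin-injective⇒surjective : ∀ {n} {f : Fin n → Fin n} → Injective _≡_ _≡_ f → ∀ y → ∃ λ x → f x ≡ y
Fin-injective⇒surjective {suc n} {f} inj y with Fin.any? (λ x → f x Fin.≟ y)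
... | yes p = p
... | no ¬p = contradiction
  -- Removing a missed value y from the codomain would inject `Fin (suc n)` into `Fin n`.
  (Fin.injective⇒≤ {f = λ x → punchOut (λ y≡ → ¬p (x , ≡.sym y≡))}
    (λ eq → inj (Fin.punchOut-injective {i = y} _ _ eq)))
  ℕ.1+n≰n

-- Rings of characteristic two: ring solver and Frobenius maps.

module CharacteristicTwo {c ℓ} (R : CommutativeRing c ℓ)
  (1+1≈0 : CommutativeRing._≈_ R (CommutativeRing._+_ R (CommutativeRing.1# R) (CommutativeRing.1# R)) (CommutativeRing.0# R)) where
  open CommutativeRing R hiding (zero)
  open Exp commutativeSemiring
  open RingProperties ring using (+-inverseʳ-unique)
  open SetoidReasoning setoid

  x+x≈0 : ∀ x → x + x ≈ 0#
  x+x≈0 x = begin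
    x + x             ≈⟨ +-cong (*-identityˡ x) (*-identityˡ x) ⟨
    1# * x + 1# * x   ≈⟨ distribʳ x 1# 1# ⟨
    (1# + 1#) * x     ≈⟨ *-congʳ 1+1≈0 ⟩
    0# * x            ≈⟨ zeroˡ x ⟩
    0# ∎

  -x≈x : ∀ x → - x ≈ x
  -x≈x x = sym (+-inverseʳ-unique x x (x+x≈0 x))

  ⟦_⟧₂ : Bool → Carrier
  ⟦ true ⟧₂  = 1#
  ⟦ false ⟧₂ = 0#

  -- Coefficients are taken in F_2, realised as `Bool` with xor and conjunction. The solver then
  -- cancels equal terms in pairs and proves identities that hold only in characteristic two.
  Bool⟶R : CommutativeRing.rawRing xor-∧-commutativeRing -Raw-AlmostCommutative⟶ fromCommutativeRing R
  Bool⟶R = record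
    { ⟦_⟧    = ⟦_⟧₂
    ; +-homo = λ { true true → sym 1+1≈0 ; true false → sym (+-identityʳ _)
                 ; false y → sym (+-identityˡ _) }
    ; *-homo = λ { true y → sym (*-identityˡ _) ; false y → sym (zeroˡ _) }
    ; -‿homo = λ x → sym (-x≈x _)
    ; 0-homo = refl
    ; 1-homo = refl
    }

  _≟₂_ : ∀ x y → Maybe (⟦ x ⟧₂ ≈ ⟦ y ⟧₂)
  true  ≟₂ true  = just refl
  false ≟₂ false = just refl
  _     ≟₂ _     = nothing

  open RingSolver (CommutativeRing.rawRing xor-∧-commutativeRing) (fromCommutativeRing R) Bool⟶R _≟₂_
    public using (solve; _:=_; _:+_; _:*_; _:^_; con)

  +-cancel⇒≈ : ∀ {x y} → x + y ≈ 0# → x ≈ y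
  +-cancel⇒≈ {x} {y} p = begin
    x            ≈⟨ solve 2 (λ x y → x := (x :+ y) :+ y) refl x y ⟩
    (x + y) + y  ≈⟨ +-congʳ p ⟩
    0# + y       ≈⟨ +-identityˡ y ⟩
    y ∎

  ≈⇒+≈0 : ∀ {x y} → x ≈ y → x + y ≈ 0#
  ≈⇒+≈0 {x} {y} p = trans (+-congʳ p) (x+x≈0 y)

  frobenius : ∀ k x y → (x + y) ^ (2 ℕ.^ k) ≈ x ^ (2 ℕ.^ k) + y ^ (2 ℕ.^ k)
  frobenius zero    x y = solve 2 (λ x y → (x :+ y) :^ 1 := x :^ 1 :+ y :^ 1) refl x y
  frobenius (suc k) x y = begin
    (x + y) ^ (2 ℕ.* 2 ℕ.^ k)          ≈⟨ ^-assocʳ (x + y) 2 (2 ℕ.^ k) ⟨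
    ((x + y) ^ 2) ^ (2 ℕ.^ k)          ≈⟨ ^-congˡ (2 ℕ.^ k) (solve 2 (λ x y → (x :+ y) :^ 2 := x :^ 2 :+ y :^ 2) refl x y) ⟩
    (x ^ 2 + y ^ 2) ^ (2 ℕ.^ k)        ≈⟨ frobenius k (x ^ 2) (y ^ 2) ⟩
    (x ^ 2) ^ (2 ℕ.^ k) + (y ^ 2) ^ (2 ℕ.^ k)  ≈⟨ +-cong (^-assocʳ x 2 (2 ℕ.^ k)) (^-assocʳ y 2 (2 ℕ.^ k)) ⟩
    x ^ (2 ℕ.* 2 ℕ.^ k) + y ^ (2 ℕ.* 2 ℕ.^ k) ∎

module _ {a b} (M : CommutativeMonoid a b) where
  open CommutativeMonoid M
  open MonoidSum M using (sum; sum-remove; sum-cong-≋; sum-replicate-zero)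

  sum-zero : ∀ {n} {t : Vector Carrier n} → (∀ i → t i ≈ ε) → sum t ≈ ε
  sum-zero {n} p = trans (sum-cong-≋ p) (sum-replicate-zero n)

  sum-single : ∀ {n} (t : Vector Carrier n) i → (∀ j → ¬ j ≡ i → t j ≈ ε) → sum t ≈ t i
  sum-single {suc n} t i p = trans (sum-remove {i = i} t)
    (trans (∙-congˡ (sum-zero (λ j → p (punchIn i j) (Fin.punchInᵢ≢i i j)))) (identityʳ (t i)))

-- Finite fields: search, counting, characteristic and Fermat's theorem.

module FieldProperties {c ℓ N} (K : FiniteField c ℓ N) where
  open FiniteField K hiding (zero)
  open CommutativeRing commutativeRing using (setoid)
  open Exp commutativeSemiring
  open SetoidReasoning setoid
  open Inverse enumeration using (to; from; to-cong; from-cong; strictlyInverseˡ; strictlyInverseʳ)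

  *-cancel-≉0 : ∀ {x y} → ¬ x ≈ 0# → x * y ≈ 0# → y ≈ 0#
  *-cancel-≉0 {x} {y} x≉0 xy≈0 with z , xz≈1 ← invertible x x≉0 = begin
    y            ≈⟨ *-identityˡ y ⟨
    1# * y       ≈⟨ *-congʳ xz≈1 ⟨
    x * z * y    ≈⟨ *-congʳ (*-comm x z) ⟩
    z * x * y    ≈⟨ *-assoc z x y ⟩
    z * (x * y)  ≈⟨ *-congˡ xy≈0 ⟩
    z * 0#       ≈⟨ zeroʳ z ⟩
    0# ∎

  *-≉0 : ∀ {x y} → ¬ x ≈ 0# → ¬ y ≈ 0# → ¬ x * y ≈ 0#
  *-≉0 x≉0 y≉0 p = y≉0 (*-cancel-≉0 x≉0 p)

  ^-≉0 : ∀ n {x} → ¬ x ≈ 0# → ¬ x ^ n ≈ 0#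
  ^-≉0 zero    x≉0 = 1≉0
  ^-≉0 (suc n) x≉0 = *-≉0 x≉0 (^-≉0 n x≉0)

  ^≈0⇒≈0 : ∀ n {x} → x ^ n ≈ 0# → x ≈ 0#
  ^≈0⇒≈0 n {x} p with x ≟ 0#
  ... | yes x≈0 = x≈0
  ... | no x≉0  = contradiction p (^-≉0 n x≉0)

  *-cancelˡ-≉0 : ∀ {x y z} → ¬ x ≈ 0# → x * y ≈ x * z → y ≈ z
  *-cancelˡ-≉0 {x} {y} {z} x≉0 xy≈xz with w , xw≈1 ← invertible x x≉0 = begin
    y            ≈⟨ *-identityˡ y ⟨
    1# * y       ≈⟨ *-congʳ (trans (*-comm w x) xw≈1) ⟨
    w * x * y    ≈⟨ *-assoc w x y ⟩
    w * (x * y)  ≈⟨ *-congˡ xy≈xz ⟩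
    w * (x * z)  ≈⟨ *-assoc w x z ⟨
    w * x * z    ≈⟨ *-congʳ (trans (*-comm w x) xw≈1) ⟩
    1# * z       ≈⟨ *-identityˡ z ⟩
    z ∎

  any? : ∀ {p} {P : Pred Carrier p} → (∀ {x y} → x ≈ y → P x → P y) → Decidable P → Dec (∃ P)
  any? resp P? = map′ (λ (i , p) → to i , p) (λ (x , p) → from x , resp (sym (strictlyInverseˡ x)) p)
    (Fin.any? (λ i → P? (to i)))

  -- Exhaustive search stands in for excluded middle; it separates the two constructions of an
  -- external line and extracts a missed value from a map that is not onto.
  ∀⊎∃¬ : ∀ {p} {P : Pred Carrier p} → (∀ {x y} → x ≈ y → P x → P y) → Decidable P → (∀ x → P x) ⊎ ∃ λ x → ¬ P x
  ∀⊎∃¬ {P = P} resp P? with Fin.all? (λ i → P? (to i))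
  ... | yes ∀P = inj₁ (λ x → resp (strictlyInverseˡ x) (∀P (from x)))
  ... | no ¬∀P with i , ¬P ← Fin.¬∀⟶∃¬ N (λ i → P (to i)) (λ i → P? (to i)) ¬∀P = inj₂ (to i , ¬P)

  from-injective : ∀ {x y} → from x ≡ from y → x ≈ y
  from-injective {x} {y} eq = begin
    x            ≈⟨ strictlyInverseˡ x ⟨
    to (from x)  ≈⟨ to-cong eq ⟩
    to (from y)  ≈⟨ strictlyInverseˡ y ⟩
    y ∎

  injective⇒surjective : ∀ {f : Carrier → Carrier} → (∀ {x y} → f x ≈ f y → x ≈ y) → ∀ y → ∃ λ x → f x ≈ y
  injective⇒surjective {f} f-inj y = to (proj₁ preimage) , from-injective (proj₂ preimage)
    where
    preimage : ∃ λ i → from (f (to i)) ≡ from y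
    preimage = Fin-injective⇒surjective
      (λ {i} {j} eq → ≡.trans (≡.sym (strictlyInverseʳ i))
        (≡.trans (from-cong (f-inj (from-injective eq))) (strictlyInverseʳ j)))
      (from y)

  -- A section of `f` is injective, hence onto by finiteness, and so a two-sided inverse of `f`.
  surjective⇒injective : ∀ {f : Carrier → Carrier} → (∀ {x y} → x ≈ y → f x ≈ f y) →
    (∀ y → ∃ λ x → f x ≈ y) → ∀ {x y} → f x ≈ f y → x ≈ y
  surjective⇒injective {f} f-cong f-surj {x} {y} fx≈fy = begin
    x           ≈⟨ g∘f x ⟨
    g (f x)     ≈⟨ g-cong fx≈fy ⟩
    g (f y)     ≈⟨ g∘f y ⟩
    y           ∎
    where
    -- Passing through `from` makes the chosen section respect _≈_.
    g : Carrier → Carrier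
    g z = proj₁ (f-surj (to (from z)))
    f∘g : ∀ z → f (g z) ≈ z
    f∘g z = trans (proj₂ (f-surj (to (from z)))) (strictlyInverseˡ z)
    g-cong : ∀ {x y} → x ≈ y → g x ≈ g y
    g-cong {x} {y} x≈y = reflexive (≡.cong (λ i → proj₁ (f-surj (to i))) (from-cong x≈y))
    g∘f : ∀ z → g (f z) ≈ z
    g∘f z with w , gw≈z ← injective⇒surjective {g} (λ p → trans (sym (f∘g _)) (trans (f-cong p) (f∘g _))) z = begin
      g (f z)      ≈⟨ g-cong (f-cong gw≈z) ⟨
      g (f (g w))  ≈⟨ g-cong (f∘g w) ⟩
      g w          ≈⟨ gw≈z ⟩
      z            ∎

  module _ {a b} (M : CommutativeMonoid a b) where
    private module M = CommutativeMonoid M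
    open MonoidSum M using (sum; sum-permute; sum-cong-≋)

    -- Stated for any commutative monoid because it serves twice: additively for translation by 1,
    -- multiplicatively for multiplication by a non-zero element.
    sum-reindex : {F : Carrier → M.Carrier} → (∀ {x y} → x ≈ y → F x M.≈ F y) →
      (f g : Carrier → Carrier) → (∀ {x y} → x ≈ y → f x ≈ f y) → (∀ {x y} → x ≈ y → g x ≈ g y) →
      (∀ x → f (g x) ≈ x) → (∀ x → g (f x) ≈ x) →
      sum (F ∘ to) M.≈ sum (F ∘ f ∘ to)
    sum-reindex {F} F-cong f g f-cong g-cong fg gf =
      M.trans (sum-permute (F ∘ to) π) (sum-cong-≋ (λ i → F-cong (strictlyInverseˡ (f (to i)))))
      where
      π : Permutation N N
      π = permutation (from ∘ f ∘ to) (from ∘ g ∘ to)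
        ( (λ i → ≡.trans (from-cong (trans (f-cong (strictlyInverseˡ _)) (fg _))) (strictlyInverseʳ i)))
        ( (λ i → ≡.trans (from-cong (trans (g-cong (strictlyInverseˡ _)) (gf _))) (strictlyInverseʳ i)))

  open SemiringMult semiring using (×1-homo-*) renaming (_×_ to _·_)
  open MonoidSum +-commutativeMonoid using (∑-distrib-+; sum-replicate; sum)

  -- Translation by 1 permutes the field, so the sum S of all elements satisfies S = S + N · 1.
  N·1≈0 : N · 1# ≈ 0#
  N·1≈0 = begin
    N · 1#                          ≈⟨ +-identityˡ _ ⟨
    0# + N · 1#                     ≈⟨ +-congʳ (-‿inverseˡ S) ⟨
    - S + S + N · 1#                ≈⟨ +-assoc _ _ _ ⟩
    - S + (S + N · 1#)              ≈⟨ +-congˡ (+-congˡ (sum-replicate N)) ⟨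
    - S + (S + sum {N} (λ _ → 1#))  ≈⟨ +-congˡ (∑-distrib-+ to (λ _ → 1#)) ⟨
    - S + sum (λ i → to i + 1#)     ≈⟨ +-congˡ (sum-reindex +-commutativeMonoid (λ p → p) (_+ 1#) (_+ - 1#)
                                        +-congʳ +-congʳ (cancel (-‿inverseˡ 1#)) (cancel (-‿inverseʳ 1#))) ⟨
    - S + S                         ≈⟨ -‿inverseˡ S ⟩
    0# ∎
    where
    S : Carrier
    S = sum to
    cancel : ∀ {a b} → a + b ≈ 0# → ∀ x → x + a + b ≈ x
    cancel p x = trans (+-assoc x _ _) (trans (+-congˡ p) (+-identityʳ x))

  2^k·1 : ∀ k → (2 ℕ.^ k) · 1# ≈ (1# + 1#) ^ k
  2^k·1 zero    = +-identityʳ 1#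
  2^k·1 (suc k) = begin
    (2 ℕ.* 2 ℕ.^ k) · 1#         ≈⟨ ×1-homo-* 2 (2 ℕ.^ k) ⟩
    (2 · 1#) * ((2 ℕ.^ k) · 1#)  ≈⟨ *-cong (+-congˡ (+-identityʳ 1#)) (2^k·1 k) ⟩
    (1# + 1#) * (1# + 1#) ^ k ∎

  -- (1 + 1)^k is the N-fold sum of 1, hence 0, and a field has no nilpotent elements except 0.
  characteristicTwo : ∀ {k} → N ≡ 2 ℕ.^ k → 1# + 1# ≈ 0#
  characteristicTwo {k} ≡.refl = ^≈0⇒≈0 k (trans (sym (2^k·1 k)) N·1≈0)

  open MonoidSum *-commutativeMonoid using ()
    renaming (sum to product; ∑-distrib-+ to product-distrib-*; sum-cong-≋ to product-cong; sum-replicate to product-replicate)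

  product-≉0 : ∀ {n} (t : Vector Carrier n) → (∀ i → ¬ t i ≈ 0#) → ¬ product t ≈ 0#
  product-≉0 {zero}  t p = 1≉0
  product-≉0 {suc n} t p = *-≉0 (p zero) (product-≉0 (t ∘ suc) (p ∘ suc))

  private
    ifZero : Carrier → Carrier → Carrier → Carrier
    ifZero x a b with x ≟ 0#
    ... | yes _ = a
    ... | no  _ = b

    ifZero-yes : ∀ {x a b} → x ≈ 0# → ifZero x a b ≈ a
    ifZero-yes {x} p with x ≟ 0#
    ... | yes _ = refl
    ... | no ¬p = contradiction p ¬p

    ifZero-no : ∀ {x a b} → ¬ x ≈ 0# → ifZero x a b ≈ b
    ifZero-no {x} p with x ≟ 0#
    ... | yes q = contradiction q p
    ... | no _  = refl

  -- The classical product over the non-zero elements, run over the whole enumeration to avoid the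
  -- exponent N - 1. `g` puts 1 in place of the element 0, and g(a x) = h(x) g(x) with h = a except
  -- h(0) = 1; as x ↦ a x is a permutation, the product of all h(x) is 1. The constant a is h(x)
  -- k(x), where `k` is 1 except k(0) = a, so a^N is the product of all k(x), which is a.
  fermat : ∀ a → a ^ N ≈ a
  fermat a with a ≟ 0#
  ... | yes a≈0 = trans (^-congˡ N a≈0) (trans (0^N (from 0#)) (sym a≈0))
    where
    0^N : ∀ {n} → Fin n → 0# ^ n ≈ 0#
    0^N {suc n} _ = zeroˡ _
  ... | no a≉0 with a⁻¹ , aa⁻¹≈1 ← invertible a a≉0 = begin
    a ^ N                                          ≈⟨ product-replicate N ⟨
    product {N} (λ _ → a)                          ≈⟨ product-cong (λ i → h*k (to i)) ⟨
    product (λ i → h (to i) * k (to i))            ≈⟨ product-distrib-* (h ∘ to) (k ∘ to) ⟩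
    product (h ∘ to) * product (k ∘ to)            ≈⟨ *-congʳ Πh≈1 ⟩
    1# * product (k ∘ to)                          ≈⟨ *-identityˡ _ ⟩
    product (k ∘ to)                               ≈⟨ sum-single *-commutativeMonoid (k ∘ to) (from 0#)
                                                       (λ j j≢ → ifZero-no (λ p → j≢ (≡.trans (≡.sym (strictlyInverseʳ j)) (from-cong p)))) ⟩
    k (to (from 0#))                               ≈⟨ ifZero-yes (strictlyInverseˡ 0#) ⟩
    a ∎
    where
    g h k : Carrier → Carrier
    g x = ifZero x 1# x
    h x = ifZero x 1# a
    k x = ifZero x a 1#

    h*k : ∀ x → h x * k x ≈ a
    h*k x with x ≟ 0#
    ... | yes _ = *-identityˡ a
    ... | no _  = *-identityʳ a

    g-cong : ∀ {x y} → x ≈ y → g x ≈ g y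
    g-cong {x} {y} x≈y with x ≟ 0# | y ≟ 0#
    ... | yes _ | yes _ = refl
    ... | yes p | no ¬q = contradiction (trans (sym x≈y) p) ¬q
    ... | no ¬p | yes q = contradiction (trans x≈y q) ¬p
    ... | no _  | no _  = x≈y

    g-≉0 : ∀ x → ¬ g x ≈ 0#
    g-≉0 x with x ≟ 0#
    ... | yes _ = 1≉0
    ... | no ¬p = ¬p

    g-* : ∀ x → g (a * x) ≈ h x * g x
    g-* x with x ≟ 0#
    ... | yes p = trans (ifZero-yes (trans (*-congˡ p) (zeroʳ a))) (sym (*-identityˡ 1#))
    ... | no ¬p = ifZero-no (*-≉0 a≉0 ¬p)

    cancel : ∀ {b d} → b * d ≈ 1# → ∀ x → b * (d * x) ≈ x
    cancel p x = trans (sym (*-assoc _ _ x)) (trans (*-congʳ p) (*-identityˡ x))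

    Πh≈1 : product (h ∘ to) ≈ 1#
    Πh≈1 = *-cancelˡ-≉0 (product-≉0 (g ∘ to) (g-≉0 ∘ to)) (begin
      product (g ∘ to) * product (h ∘ to)    ≈⟨ *-comm _ _ ⟩
      product (h ∘ to) * product (g ∘ to)    ≈⟨ product-distrib-* (h ∘ to) (g ∘ to) ⟨
      product (λ i → h (to i) * g (to i))    ≈⟨ product-cong (λ i → g-* (to i)) ⟨
      product (λ i → g (a * to i))           ≈⟨ sum-reindex *-commutativeMonoid g-cong (a *_) (a⁻¹ *_) *-congˡ *-congˡ
                                                  (cancel aa⁻¹≈1) (cancel (trans (*-comm _ _) aa⁻¹≈1)) ⟨
      product (g ∘ to)                       ≈⟨ *-identityʳ _ ⟨
      product (g ∘ to) * 1# ∎)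

-- Linear algebra: elimination, dimension bounds, spans.

module LinearAlgebra {c ℓ N} (K : FiniteField c ℓ N) where
  open FiniteField K hiding (zero)
  open CommutativeRing commutativeRing using (setoid)
  open SetoidReasoning setoid
  open FieldProperties K
  open SemiringSum semiring using (sum; sum-cong-≋; ∑-distrib-+; ∑-comm; *-distribˡ-sum; *-distribʳ-sum)
  open RingProperties ring using (-‿distribˡ-*)
  open ProjectiveGeometry commutativeRing

  infix 8 _•_
  _•_ : ∀ {n} → Vector Carrier n → Vector Carrier n → Carrier
  x • y = sum (λ j → x j * y j)

  •-linearʳ : ∀ {n} (x y z : Vector Carrier n) a → x • (λ j → y j + a * z j) ≈ x • y + a * x • z
  •-linearʳ x y z a = begin
    sum (λ j → x j * (y j + a * z j))         ≈⟨ sum-cong-≋ (λ j → trans (distribˡ (x j) (y j) (a * z j))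
                                                   (+-congˡ (trans (sym (*-assoc _ _ _)) (trans (*-congʳ (*-comm _ _)) (*-assoc _ _ _))))) ⟩
    sum (λ j → x j * y j + a * (x j * z j))   ≈⟨ ∑-distrib-+ (λ j → x j * y j) (λ j → a * (x j * z j)) ⟩
    x • y + sum (λ j → a * (x j * z j))       ≈⟨ +-congˡ (*-distribˡ-sum a (λ j → x j * z j)) ⟨
    x • y + a * x • z ∎

  -- Elimination of the first unknown. If no equation contains it, the first unit vector is a
  -- solution. Otherwise a pivot row p clears it from the other rows, a solution of the smaller
  -- system is taken, and row p gives the value of the first unknown.
  homogeneousSystem : ∀ {m n} → m ℕ.< n → (A : Fin m → Vector Carrier n) →
    ∃ λ x → (∃ λ j → ¬ x j ≈ 0#) × (∀ i → x • A i ≈ 0#)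
  homogeneousSystem {zero}  {suc n} _ A = (λ _ → 1#) , (zero , 1≉0) , λ ()
  homogeneousSystem {suc m} {suc n} (ℕ.s≤s m<n) A with Fin.any? (λ i → ¬? (A i zero ≟ 0#))
  ... | no ¬pivot = e₀ , (zero , 1≉0) , λ i → begin
    1# * A i zero + sum (λ j → 0# * A i (suc j))  ≈⟨ +-cong (trans (*-identityˡ _) (decidable-stable (A i zero ≟ 0#) (λ p → ¬pivot (i , p))))
                                                       (sum-zero +-commutativeMonoid (λ j → zeroˡ (A i (suc j)))) ⟩
    0# + 0#                                       ≈⟨ +-identityˡ 0# ⟩
    0# ∎
    where
    e₀ : Vector Carrier (suc n)
    e₀ zero    = 1#
    e₀ (suc _) = 0#
  ... | yes (p , a≉0) with y , (j , yj≉0) , sol ← homogeneousSystem {m} m<n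
                             (λ k j → A (punchIn p k) (suc j) + - (A (punchIn p k) zero * proj₁ (invertible (A p zero) a≉0)) * A p (suc j)) =
    x , (suc j , yj≉0) , solves
    where
    T : Fin (suc m) → Carrier
    T i = y • (A i ∘ suc)
    b′ = proj₁ (invertible (A p zero) a≉0)
    ab′≈1 = proj₂ (invertible (A p zero) a≉0)
    x : Vector Carrier (suc n)
    x zero    = - b′ * T p
    x (suc j) = y j
    solves : ∀ i → x • A i ≈ 0#
    solves i with p Fin.≟ i
    ... | yes ≡.refl = begin
      - b′ * T p * A p zero + T p    ≈⟨ +-congʳ (trans (*-assoc _ _ _) (trans (*-congˡ (*-comm _ _)) (sym (*-assoc _ _ _)))) ⟩
      - b′ * A p zero * T p + T p    ≈⟨ +-cong (*-congʳ (trans (sym (-‿distribˡ-* _ _)) (-‿cong (trans (*-comm _ _) ab′≈1)))) (sym (*-identityˡ _)) ⟩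
      - 1# * T p + 1# * T p          ≈⟨ distribʳ (T p) (- 1#) 1# ⟨
      (- 1# + 1#) * T p              ≈⟨ *-congʳ (-‿inverseˡ 1#) ⟩
      0# * T p                       ≈⟨ zeroˡ _ ⟩
      0# ∎
    ... | no p≢i = begin
      - b′ * T p * A i zero + T i    ≈⟨ +-congʳ (trans (*-comm _ _) (trans (sym (*-assoc _ _ _)) (*-congʳ (trans (*-comm _ _)
                                          (trans (sym (-‿distribˡ-* _ _)) (-‿cong (*-comm _ _))))))) ⟩
      - (A i zero * b′) * T p + T i  ≈⟨ +-comm _ _ ⟩
      T i + - (A i zero * b′) * T p  ≈⟨ •-linearʳ y (A i ∘ suc) (A p ∘ suc) (- (A i zero * b′)) ⟨
      y • (λ j → A i (suc j) + - (A i zero * b′) * A p (suc j))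
        ≡⟨ ≡.cong (λ i → y • (λ j → A i (suc j) + - (A i zero * b′) * A p (suc j))) (Fin.punchIn-punchOut p≢i) ⟨
      _                              ≈⟨ sol (punchOut p≢i) ⟩
      0# ∎

  combination-assoc : ∀ {m d n} (x : Vector Carrier m) (A : Fin m → Vector Carrier d) (b : Vector (Vector Carrier n) d) i →
    x • (λ j → combination (A j) b i) ≈ combination (λ k → x • (λ j → A j k)) b i
  combination-assoc x A b i = begin
    sum (λ j → x j * sum (λ k → A j k * b k i))    ≈⟨ sum-cong-≋ (λ j → *-distribˡ-sum (x j) (λ k → A j k * b k i)) ⟩
    sum (λ j → sum (λ k → x j * (A j k * b k i)))  ≈⟨ ∑-comm (λ j k → x j * (A j k * b k i)) ⟩
    sum (λ k → sum (λ j → x j * (A j k * b k i)))  ≈⟨ sum-cong-≋ (λ k → sum-cong-≋ (λ j → *-assoc (x j) (A j k) (b k i))) ⟨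
    sum (λ k → sum (λ j → x j * A j k * b k i))    ≈⟨ sum-cong-≋ (λ k → *-distribʳ-sum (b k i) (λ j → x j * A j k)) ⟨
    sum (λ k → sum (λ j → x j * A j k) * b k i)    ∎

  zero-combination : ∀ {d n} {a : Vector Carrier d} (b : Vector (Vector Carrier n) d) → (∀ j → a j ≈ 0#) → ∀ i → combination a b i ≈ 0#
  zero-combination b p i = sum-zero +-commutativeMonoid (λ j → trans (*-congʳ (p j)) (zeroˡ (b j i)))

  -- In coordinates with respect to the basis, a relation among the `v j` is a system of d equations
  -- in m unknowns, which has a non-zero solution as soon as m > d.
  independent⇒≤ : ∀ {m d n} {U : LinearSubspace n} {b : Vector (Vector Carrier n) d} → IsBasis U b →
    (v : Vector (Vector Carrier n) m) → (∀ j → member U (v j)) →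
    (∀ a → (∀ i → combination a v i ≈ 0#) → ∀ j → a j ≈ 0#) → m ℕ.≤ d
  independent⇒≤ {m} {d} {b = b} basis v v∈U independent with m ℕ.≤? d
  ... | yes m≤d = m≤d
  ... | no m≰d with x , (j , xj≉0) , sol ← homogeneousSystem (ℕ.≰⇒> m≰d) (λ k j → proj₁ (IsBasis.generates basis (v j) (v∈U j)) k) =
    contradiction (independent x (λ i → begin
      combination x v i   ≈⟨ sum-cong-≋ (λ j → *-congˡ (proj₂ (IsBasis.generates basis (v j) (v∈U j)) i)) ⟩
      x • (λ j → combination (A j) b i)  ≈⟨ combination-assoc x A b i ⟩
      combination (λ k → x • (λ j → A j k)) b i  ≈⟨ zero-combination b sol i ⟩
      0# ∎) j) xj≉0
    where
    A : Fin m → Vector Carrier d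
    A j = proj₁ (IsBasis.generates basis (v j) (v∈U j))

  combination∈ : ∀ {d n} (U : LinearSubspace n) (a : Vector Carrier d) {b : Vector (Vector Carrier n) d} →
    (∀ j → member U (b j)) → member U (combination a b)
  combination∈ {zero}  U a p = LinearSubspace.0-closed U
  combination∈ {suc d} U a p = LinearSubspace.+-closed U (LinearSubspace.*-closed U (a zero) (p zero)) (combination∈ U (a ∘ suc) (p ∘ suc))

  combination-* : ∀ {d n} k (a : Vector Carrier d) (b : Vector (Vector Carrier n) d) i →
    combination (λ j → k * a j) b i ≈ k * combination a b i
  combination-* k a b i = trans (sum-cong-≋ (λ j → *-assoc k (a j) (b j i))) (sym (*-distribˡ-sum k (λ j → a j * b j i)))

  combination-+ : ∀ {d n} (a a′ : Vector Carrier d) (b : Vector (Vector Carrier n) d) i →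
    combination (λ j → a j + a′ j) b i ≈ combination a b i + combination a′ b i
  combination-+ a a′ b i = trans (sum-cong-≋ (λ j → distribʳ (b j i) (a j) (a′ j))) (∑-distrib-+ (λ j → a j * b j i) (λ j → a′ j * b j i))

  Independent : ∀ {d n} → Vector (Vector Carrier n) d → Set (c Level.⊔ ℓ)
  Independent b = ∀ a → (∀ i → combination a b i ≈ 0#) → ∀ j → a j ≈ 0#

  -- Among y and the d vectors of `b` there are d + 1 unknown coefficients, and fewer than that many
  -- `rows` to satisfy; `determined` extends the resulting relation to all rows. Independence of `b`
  -- forces a non-zero coefficient at y, which can be divided out. Passing a selection of rows
  -- covers both a basis of the whole space and a basis of a hyperplane, where one row follows from
  -- the others.
  preimage : ∀ {m d n} (b : Vector (Vector Carrier n) d) → Independent b → (y : Vector Carrier n) (rows : Fin m → Fin n) → m ℕ.< suc d →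
    (∀ x → (∀ i → combination x (y Vector.∷ b) (rows i) ≈ 0#) → ∀ i → combination x (y Vector.∷ b) i ≈ 0#) →
    ∃ λ a → ∀ i → combination a b i ≈ y i
  preimage {d = d} b independent y rows m<1+d determined = (λ j → - w * x (suc j)) , λ i → begin
    combination (λ j → - w * x (suc j)) b i    ≈⟨ combination-* (- w) (x ∘ suc) b i ⟩
    - w * combination (x ∘ suc) b i            ≈⟨ -‿distribˡ-* w _ ⟨
    - (w * combination (x ∘ suc) b i)          ≈⟨ +-identityʳ _ ⟨
    - (w * combination (x ∘ suc) b i) + 0#     ≈⟨ +-congˡ (trans (*-congˡ (relation i)) (zeroʳ w)) ⟨
    - (w * combination (x ∘ suc) b i) + w * (x zero * y i + combination (x ∘ suc) b i)
      ≈⟨ +-congˡ (trans (distribˡ w _ _) (+-cong (trans (sym (*-assoc w (x zero) (y i))) (*-congʳ (trans (*-comm w (x zero)) xw≈1))) refl)) ⟩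
    - (w * combination (x ∘ suc) b i) + (1# * y i + w * combination (x ∘ suc) b i)
      ≈⟨ trans (+-congˡ (+-comm _ _)) (sym (+-assoc _ _ _)) ⟩
    - (w * combination (x ∘ suc) b i) + w * combination (x ∘ suc) b i + 1# * y i
      ≈⟨ +-cong (-‿inverseˡ _) (*-identityˡ (y i)) ⟩
    0# + y i                                   ≈⟨ +-identityˡ (y i) ⟩
    y i ∎
    where
    solution = homogeneousSystem m<1+d (λ i j → (y Vector.∷ b) j (rows i))
    x = proj₁ solution
    relation : ∀ i → combination x (y Vector.∷ b) i ≈ 0#
    relation = determined x (proj₂ (proj₂ solution))
    x₀≉0 : ¬ x zero ≈ 0#
    x₀≉0 x₀≈0 = proj₂ (proj₁ (proj₂ solution)) (all-zero (proj₁ (proj₁ (proj₂ solution))))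
      where
      all-zero : ∀ j → x j ≈ 0#
      all-zero zero    = x₀≈0
      all-zero (suc j) = independent (x ∘ suc) (λ i → trans (sym (trans (+-congʳ (trans (*-congʳ x₀≈0) (zeroˡ (y i)))) (+-identityˡ _))) (relation i)) j
    w = proj₁ (invertible (x zero) x₀≉0)
    xw≈1 = proj₂ (invertible (x zero) x₀≉0)

  spanned : ∀ {d n} → Vector (Vector Carrier n) d → LinearSubspace n
  spanned b = record
    { member   = λ v → ∃ λ a → ∀ i → v i ≈ combination a b i
    ; resp-≋   = λ v≈w (a , p) → a , λ i → trans (sym (v≈w i)) (p i)
    ; 0-closed = (λ _ → 0#) , λ i → sym (zero-combination b (λ _ → refl) i)
    ; +-closed = λ (a , p) (a′ , p′) → (λ j → a j + a′ j) , λ i → trans (+-cong (p i) (p′ i)) (sym (combination-+ a a′ b i))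
    ; *-closed = λ k (a , p) → (λ j → k * a j) , λ i → trans (*-congˡ (p i)) (sym (combination-* k a b i))
    }

  spanned-basis : ∀ {d n} {b : Vector (Vector Carrier n) d} → Independent b → IsBasis (spanned b) b
  spanned-basis {d} {n} {b} independent = record
    { members     = λ j → unit j , λ i → sym (begin
        sum (λ k → unit j k * b k i)   ≈⟨ sum-single +-commutativeMonoid (λ k → unit j k * b k i) j
                                             (λ k k≢j → trans (*-congʳ (unit-other k≢j)) (zeroˡ (b k i))) ⟩
        unit j j * b j i               ≈⟨ trans (*-congʳ (unit-same j)) (*-identityˡ (b j i)) ⟩
        b j i ∎)
    ; independent = independent
    ; generates   = λ v v∈ → v∈
    }
    where
    unit : Fin d → Vector Carrier d
    unit j k with k Fin.≟ j
    ... | yes _ = 1#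
    ... | no  _ = 0#
    unit-same : ∀ j → unit j j ≈ 1#
    unit-same j with j Fin.≟ j
    ... | yes _  = refl
    ... | no j≢j = contradiction ≡.refl j≢j
    unit-other : ∀ {j k} → ¬ k ≡ j → unit j k ≈ 0#
    unit-other {j} {k} k≢j with k Fin.≟ j
    ... | yes k≡j = contradiction k≡j k≢j
    ... | no _    = refl

  span-least : ∀ {r} {Ω : PointSet r} (U : Subspace r) → (∀ P → Ω P → member U (coordinates P)) → ∀ {v} → Span Ω v → member U v
  span-least U p (point P P∈Ω) = p P P∈Ω
  span-least U p (resp v≋w v∈) = LinearSubspace.resp-≋ U v≋w (span-least U p v∈)
  span-least U p zeroᵥ         = LinearSubspace.0-closed U
  span-least U p (plus v∈ w∈)  = LinearSubspace.+-closed U (span-least U p v∈) (span-least U p w∈)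
  span-least U p (scale a v∈)  = LinearSubspace.*-closed U a (span-least U p v∈)

  -- `ι` selects the coordinates seen by ψ; with `inject₁` the last one is ignored, so that the
  -- functional factors through the projection from the vertex.
  annihilator : ∀ {m n} → Vector Carrier m → (Fin m → Fin n) → LinearSubspace n
  annihilator ψ ι = record
    { member   = λ v → Level.Lift c (ψ • (v ∘ ι) ≈ 0#)
    ; resp-≋   = λ v≋w (Level.lift p) → Level.lift (trans (sum-cong-≋ (λ i → *-congˡ (sym (v≋w (ι i))))) p)
    ; 0-closed = Level.lift (sum-zero +-commutativeMonoid (λ i → zeroʳ (ψ i)))
    ; +-closed = λ {v} {w} (Level.lift p) (Level.lift r) → Level.lift (begin
        ψ • (λ i → v (ι i) + w (ι i))          ≈⟨ sum-cong-≋ (λ i → *-congˡ (+-congˡ (*-identityˡ (w (ι i))))) ⟨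
        ψ • (λ i → v (ι i) + 1# * w (ι i))     ≈⟨ •-linearʳ ψ (v ∘ ι) (w ∘ ι) 1# ⟩
        ψ • (v ∘ ι) + 1# * ψ • (w ∘ ι)         ≈⟨ +-cong p (trans (*-congˡ r) (zeroʳ 1#)) ⟩
        0# + 0#                                ≈⟨ +-identityʳ 0# ⟩
        0# ∎)
    ; *-closed = λ a {v} (Level.lift p) → Level.lift (begin
        ψ • (λ i → a * v (ι i))                ≈⟨ sum-cong-≋ (λ i → *-congˡ (+-identityˡ (a * v (ι i)))) ⟨
        ψ • (λ i → 0# + a * v (ι i))           ≈⟨ •-linearʳ ψ (λ _ → 0#) (v ∘ ι) a ⟩
        ψ • (λ _ → 0#) + a * ψ • (v ∘ ι)       ≈⟨ +-cong (sum-zero +-commutativeMonoid (λ i → zeroʳ (ψ i))) (trans (*-congˡ p) (zeroʳ a)) ⟩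
        0# + 0#                                ≈⟨ +-identityʳ 0# ⟩
        0# ∎)
    }

-- Formal polynomials: collecting terms, degree, homogenization.

Vec-sum-replicate : ∀ n → Vec.sum (replicate n 0) ≡ 0
Vec-sum-replicate zero    = ≡.refl
Vec-sum-replicate (suc n) = Vec-sum-replicate n

Vec-sum-unit : ∀ {n} (i : Fin n) → Vec.sum (replicate n 0 [ i ]≔ 1) ≡ 1
Vec-sum-unit {suc n} zero    = ≡.cong suc (Vec-sum-replicate n)
Vec-sum-unit {suc n} (suc i) = Vec-sum-unit i

Vec-sum-zipWith : ∀ {n} (α β : Vec ℕ n) → Vec.sum (zipWith ℕ._+_ α β) ≡ Vec.sum α ℕ.+ Vec.sum β
Vec-sum-zipWith Vec.[] Vec.[] = ≡.refl
Vec-sum-zipWith (a Vec.∷ α) (b Vec.∷ β) = ≡.trans (≡.cong (a ℕ.+ b ℕ.+_) (Vec-sum-zipWith α β))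
  (interchange a b (Vec.sum α) (Vec.sum β))
  where open CommutativeSemigroupProperties ℕ.+-commutativeSemigroup using (interchange)

∸-split : ∀ {a d d′} → a ℕ.≤ d → d ℕ.≤ d′ → d′ ℕ.∸ a ≡ (d′ ℕ.∸ d) ℕ.+ (d ℕ.∸ a)
∸-split {a} {d} {d′} a≤d d≤d′ = ≡.trans (≡.cong (ℕ._∸ a) (≡.sym (ℕ.m∸n+n≡m d≤d′))) (ℕ.+-∸-assoc (d′ ℕ.∸ d) a≤d)

+-∸-+ : ∀ {a b d d′} → a ℕ.≤ d → b ℕ.≤ d′ → (d ℕ.+ d′) ℕ.∸ (a ℕ.+ b) ≡ (d ℕ.∸ a) ℕ.+ (d′ ℕ.∸ b)
+-∸-+ {a} {b} {d} {d′} a≤d b≤d′ = ≡.trans (≡.sym (ℕ.∸-+-assoc (d ℕ.+ d′) a b))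
  (≡.trans (≡.cong (ℕ._∸ b) (ℕ.+-∸-comm d′ a≤d)) (ℕ.+-∸-assoc (d ℕ.∸ a) b≤d′))

module Homogenization {c ℓ} (R : CommutativeRing c ℓ) (_≟_ : Decidable₂ (CommutativeRing._≈_ R)) where
  open CommutativeRing R hiding (zero)
  open import Data.List.Relation.Unary.All using (All; []; _∷_)
  open import Data.List.Base using ([]; _∷_; _++_; filter; foldr)
  open Exp commutativeSemiring
  open SetoidReasoning setoid
  open MonoidSum *-commutativeMonoid using ()
    renaming (sum to product; ∑-distrib-+ to product-distrib-*; sum-cong-≋ to product-cong)
  open CommutativeSemigroupProperties +-commutativeSemigroup using () renaming (x∙yz≈y∙xz to x+[y+z]≈y+[x+z])
  open CommutativeSemigroupProperties *-commutativeSemigroup using () renaming (interchange to *-interchange; x∙yz≈y∙xz to x*[y*z]≈y*[x*z])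
  open Polynomials R _≟_

  -- Evaluation with the monomials replaced by an arbitrary function of the exponents. It covers
  -- homogenized evaluation in any prescribed degree and permits selecting terms by their exponents.
  weightedSum : ∀ {n} → Polynomial n → (Vec ℕ n → Carrier) → Carrier
  weightedSum f w = foldr _+_ 0# (List.map (λ (a , α) → a * w α) f)

  without : ∀ {n} → Vec ℕ n → Polynomial n → Polynomial n
  without α = filter (λ t → ¬? (Vec.≡-dec ℕ._≟_ (proj₂ t) α))

  coefficient-here : ∀ {n} a (α : Vec ℕ n) g → coefficient ((a , α) ∷ g) α ≡ a + coefficient g α
  coefficient-here a α g = ≡.cong (foldr _+_ 0# ∘ List.map proj₁)
    (List.filter-accept (λ t → Vec.≡-dec ℕ._≟_ (proj₂ t) α) ≡.refl)

  coefficient-there : ∀ {n} a {α β : Vec ℕ n} g → ¬ α ≡ β → coefficient ((a , α) ∷ g) β ≡ coefficient g β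
  coefficient-there a {α} {β} g α≢β = ≡.cong (foldr _+_ 0# ∘ List.map proj₁)
    (List.filter-reject (λ t → Vec.≡-dec ℕ._≟_ (proj₂ t) β) α≢β)

  coefficient-without-same : ∀ {n} (α : Vec ℕ n) g → coefficient (without α g) α ≡ 0#
  coefficient-without-same α [] = ≡.refl
  coefficient-without-same α ((b , β) ∷ g) with Vec.≡-dec ℕ._≟_ β α
  ... | yes ≡.refl = coefficient-without-same α g
  ... | no β≢α     = ≡.trans (coefficient-there b (without α g) β≢α) (coefficient-without-same α g)

  coefficient-without-other : ∀ {n} {α β : Vec ℕ n} g → ¬ α ≡ β → coefficient (without α g) β ≡ coefficient g β
  coefficient-without-other [] α≢β = ≡.refl
  coefficient-without-other {α = α} {β} ((b , γ) ∷ g) α≢β with Vec.≡-dec ℕ._≟_ γ α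
  ... | yes ≡.refl = ≡.trans (coefficient-without-other g α≢β) (≡.sym (coefficient-there b g α≢β))
  ... | no γ≢α with Vec.≡-dec ℕ._≟_ γ β
  ...   | yes ≡.refl = ≡.cong (b +_) (coefficient-without-other g α≢β)
  ...   | no γ≢β     = coefficient-without-other g α≢β

  weightedSum-without : ∀ {n} (α : Vec ℕ n) g w → weightedSum g w ≈ coefficient g α * w α + weightedSum (without α g) w
  weightedSum-without α [] w = sym (trans (+-identityʳ _) (zeroˡ (w α)))
  weightedSum-without α ((b , β) ∷ g) w with Vec.≡-dec ℕ._≟_ β α
  ... | yes ≡.refl = begin
    b * w α + weightedSum g w                                           ≈⟨ +-congˡ (weightedSum-without α g w) ⟩
    b * w α + (coefficient g α * w α + weightedSum (without α g) w)     ≈⟨ +-assoc _ _ _ ⟨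
    b * w α + coefficient g α * w α + weightedSum (without α g) w       ≈⟨ +-congʳ (distribʳ (w α) b (coefficient g α)) ⟨
    (b + coefficient g α) * w α + weightedSum (without α g) w ∎
  ... | no β≢α = begin
    b * w β + weightedSum g w                                           ≈⟨ +-congˡ (weightedSum-without α g w) ⟩
    b * w β + (coefficient g α * w α + weightedSum (without α g) w)     ≈⟨ x+[y+z]≈y+[x+z] _ _ _ ⟩
    coefficient g α * w α + (b * w β + weightedSum (without α g) w) ∎

  -- All terms with the leading exponent are collected and removed together. The remaining list is
  -- shorter but not a structural part of `f`, so the recursion is on a bound k for the length.
  weightedSum-vanishes : ∀ {n} k (f : Polynomial n) → List.length f ℕ.≤ k → ∀ w →
    (∀ α → coefficient f α * w α ≈ 0#) → weightedSum f w ≈ 0#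
  weightedSum-vanishes k       []            _            w p = refl
  weightedSum-vanishes (suc k) ((a , α) ∷ g) (ℕ.s≤s g≤k)  w p = begin
    a * w α + weightedSum g w                                           ≈⟨ +-congˡ (weightedSum-without α g w) ⟩
    a * w α + (coefficient g α * w α + weightedSum (without α g) w)     ≈⟨ +-assoc _ _ _ ⟨
    a * w α + coefficient g α * w α + weightedSum (without α g) w       ≈⟨ +-cong (sym (distribʳ (w α) a (coefficient g α)))
      (weightedSum-vanishes k (without α g) (ℕ.≤-trans (List.length-filter _ g) g≤k) w rest) ⟩
    (a + coefficient g α) * w α + 0#                                    ≈⟨ +-identityʳ _ ⟩
    (a + coefficient g α) * w α                                         ≡⟨ ≡.cong (_* w α) (coefficient-here a α g) ⟨
    coefficient ((a , α) ∷ g) α * w α                                   ≈⟨ p α ⟩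
    0# ∎
    where
    rest : ∀ β → coefficient (without α g) β * w β ≈ 0#
    rest β with Vec.≡-dec ℕ._≟_ α β
    ... | yes ≡.refl = trans (*-congʳ (reflexive (coefficient-without-same α g))) (zeroˡ (w α))
    ... | no α≢β     = trans (*-congʳ (reflexive (≡.trans (coefficient-without-other g α≢β) (≡.sym (coefficient-there a g α≢β))))) (p β)

  weightedSum-support : ∀ {n} (f : Polynomial n) w → weightedSum (support f) w ≈ weightedSum f w
  weightedSum-support {n} f w = begin
    weightedSum (support f) w                        ≈⟨ +-identityʳ _ ⟨
    weightedSum (support f) w + 0#                   ≈⟨ +-congˡ (weightedSum-vanishes _ f ℕ.≤-refl w₀ w₀-vanishes) ⟨
    weightedSum (support f) w + weightedSum f w₀     ≈⟨ split f ⟩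
    weightedSum f w ∎
    where
    -- `w₀` keeps the weights exactly at the exponents discarded by `support`. Its weighted sum is
    -- the discarded part, and it vanishes because each of those exponents has total coefficient 0.
    w₀ : Vec ℕ n → Carrier
    w₀ α with coefficient f α ≟ 0#
    ... | yes _ = w α
    ... | no  _ = 0#

    w₀-vanishes : ∀ α → coefficient f α * w₀ α ≈ 0#
    w₀-vanishes α with coefficient f α ≟ 0#
    ... | yes p = trans (*-congʳ p) (zeroˡ (w α))
    ... | no _  = zeroʳ _

    split : ∀ g → weightedSum (filter (λ t → ¬? (coefficient f (proj₂ t) ≟ 0#)) g) w + weightedSum g w₀ ≈ weightedSum g w
    split [] = +-identityˡ 0#
    split ((b , β) ∷ g) with coefficient f β ≟ 0#
    ... | yes _ = trans (x+[y+z]≈y+[x+z] _ _ _) (+-congˡ (split g))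
    ... | no _  = trans (+-assoc _ _ _) (+-congˡ (trans (+-congˡ (trans (+-congʳ (zeroʳ b)) (+-identityˡ _))) (split g)))

  weightedSum-++ : ∀ {n} (f g : Polynomial n) w → weightedSum (f ++ g) w ≈ weightedSum f w + weightedSum g w
  weightedSum-++ []      g w = sym (+-identityˡ _)
  weightedSum-++ (t ∷ f) g w = trans (+-congˡ (weightedSum-++ f g w)) (sym (+-assoc _ _ _))

  Bounded : ∀ {n} → ℕ → Polynomial n → Set c
  Bounded d = All (λ t → Vec.sum (proj₂ t) ℕ.≤ d)

  degree-bounds-support : ∀ {n} (f : Polynomial n) → Bounded (degree f) (support f)
  degree-bounds-support f = go (support f)
    where
    go : ∀ g → Bounded (foldr ℕ._⊔_ 0 (List.map (Vec.sum ∘ proj₂) g)) g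
    go []      = []
    go (t ∷ g) = ℕ.m≤m⊔n _ _ ∷ All.map (λ p → ℕ.≤-trans p (ℕ.m≤n⊔m (Vec.sum (proj₂ t)) _)) (go g)

  degree-≤ : ∀ {n d} {f : Polynomial n} → Bounded d f → degree f ℕ.≤ d
  degree-≤ {d = d} {f} p = go (AllProperties.filter⁺ _ p)
    where
    go : ∀ {g} → Bounded d g → foldr ℕ._⊔_ 0 (List.map (Vec.sum ∘ proj₂) g) ℕ.≤ d
    go []      = ℕ.z≤n
    go (q ∷ r) = ℕ.⊔-lub q (go r)

  module _ {n} (X : Vector Carrier (suc n)) where

    powers : Vec ℕ n → Carrier
    powers α = product (λ i → X (suc i) ^ lookup α i)

    monomial : ℕ → Vec ℕ n → Carrier
    monomial d α = X zero ^ (d ℕ.∸ Vec.sum α) * powers α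

    monomial-raise : ∀ {d d′ α} → Vec.sum α ℕ.≤ d → d ℕ.≤ d′ → monomial d′ α ≈ X zero ^ (d′ ℕ.∸ d) * monomial d α
    monomial-raise {d} {d′} {α} p q = begin
      X zero ^ (d′ ℕ.∸ Vec.sum α) * powers α                              ≈⟨ *-congʳ (^-congʳ (X zero) (∸-split p q)) ⟩
      X zero ^ ((d′ ℕ.∸ d) ℕ.+ (d ℕ.∸ Vec.sum α)) * powers α              ≈⟨ *-congʳ (^-homo-* (X zero) (d′ ℕ.∸ d) _) ⟩
      X zero ^ (d′ ℕ.∸ d) * X zero ^ (d ℕ.∸ Vec.sum α) * powers α         ≈⟨ *-assoc _ _ _ ⟩
      X zero ^ (d′ ℕ.∸ d) * monomial d α ∎

    monomial-* : ∀ {d d′ α β} → Vec.sum α ℕ.≤ d → Vec.sum β ℕ.≤ d′ →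
      monomial (d ℕ.+ d′) (zipWith ℕ._+_ α β) ≈ monomial d α * monomial d′ β
    monomial-* {d} {d′} {α} {β} p q = begin
      X zero ^ ((d ℕ.+ d′) ℕ.∸ Vec.sum (zipWith ℕ._+_ α β)) * powers (zipWith ℕ._+_ α β)
        ≈⟨ *-cong (^-congʳ (X zero) (≡.trans (≡.cong ((d ℕ.+ d′) ℕ.∸_) (Vec-sum-zipWith α β)) (+-∸-+ p q)))
                  (product-cong (λ i → trans (^-congʳ (X (suc i)) (Vec.lookup-zipWith ℕ._+_ i α β)) (^-homo-* (X (suc i)) (lookup α i) (lookup β i)))) ⟩
      X zero ^ ((d ℕ.∸ Vec.sum α) ℕ.+ (d′ ℕ.∸ Vec.sum β)) * product (λ i → X (suc i) ^ lookup α i * X (suc i) ^ lookup β i)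
        ≈⟨ *-cong (^-homo-* (X zero) (d ℕ.∸ Vec.sum α) _) (product-distrib-* (λ i → X (suc i) ^ lookup α i) (λ i → X (suc i) ^ lookup β i)) ⟩
      X zero ^ (d ℕ.∸ Vec.sum α) * X zero ^ (d′ ℕ.∸ Vec.sum β) * (powers α * powers β)
        ≈⟨ *-interchange _ _ _ _ ⟩
      monomial d α * monomial d′ β ∎

    -- X₀ ^ d · f (X₁ / X₀ , … , Xₙ / X₀) = v for an f of degree at most d.
    record HomogenizesTo (d : ℕ) (f : Polynomial n) (v : Carrier) : Set (c Level.⊔ ℓ) where
      field
        bounded : Bounded d f
        value   : weightedSum f (monomial d) ≈ v

    open HomogenizesTo

    homogenizesTo-≈ : ∀ {d f v w} → v ≈ w → HomogenizesTo d f v → HomogenizesTo d f w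
    homogenizesTo-≈ p F = record { bounded = bounded F ; value = trans (value F) p }

    homogenizesTo-con : ∀ a → HomogenizesTo 0 (con a) a
    homogenizesTo-con a = record
      { bounded = ℕ.≤-reflexive (Vec-sum-replicate n) ∷ []
      ; value   = begin
          a * (X zero ^ (0 ℕ.∸ Vec.sum (replicate n 0)) * powers (replicate n 0)) + 0#  ≈⟨ +-identityʳ _ ⟩
          a * (X zero ^ (0 ℕ.∸ Vec.sum (replicate n 0)) * powers (replicate n 0))
            ≈⟨ *-congˡ (*-cong (^-congʳ (X zero) (ℕ.0∸n≡0 (Vec.sum (replicate n 0))))
                 (sum-zero *-commutativeMonoid (λ i → ^-congʳ (X (suc i)) (Vec.lookup-replicate i 0)))) ⟩
          a * (1# * 1#)  ≈⟨ *-congˡ (*-identityˡ 1#) ⟩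
          a * 1#         ≈⟨ *-identityʳ a ⟩
          a ∎
      }

    homogenizesTo-var : ∀ i → HomogenizesTo 1 (var i) (X (suc i))
    homogenizesTo-var i = record
      { bounded = ℕ.≤-reflexive (Vec-sum-unit i) ∷ []
      ; value   = begin
          1# * (X zero ^ (1 ℕ.∸ Vec.sum α) * powers α) + 0#  ≈⟨ +-identityʳ _ ⟩
          1# * (X zero ^ (1 ℕ.∸ Vec.sum α) * powers α)       ≈⟨ *-identityˡ _ ⟩
          X zero ^ (1 ℕ.∸ Vec.sum α) * powers α
            ≈⟨ *-cong (^-congʳ (X zero) (≡.cong (1 ℕ.∸_) (Vec-sum-unit i)))
                 (sum-single *-commutativeMonoid _ i (λ j j≢i → ^-congʳ (X (suc j))
                   (≡.trans (Vec.lookup∘update′ j≢i (replicate n 0) 1) (Vec.lookup-replicate j 0)))) ⟩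
          1# * X (suc i) ^ lookup α i   ≈⟨ *-identityˡ _ ⟩
          X (suc i) ^ lookup α i        ≈⟨ ^-congʳ (X (suc i)) (Vec.lookup∘update i (replicate n 0) 1) ⟩
          X (suc i) * 1#                ≈⟨ *-identityʳ _ ⟩
          X (suc i) ∎
      }
      where
      α : Vec ℕ n
      α = replicate n 0 [ i ]≔ 1

    homogenizesTo-⊞ : ∀ {d f g v w} → HomogenizesTo d f v → HomogenizesTo d g w → HomogenizesTo d (f ⊞ g) (v + w)
    homogenizesTo-⊞ {d} {f} {g} F G = record
      { bounded = AllProperties.++⁺ (bounded F) (bounded G)
      ; value   = trans (weightedSum-++ f g (monomial d)) (+-cong (value F) (value G))
      }

    homogenizesTo-[] : ∀ {d} → HomogenizesTo d [] 0#
    homogenizesTo-[] = record { bounded = [] ; value = refl }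

    homogenizesTo-⊠ : ∀ {d d′ f g v w} → HomogenizesTo d f v → HomogenizesTo d′ g w → HomogenizesTo (d ℕ.+ d′) (f ⊠ g) (v * w)
    homogenizesTo-⊠ {d} {d′} {f} {g} F G = record
      { bounded = ⊠-bounded (bounded F)
      ; value   = trans (⊠-value (bounded F)) (*-cong (value F) (value G))
      }
      where
      term-bounded : ∀ {a α g} → Vec.sum α ℕ.≤ d → Bounded d′ g →
        Bounded (d ℕ.+ d′) (List.map (λ (b , β) → a * b , zipWith ℕ._+_ α β) g)
      term-bounded p [] = []
      term-bounded {α = α} {g = (_ , β) ∷ _} p (q ∷ r) =
        ℕ.≤-trans (ℕ.≤-reflexive (Vec-sum-zipWith α β)) (ℕ.+-mono-≤ p q) ∷ term-bounded p r

      ⊠-bounded : ∀ {f} → Bounded d f → Bounded (d ℕ.+ d′) (f ⊠ g)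
      ⊠-bounded []      = []
      ⊠-bounded (p ∷ q) = AllProperties.++⁺ (term-bounded p (bounded G)) (⊠-bounded q)

      term-value : ∀ {a α g} → Vec.sum α ℕ.≤ d → Bounded d′ g →
        weightedSum (List.map (λ (b , β) → a * b , zipWith ℕ._+_ α β) g) (monomial (d ℕ.+ d′)) ≈
        a * monomial d α * weightedSum g (monomial d′)
      term-value p [] = sym (zeroʳ _)
      term-value {a} {α} {(b , β) ∷ g} p (q ∷ r) = begin
        a * b * monomial (d ℕ.+ d′) (zipWith ℕ._+_ α β) + _
          ≈⟨ +-cong (trans (*-congˡ (monomial-* {α = α} {β} p q)) (*-interchange a b _ _)) (term-value p r) ⟩
        a * monomial d α * (b * monomial d′ β) + a * monomial d α * weightedSum g (monomial d′)
          ≈⟨ distribˡ _ _ _ ⟨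
        a * monomial d α * (b * monomial d′ β + weightedSum g (monomial d′)) ∎

      ⊠-value : ∀ {f} → Bounded d f →
        weightedSum (f ⊠ g) (monomial (d ℕ.+ d′)) ≈ weightedSum f (monomial d) * weightedSum g (monomial d′)
      ⊠-value [] = sym (zeroˡ _)
      ⊠-value {(a , α) ∷ f} (p ∷ q) = begin
        weightedSum (List.map (λ (b , β) → a * b , zipWith ℕ._+_ α β) g ++ f ⊠ g) (monomial (d ℕ.+ d′))
          ≈⟨ weightedSum-++ (List.map (λ (b , β) → a * b , zipWith ℕ._+_ α β) g) (f ⊠ g) _ ⟩
        _ ≈⟨ +-cong (term-value p (bounded G)) (⊠-value q) ⟩
        a * monomial d α * weightedSum g (monomial d′) + weightedSum f (monomial d) * weightedSum g (monomial d′)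
          ≈⟨ distribʳ _ _ _ ⟨
        (a * monomial d α + weightedSum f (monomial d)) * weightedSum g (monomial d′) ∎

    homogenizesTo-⊠^ : ∀ k {d f v} → HomogenizesTo d f v → HomogenizesTo (k ℕ.* d) (f ⊠^ k) (v ^ k)
    homogenizesTo-⊠^ zero    F = homogenizesTo-con 1#
    homogenizesTo-⊠^ (suc k) F = homogenizesTo-⊠ F (homogenizesTo-⊠^ k F)

    homogenizesTo-raise : ∀ {d d′ f v} → d ℕ.≤ d′ → HomogenizesTo d f v → HomogenizesTo d′ f (X zero ^ (d′ ℕ.∸ d) * v)
    homogenizesTo-raise {d} {d′} d≤d′ F = record
      { bounded = All.map (λ p → ℕ.≤-trans p d≤d′) (bounded F)
      ; value   = trans (raise (bounded F)) (*-congˡ (value F))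
      }
      where
      raise : ∀ {f} → Bounded d f → weightedSum f (monomial d′) ≈ X zero ^ (d′ ℕ.∸ d) * weightedSum f (monomial d)
      raise [] = sym (zeroʳ _)
      raise {(a , α) ∷ f} (p ∷ q) = begin
        a * monomial d′ α + weightedSum f (monomial d′)
          ≈⟨ +-cong (trans (*-congˡ (monomial-raise {α = α} p d≤d′)) (x*[y*z]≈y*[x*z] _ _ _)) (raise q) ⟩
        X zero ^ (d′ ℕ.∸ d) * (a * monomial d α) + X zero ^ (d′ ℕ.∸ d) * weightedSum f (monomial d)
          ≈⟨ distribˡ _ _ _ ⟨
        X zero ^ (d′ ℕ.∸ d) * (a * monomial d α + weightedSum f (monomial d)) ∎

    eval-homogenize : ∀ {d f v} → HomogenizesTo d f v → degree f ≡ d → eval (homogenize f) X ≈ v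
    eval-homogenize {f = f} F ≡.refl = begin
      eval (homogenize f) X                               ≡⟨ ≡.cong (foldr _+_ 0#) (List.map-∘ (support f)) ⟨
      weightedSum (support f) (monomial (degree f))       ≈⟨ weightedSum-support f (monomial (degree f)) ⟩
      weightedSum f (monomial (degree f))                 ≈⟨ value F ⟩
      _ ∎

    -- In smaller degree every homogenized term would be divisible by X₀.
    degree-≡ : ∀ {d f v} → X zero ≈ 0# → HomogenizesTo d f v → ¬ v ≈ 0# → degree f ≡ d
    degree-≡ {d} {f} {v} X₀≈0 F v≉0 with degree f ℕ.<? d
    ... | no ≮d = ℕ.≤-antisym (degree-≤ (bounded F)) (ℕ.≮⇒≥ ≮d)
    ... | yes deg<d = contradiction (trans (sym (value F)) (trans (sym (weightedSum-support f (monomial d)))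
                        (vanishes (degree-bounds-support f)))) v≉0
      where
      0^suc : ∀ {k} → 0 ℕ.< k → X zero ^ k ≈ 0#
      0^suc {suc k} _ = trans (*-congʳ X₀≈0) (zeroˡ _)
      vanishes : ∀ {g} → Bounded (degree f) g → weightedSum g (monomial d) ≈ 0#
      vanishes [] = refl
      vanishes {(a , α) ∷ g} (p ∷ q) = begin
        a * (X zero ^ (d ℕ.∸ Vec.sum α) * powers α) + weightedSum g (monomial d)
          ≈⟨ +-cong (*-congˡ (*-congʳ (0^suc (ℕ.m<n⇒0<n∸m (ℕ.≤-<-trans p deg<d))))) (vanishes q) ⟩
        a * (0# * powers α) + 0#   ≈⟨ +-identityʳ _ ⟩
        a * (0# * powers α)        ≈⟨ trans (*-congˡ (zeroˡ _)) (zeroʳ a) ⟩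
        0# ∎

-- The homogenized equation, at infinity and in affine space.

1+f+f+1 : ∀ f → suc (f ℕ.+ f) ℕ.+ 1 ≡ suc f ℕ.* 2
1+f+f+1 = solve 1 (λ f → con 1 :+ (f :+ f) :+ con 1 := (con 1 :+ f) :* con 2) ≡.refl
  where open ℕ.+-*-Solver

q[2s+2] : ∀ q s → q ℕ.* (2 ℕ.* s ℕ.+ 2) ≡ suc s ℕ.* (2 ℕ.* q)
q[2s+2] = solve 2 (λ q s → q :* (con 2 :* s :+ con 2) := (con 1 :+ s) :* (con 2 :* q)) ≡.refl
  where open ℕ.+-*-Solver

module Equation {c ℓ} (e f : ℕ) (e≡ : e ≡ suc (f ℕ.+ f)) (K : FiniteField c ℓ ((2 ℕ.^ e) ℕ.^ 2)) where
  open FiniteField K hiding (zero)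
  open CommutativeRing commutativeRing using (setoid)
  open SetoidReasoning setoid
  open Exp commutativeSemiring
  open SemiringSum semiring using (sum; sum-cong-≋; *-distribˡ-sum)
  open Hypersurface e K
  open FieldProperties K
  open CharacteristicTwo commutativeRing (characteristicTwo {e ℕ.* 2} (ℕ.^-*-assoc 2 e 2))
  open Polynomials commutativeRing _≟_ hiding (con)
  open Homogenization commutativeRing _≟_

  s : ℕ
  s = 2 ℕ.^ f

  σ≡2s : σ ≡ 2 ℕ.* s
  σ≡2s = ≡.cong (2 ℕ.^_) (≡.trans (≡.cong (λ n → (n ℕ.+ 1) ℕ./ 2) e≡) (≡.trans (≡.cong (ℕ._/ 2) (1+f+f+1 f)) (ℕ.m*n/n≡m (suc f) 2)))

  q≡2ss : q ≡ 2 ℕ.* (s ℕ.* s)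
  q≡2ss = ≡.trans (≡.cong (2 ℕ.^_) e≡) (≡.cong (2 ℕ.*_) (ℕ.^-distribˡ-+-* 2 f f))

  1<q : 1 ℕ.< q
  1<q = ≡.subst (1 ℕ.<_) (≡.sym q≡2ss) (ℕ.*-monoʳ-≤ 2 (ℕ.*-mono-≤ (ℕ.m^n>0 2 f) (ℕ.m^n>0 2 f)))

  instance
    q≢0 : ℕ.NonZero q
    q≢0 = ℕ.>-nonZero (ℕ.<-trans ℕ.z<s 1<q)

  -- This is (σ + 2) q, the degree of the leading term of Γ_ε, left in the shape in which the
  -- homogenization rules for powers and products produce it.
  D : ℕ
  D = (σ ℕ.+ 2) ℕ.* (q ℕ.* 1 ℕ.+ 0)

  private
    q*1 : q ℕ.* 1 ≡ q
    q*1 = ℕ.*-identityʳ q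

    D≡ : D ≡ (σ ℕ.+ 2) ℕ.* q
    D≡ = ≡.cong ((σ ℕ.+ 2) ℕ.*_) (≡.trans (ℕ.+-identityʳ _) q*1)

    2<σ+2 : 2 ℕ.< σ ℕ.+ 2
    2<σ+2 = ℕ.m<n+m 2 (ℕ.m^n>0 2 ((e ℕ.+ 1) ℕ./ 2))

    <D : ∀ {k n} → n ≡ k ℕ.* q → k ℕ.< σ ℕ.+ 2 → n ℕ.< D
    <D {k} ≡.refl k< = ≡.subst (k ℕ.* q ℕ.<_) {y = D} (≡.sym D≡) (ℕ.*-monoˡ-< q k<)

    1<q*1 : 1 ℕ.< q ℕ.* 1
    1<q*1 = ≡.subst (1 ℕ.<_) (≡.sym q*1) 1<q

    2q<D : (2 ℕ.* q) ℕ.* 1 ℕ.+ 0 ℕ.< D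
    2q<D = <D (≡.trans (ℕ.+-identityʳ _) (ℕ.*-identityʳ _)) 2<σ+2

    q+1<D : (q ℕ.+ 1) ℕ.* 1 ℕ.< D
    q+1<D = ℕ.≤-<-trans (≡.subst₂ ℕ._≤_ (≡.sym (ℕ.*-identityʳ _)) (≡.sym (≡.cong (q ℕ.+_) (ℕ.+-identityʳ q))) (ℕ.+-monoʳ-≤ q (ℕ.<⇒≤ 1<q)))
              (<D {2} ≡.refl 2<σ+2)

  -- The value of Γ homogenized at X₀, where χ is the common value of the positive powers of X₀.
  Γᵪ : Carrier → Carrier → Carrier → Carrier
  Γᵪ χ ε x = (χ * x + (x ^ q + χ * x) * ε) ^ (σ ℕ.+ 2)
           + χ * (x ^ q + χ * x) ^ σ
           + χ * ((x ^ (2 ℕ.* q) + χ * x ^ 2) * ε)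
           + χ * x ^ (q ℕ.+ 1)
           + χ * x ^ 2

  module _ (X : Vector Carrier 5) {χ : Carrier} (X₀^ : ∀ k → X 0F ^ suc k ≈ χ) (ε : Carrier) where

    -- Every term of strictly lower degree acquires a positive power of X₀, whose value is χ
    -- whatever the exponent.
    raise : ∀ {d d′ p v} → d ℕ.< d′ → HomogenizesTo X d p v → HomogenizesTo X d′ p (χ * v)
    raise d<d′ F = homogenizesTo-≈ X (*-congʳ (X₀^pos (ℕ.m<n⇒0<n∸m d<d′))) (homogenizesTo-raise X (ℕ.<⇒≤ d<d′) F)
      where
      X₀^pos : ∀ {k} → 0 ℕ.< k → X 0F ^ k ≈ χ
      X₀^pos {suc k} _ = X₀^ k

    Γ-homogenizesTo : ∀ {p v} → HomogenizesTo X 1 p v → HomogenizesTo X D (Γ ε p) (Γᵪ χ ε v)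
    Γ-homogenizesTo x =
      homogenizesTo-⊞ X (homogenizesTo-⊞ X (homogenizesTo-⊞ X (homogenizesTo-⊞ X
        (homogenizesTo-⊠^ X (σ ℕ.+ 2) (homogenizesTo-⊞ X (raise (≡.subst (1 ℕ.<_) (≡.sym (ℕ.+-identityʳ _)) 1<q*1) x) (homogenizesTo-⊠ X x^q+x (homogenizesTo-con X ε))))
        (raise (<D {σ} (≡.cong (σ ℕ.*_) q*1) (ℕ.m<m+n σ ℕ.z<s)) (homogenizesTo-⊠^ X σ x^q+x)))
        (raise 2q<D (homogenizesTo-⊠ X (homogenizesTo-⊞ X (homogenizesTo-⊠^ X (2 ℕ.* q) x)
           (raise (≡.subst (2 ℕ.<_) (≡.sym (ℕ.*-identityʳ _)) (ℕ.*-monoʳ-< 2 1<q)) (homogenizesTo-⊠^ X 2 x))) (homogenizesTo-con X ε))))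
        (raise q+1<D (homogenizesTo-⊠^ X (q ℕ.+ 1) x)))
        (raise (ℕ.≤-<-trans (ℕ.*-monoʳ-≤ 2 (ℕ.<⇒≤ 1<q)) (<D {2} ≡.refl 2<σ+2)) (homogenizesTo-⊠^ X 2 x))
      where
      x^q+x = homogenizesTo-⊞ X (homogenizesTo-⊠^ X q x) (raise 1<q*1 x)

    ⊞-sum-homogenizesTo : ∀ {k d} {p : Vector (Polynomial 4) k} {v : Vector Carrier k} →
      (∀ i → HomogenizesTo X d (p i) (v i)) → HomogenizesTo X d (⊞-sum p) (sum v)
    ⊞-sum-homogenizesTo {zero}  P = homogenizesTo-[] X
    ⊞-sum-homogenizesTo {suc k} P = homogenizesTo-⊞ X (P 0F) (⊞-sum-homogenizesTo (P ∘ suc))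

    affineEquation-homogenizesTo : HomogenizesTo X D (affineEquation 3 ε)
      (χ * (X 4F ^ q + χ * X 4F) + - 1# * sum (λ (i : Fin 3) → Γᵪ χ ε (X (suc (inject₁ i)))))
    affineEquation-homogenizesTo = homogenizesTo-⊞ X
      (raise (<D {1} (≡.trans q*1 (≡.sym (ℕ.+-identityʳ q))) (ℕ.<-trans (ℕ.n<1+n 1) 2<σ+2)) (homogenizesTo-⊞ X (homogenizesTo-⊠^ X q xᵣ) (raise 1<q*1 xᵣ)))
      (homogenizesTo-⊠ X (homogenizesTo-con X (- 1#)) (⊞-sum-homogenizesTo (λ i → Γ-homogenizesTo (homogenizesTo-var X (inject₁ i)))))
      where
      xᵣ = homogenizesTo-var X (fromℕ 3)

  -- Multiplicative, but not a field norm: x ↦ x^s is not an involution of K.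
  norm : Carrier → Carrier
  norm x = x ^ suc s

  norm-cong : ∀ {x y} → x ≈ y → norm x ≈ norm y
  norm-cong = ^-congˡ (suc s)

  0^suc : ∀ {x} → x ≈ 0# → ∀ k → x ^ suc k ≈ 0#
  0^suc x≈0 k = trans (*-congʳ x≈0) (zeroˡ _)

  1^ : ∀ {x} → x ≈ 1# → ∀ k → x ^ k ≈ 1#
  1^ x≈1 zero    = refl
  1^ x≈1 (suc k) = trans (*-cong x≈1 (1^ x≈1 k)) (*-identityˡ 1#)

  0^q : 0# ^ q ≈ 0#
  0^q with q | 1<q
  ... | suc k | _ = zeroˡ _

  -- At infinity only (ε x^q)^(σ+2) survives. Because (σ + 2) q = (s + 1) 2q, it is a constant times
  -- a 2q-th power of `norm x`, and 2q-th powers are additive.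
  Γ₀ : ∀ ε x → Γᵪ 0# ε x ≈ ε ^ (σ ℕ.+ 2) * norm x ^ (2 ℕ.* q)
  Γ₀ ε x = begin
    Γᵪ 0# ε x
      ≈⟨ +-cong (+-cong (+-cong (+-congˡ (zeroˡ _)) (zeroˡ _)) (zeroˡ _)) (zeroˡ _) ⟩
    (0# * x + (x ^ q + 0# * x) * ε) ^ (σ ℕ.+ 2) + 0# + 0# + 0# + 0#
      ≈⟨ trans (+-identityʳ _) (trans (+-identityʳ _) (trans (+-identityʳ _) (+-identityʳ _))) ⟩
    (0# * x + (x ^ q + 0# * x) * ε) ^ (σ ℕ.+ 2)
      ≈⟨ ^-congˡ (σ ℕ.+ 2) (solve 3 (λ x y ε → con false :* x :+ (y :+ con false :* x) :* ε := ε :* y) refl x (x ^ q) ε) ⟩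
    (ε * x ^ q) ^ (σ ℕ.+ 2)
      ≈⟨ ^-distrib-* ε (x ^ q) (σ ℕ.+ 2) ⟩
    ε ^ (σ ℕ.+ 2) * (x ^ q) ^ (σ ℕ.+ 2)
      ≈⟨ *-congˡ (trans (^-assocʳ x q (σ ℕ.+ 2)) (trans (^-congʳ x exponents) (sym (^-assocʳ x (suc s) (2 ℕ.* q))))) ⟩
    ε ^ (σ ℕ.+ 2) * norm x ^ (2 ℕ.* q) ∎
    where
    exponents : q ℕ.* (σ ℕ.+ 2) ≡ suc s ℕ.* (2 ℕ.* q)
    exponents = ≡.trans (≡.cong (λ n → q ℕ.* (n ℕ.+ 2)) σ≡2s) (q[2s+2] q s)

  -- The trace from K to F_q, as opposed to the absolute trace `Tr`. For x = a + b ε over F_q it is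
  -- b, since ε^q = ε + 1; `co` gives the other component a.
  trace : Carrier → Carrier
  trace x = x ^ q + x

  co : Carrier → Carrier → Carrier
  co ε x = x + trace x * ε

  gamma : Carrier → Carrier → Carrier
  gamma ε x = co ε x ^ (σ ℕ.+ 2) + trace x ^ σ + co ε x * trace x

  -- The last three terms of Γ_ε factor: with y = x^q, (y² + x²) ε + x y + x² = (x + (y + x) ε)(y +
  -- x).
  Γ₁ : ∀ ε x → Γᵪ 1# ε x ≈ gamma ε x
  Γ₁ ε x = begin
    Γᵪ 1# ε x
      ≈⟨ +-cong (+-cong (+-cong (+-cong (^-congˡ (σ ℕ.+ 2) (+-cong (*-identityˡ _) (*-congʳ (+-congˡ (*-identityˡ _)))))
                                       (trans (*-identityˡ _) (^-congˡ σ (+-congˡ (*-identityˡ _)))))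
                                (trans (*-identityˡ _) (*-congʳ (+-cong x^2q (*-identityˡ _)))))
                        (trans (*-identityˡ _) (trans (^-homo-* x q 1) (*-congˡ (*-identityʳ x)))))
                (*-identityˡ _) ⟩
    co ε x ^ (σ ℕ.+ 2) + trace x ^ σ + ((x ^ q) ^ 2 + x ^ 2) * ε + x ^ q * x + x ^ 2
      ≈⟨ solve 5 (λ a b x y ε → a :+ b :+ (y :^ 2 :+ x :^ 2) :* ε :+ y :* x :+ x :^ 2 :=
                                a :+ b :+ (x :+ (y :+ x) :* ε) :* (y :+ x)) refl (co ε x ^ (σ ℕ.+ 2)) (trace x ^ σ) x (x ^ q) ε ⟩
    gamma ε x ∎
    where
    x^2q : x ^ (2 ℕ.* q) ≈ (x ^ q) ^ 2
    x^2q = trans (^-congʳ x (ℕ.*-comm 2 q)) (sym (^-assocʳ x q 2))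

  module _ {ε : Carrier} (ε≉0 : ¬ ε ≈ 0#) where

    value-at-infinity : (X : Vector Carrier 5) → X 0F ≈ 0# →
      HomogenizesTo X D (affineEquation 3 ε) (ε ^ (σ ℕ.+ 2) * (norm (X 1F) + norm (X 2F) + norm (X 3F)) ^ (2 ℕ.* q))
    value-at-infinity X X₀≈0 = homogenizesTo-≈ X (begin
      0# * _ + - 1# * (Γᵪ 0# ε (X 1F) + (Γᵪ 0# ε (X 2F) + (Γᵪ 0# ε (X 3F) + 0#)))
        ≈⟨ +-cong (zeroˡ _) (*-cong (-x≈x 1#) (+-cong (Γ₀ ε (X 1F)) (+-cong (Γ₀ ε (X 2F)) (+-congʳ (Γ₀ ε (X 3F)))))) ⟩
      0# + 1# * (E * N₁ ^ (2 ℕ.* q) + (E * N₂ ^ (2 ℕ.* q) + (E * N₃ ^ (2 ℕ.* q) + 0#)))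
        ≈⟨ solve 4 (λ E a b c → con false :+ con true :* (E :* a :+ (E :* b :+ (E :* c :+ con false))) := E :* ((a :+ b) :+ c)) refl
             E (N₁ ^ (2 ℕ.* q)) (N₂ ^ (2 ℕ.* q)) (N₃ ^ (2 ℕ.* q)) ⟩
      E * (N₁ ^ (2 ℕ.* q) + N₂ ^ (2 ℕ.* q) + N₃ ^ (2 ℕ.* q))
        ≈⟨ *-congˡ (trans (frobenius (suc e) (N₁ + N₂) N₃) (+-congʳ (frobenius (suc e) N₁ N₂))) ⟨
      E * (N₁ + N₂ + N₃) ^ (2 ℕ.* q) ∎)
      (affineEquation-homogenizesTo X (0^suc X₀≈0) ε)
      where
      E = ε ^ (σ ℕ.+ 2)
      N₁ = norm (X 1F)
      N₂ = norm (X 2F)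
      N₃ = norm (X 3F)

    degree-affineEquation : degree (affineEquation 3 ε) ≡ D
    degree-affineEquation = degree-≡ X refl (value-at-infinity X refl)
      (*-≉0 (^-≉0 (σ ℕ.+ 2) ε≉0) (^-≉0 (2 ℕ.* q) (λ p → 1≉0 (trans (sym norms) p))))
      where
      -- At the infinite point (0,1,0,0,0) the form of degree `D` has the value ε^(σ+2), which is
      -- not 0.
      X : Vector Carrier 5
      X 1F = 1#
      X _  = 0#
      norms : norm 1# + norm 0# + norm 0# ≈ 1#
      norms = trans (+-cong (trans (+-cong (1^ refl (suc s)) (zeroˡ _)) (+-identityʳ 1#)) (zeroˡ _)) (+-identityʳ 1#)

    module _ {X : Vector Carrier 5} where
      infinite⇒norms : X 0F ≈ 0# → eval (homogenize (affineEquation 3 ε)) X ≈ 0# → norm (X 1F) + norm (X 2F) + norm (X 3F) ≈ 0#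
      infinite⇒norms X₀≈0 p = ^≈0⇒≈0 (2 ℕ.* q) (*-cancel-≉0 (^-≉0 (σ ℕ.+ 2) ε≉0)
        (trans (sym (eval-homogenize X (value-at-infinity X X₀≈0) degree-affineEquation)) p))

      norms⇒infinite : X 0F ≈ 0# → norm (X 1F) + norm (X 2F) + norm (X 3F) ≈ 0# → eval (homogenize (affineEquation 3 ε)) X ≈ 0#
      norms⇒infinite X₀≈0 p = trans (eval-homogenize X (value-at-infinity X X₀≈0) degree-affineEquation)
        (trans (*-congˡ (trans (^-congˡ (2 ℕ.* q) p) 0^2q)) (zeroʳ _))
        where
        0^2q : 0# ^ (2 ℕ.* q) ≈ 0#
        0^2q = trans (^-homo-* 0# q (q ℕ.+ 0)) (trans (*-congʳ 0^q) (zeroˡ _))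

      trace⇒affine : X 0F ≈ 1# → trace (X 4F) ≈ gamma ε (X 1F) + gamma ε (X 2F) + gamma ε (X 3F) →
        eval (homogenize (affineEquation 3 ε)) X ≈ 0#
      trace⇒affine X₀≈1 p = trans (eval-homogenize X (affineEquation-homogenizesTo X (λ k → 1^ X₀≈1 (suc k)) ε) degree-affineEquation) (begin
        1# * (X 4F ^ q + 1# * X 4F) + - 1# * (Γᵪ 1# ε (X 1F) + (Γᵪ 1# ε (X 2F) + (Γᵪ 1# ε (X 3F) + 0#)))
          ≈⟨ +-cong (trans (*-identityˡ _) (+-congˡ (*-identityˡ _)))
                    (*-cong (-x≈x 1#) (+-cong (Γ₁ ε (X 1F)) (+-cong (Γ₁ ε (X 2F)) (+-congʳ (Γ₁ ε (X 3F)))))) ⟩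
        trace (X 4F) + 1# * (gamma ε (X 1F) + (gamma ε (X 2F) + (gamma ε (X 3F) + 0#)))
          ≈⟨ solve 4 (λ t a b c → t :+ con true :* (a :+ (b :+ (c :+ con false))) := t :+ (a :+ b :+ c)) refl
               (trace (X 4F)) (gamma ε (X 1F)) (gamma ε (X 2F)) (gamma ε (X 3F)) ⟩
        trace (X 4F) + (gamma ε (X 1F) + gamma ε (X 2F) + gamma ε (X 3F))
          ≈⟨ ≈⇒+≈0 p ⟩
        0# ∎)

-- The curve N(x) + N(y) + N(z) = 0: an external line, and points spanning the plane.

module Arithmetic {c ℓ} (e f : ℕ) (e≡ : e ≡ suc (f ℕ.+ f)) (K : FiniteField c ℓ ((2 ℕ.^ e) ℕ.^ 2))
                  (ε : FiniteField.Carrier K) (admissible : Hypersurface.Admissible e K ε) where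
  open FiniteField K hiding (zero)
  open CommutativeRing commutativeRing using (setoid)
  open SetoidReasoning setoid
  open Exp commutativeSemiring
  open Hypersurface e K using (q; σ; 𝔽q; module Admissible)
  open Admissible admissible
  open FieldProperties K
  open CharacteristicTwo commutativeRing (characteristicTwo {e ℕ.* 2} (ℕ.^-*-assoc 2 e 2))
  open Equation e f e≡ K

  ε≉0 : ¬ ε ≈ 0#
  ε≉0 p = ε∉𝔽q (trans (^-congˡ q p) (trans 0^q (sym p)))

  ^-comm : ∀ x m n → (x ^ m) ^ n ≈ (x ^ n) ^ m
  ^-comm x m n = trans (^-assocʳ x m n) (trans (^-congʳ x (ℕ.*-comm m n)) (sym (^-assocʳ x n m)))

  -- ε^q is a root of T² + T + δ as well, because δ lies in F_q. The roots are ε and ε + 1, and ε^q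
  -- = ε is excluded.
  ε^q≈ε+1 : ε ^ q ≈ ε + 1#
  ε^q≈ε+1 = +-cancel⇒≈ (trans (sym (+-assoc _ _ _)) (*-cancel-≉0 (ε∉𝔽q ∘ +-cancel⇒≈) (begin
    (y + ε) * (y + ε + 1#)
      ≈⟨ solve 3 (λ y ε δ → (y :+ ε) :* (y :+ ε :+ con true) := (y :^ 2 :+ y :+ δ) :+ (ε :^ 2 :+ ε :+ δ)) refl y ε δ ⟩
    (y ^ 2 + y + δ) + (ε ^ 2 + ε + δ)
      ≈⟨ +-congʳ (+-cong (+-congʳ (^-comm ε 2 q)) δ∈𝔽q) ⟨
    ((ε ^ 2) ^ q + ε ^ q + δ ^ q) + (ε ^ 2 + ε + δ)
      ≈⟨ +-congʳ (trans (frobenius e _ δ) (+-congʳ (frobenius e (ε ^ 2) ε))) ⟨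
    (ε ^ 2 + ε + δ) ^ q + (ε ^ 2 + ε + δ)
      ≈⟨ +-cong (trans (^-congˡ q equation) 0^q) equation ⟩
    0# + 0# ≈⟨ +-identityʳ 0# ⟩
    0# ∎)))
    where y = ε ^ q

  -- Otherwise ε^q = ε², hence δ = ε² + ε = 1.
  ε^ss≉ε : ¬ (ε ^ s) ^ s ≈ ε
  ε^ss≉ε p = δ≉1 (+-cancel⇒≈ (begin
    δ + 1#                                ≈⟨ solve 2 (λ ε δ → δ :+ con true := (ε :^ 2 :+ ε :+ δ) :+ (ε :^ 2 :+ (ε :+ con true))) refl ε δ ⟩
    (ε ^ 2 + ε + δ) + (ε ^ 2 + (ε + 1#))  ≈⟨ +-cong equation (≈⇒+≈0 (trans ε²≈ε^q ε^q≈ε+1)) ⟩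
    0# + 0#                               ≈⟨ +-identityʳ 0# ⟩
    0# ∎))
    where
    ε²≈ε^q : ε ^ 2 ≈ ε ^ q
    ε²≈ε^q = begin
      ε ^ 2                ≈⟨ ^-congˡ 2 (trans (sym (^-assocʳ ε s s)) p) ⟨
      (ε ^ (s ℕ.* s)) ^ 2  ≈⟨ ^-comm ε (s ℕ.* s) 2 ⟩
      (ε ^ 2) ^ (s ℕ.* s)  ≈⟨ ^-assocʳ ε 2 (s ℕ.* s) ⟩
      ε ^ (2 ℕ.* (s ℕ.* s)) ≈⟨ ^-congʳ ε q≡2ss ⟨
      ε ^ q ∎

  ε^s≉ε : ¬ ε ^ s ≈ ε
  ε^s≉ε p = ε^ss≉ε (trans (^-congˡ s p) p)

  norm-* : ∀ x y → norm (x * y) ≈ norm x * norm y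
  norm-* x y = ^-distrib-* x y (suc s)

  norm-0 : norm 0# ≈ 0#
  norm-0 = zeroˡ _

  norm-1 : norm 1# ≈ 1#
  norm-1 = 1^ refl (suc s)

  norm-+1 : ∀ x → norm (x + 1#) ≈ norm x + (x ^ s + x) + 1#
  norm-+1 x = trans (*-congˡ (trans (frobenius f x 1#) (+-congˡ (1^ refl s))))
    (solve 2 (λ x y → (x :+ con true) :* (y :+ con true) := x :* y :+ (y :+ x) :+ con true) refl x (x ^ s))

  IsNorm : Carrier → Set _
  IsNorm y = ∃ λ x → norm x ≈ y

  isNorm? : ∀ y → Dec (IsNorm y)
  isNorm? y = any? (λ x≈x′ p → trans (norm-cong (sym x≈x′)) p) (λ x → norm x ≟ y)

  -- Then the norms form a subfield containing every x^s + x; with d = norm ε it also contains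
  -- ((dx)^s + dx) + d^s (x^s + x) = (d^s + d) x.
  1+norms⇒surjective : (∀ a → IsNorm (1# + norm a)) → ∀ y → IsNorm y
  1+norms⇒surjective 1+norm y = isNorm-≈ (begin
      (d * z) ^ s + d * z + d ^ s * (z ^ s + z)     ≈⟨ +-congʳ (+-congʳ (^-distrib-* d z s)) ⟩
      d ^ s * z ^ s + d * z + d ^ s * (z ^ s + z)   ≈⟨ solve 4 (λ a b d z → a :* b :+ d :* z :+ a :* (b :+ z) := (a :+ d) :* z) refl (d ^ s) (z ^ s) d z ⟩
      (d ^ s + d) * z                               ≈⟨ *-assoc _ k y ⟨
      (d ^ s + d) * k * y                           ≈⟨ *-congʳ dk≈1 ⟩
      1# * y                                        ≈⟨ *-identityˡ y ⟩
      y ∎)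
      (isNorm-+ (^s+ (d * z)) (isNorm-* (ε ^ s , ^-comm ε s (suc s)) (^s+ z)))
    where
    d = norm ε
    -- d^s = d would read ε^s · ε^(s²) = ε^s · ε, hence ε^(s²) = ε.
    d^s+d≉0 : ¬ d ^ s + d ≈ 0#
    d^s+d≉0 p = ε^ss≉ε (*-cancelˡ-≉0 (^-≉0 s ε≉0) (trans (sym (^-distrib-* ε (ε ^ s) s)) (trans (+-cancel⇒≈ p) (*-comm _ _))))
    k = proj₁ (invertible (d ^ s + d) d^s+d≉0)
    dk≈1 = proj₂ (invertible (d ^ s + d) d^s+d≉0)
    z = k * y
    isNorm-≈ : ∀ {u v} → u ≈ v → IsNorm u → IsNorm v
    isNorm-≈ p (x , q) = x , trans q p
    isNorm-* : ∀ {u v} → IsNorm u → IsNorm v → IsNorm (u * v)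
    isNorm-* (x , p) (y , q) = x * y , trans (norm-* x y) (*-cong p q)
    -- For x ≠ 0, N(x) + N(y) = N(x) (1 + N(y / x)).
    isNorm-+ : ∀ {u v} → IsNorm u → IsNorm v → IsNorm (u + v)
    isNorm-+ {u} {v} (x , p) (y , q) with x ≟ 0#
    ... | yes x≈0 = y , trans q (trans (sym (+-identityˡ v)) (+-congʳ (trans (sym (trans (norm-cong x≈0) norm-0)) p)))
    ... | no x≉0 with w , xw≈1 ← invertible x x≉0 = isNorm-≈ (begin
      norm x * (1# + norm (w * y))      ≈⟨ distribˡ _ _ _ ⟩
      norm x * 1# + norm x * norm (w * y) ≈⟨ +-cong (trans (*-identityʳ _) p) (trans (sym (norm-* x (w * y))) (trans (norm-cong
        (trans (sym (*-assoc x w y)) (trans (*-congʳ xw≈1) (*-identityˡ y)))) q)) ⟩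
      u + v ∎) (isNorm-* (x , refl) (1+norm (w * y)))
    -- x^s + x = N(x + 1) + N(x) + N(1).
    ^s+ : ∀ x → IsNorm (x ^ s + x)
    ^s+ x = isNorm-≈ (trans (+-congʳ (norm-+1 x)) (solve 2 (λ n t → n :+ t :+ con true :+ (n :+ con true) := t) refl (norm x) (x ^ s + x)))
      (isNorm-+ (x + 1# , refl) (isNorm-+ (x , refl) (1# , norm-1)))

  -- The line through (r , 0 , a) and (0 , 1 , m) misses the curve norm x + norm y + norm z = 0.
  External : Carrier → Carrier → Carrier → Set _
  External r a m = ∀ x y → norm (r * x) + norm y + norm (a * x + m * y) ≈ 0# → x ≈ 0# × y ≈ 0#

  -- On the line z = a x the curve becomes (1 + N(a)) N(x) = N(y). A solution with x ≠ 0 would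
  -- exhibit 1 + N(a) as N(y / x).
  non-norm⇒external : ∀ {a} → ¬ IsNorm (1# + norm a) → External 1# a 0#
  non-norm⇒external {a} ¬norm x y p = x≈0 , ^≈0⇒≈0 (suc s) (begin
    norm y                           ≈⟨ +-identityˡ _ ⟨
    0# + norm y                      ≈⟨ +-congʳ (trans (*-congˡ (trans (norm-cong x≈0) norm-0)) (zeroʳ _)) ⟨
    (1# + norm a) * norm x + norm y  ≈⟨ factored ⟩
    0# ∎)
    where
    factored : (1# + norm a) * norm x + norm y ≈ 0#
    factored = begin
      (1# + norm a) * norm x + norm y
        ≈⟨ solve 3 (λ a x y → (con true :+ a) :* x :+ y := x :+ y :+ a :* x) refl (norm a) (norm x) (norm y) ⟩
      norm x + norm y + norm a * norm x
        ≈⟨ +-cong (+-congʳ (norm-cong (sym (*-identityˡ x)))) (trans (sym (norm-* a x))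
             (norm-cong (sym (trans (+-congˡ (zeroˡ y)) (+-identityʳ _))))) ⟩
      norm (1# * x) + norm y + norm (a * x + 0# * y)
        ≈⟨ p ⟩
      0# ∎
    x≈0 : x ≈ 0#
    x≈0 = decidable-stable (x ≟ 0#) λ x≉0 → let w , xw≈1 = invertible x x≉0 in ¬norm (y * w , (begin
      norm (y * w)                         ≈⟨ norm-* y w ⟩
      norm y * norm w                      ≈⟨ *-congʳ (+-cancel⇒≈ factored) ⟨
      (1# + norm a) * norm x * norm w      ≈⟨ *-assoc _ _ _ ⟩
      (1# + norm a) * (norm x * norm w)    ≈⟨ *-congˡ (trans (sym (norm-* x w)) (trans (norm-cong xw≈1) norm-1)) ⟩
      (1# + norm a) * 1#                   ≈⟨ *-identityʳ _ ⟩
      1# + norm a ∎))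

  -- The points of the curve on the line through (r , 0 , 1) and (0 , 1 , m) are the solutions of g x = m.
  -- As g 0 = g ε, the map g is not injective on the finite field, hence misses some m.
  module _ (surjective : ∀ y → IsNorm y) where

    private
      injective : ∀ {x y} → norm x ≈ norm y → x ≈ y
      injective = surjective⇒injective norm-cong surjective

      root : Carrier → Carrier
      root y = proj₁ (surjective y)

      norm-root : ∀ y → norm (root y) ≈ y
      norm-root y = proj₂ (surjective y)

      root-≈ : ∀ {x y} → y ≈ norm x → root y ≈ x
      root-≈ p = injective (trans (norm-root _) p)

      -- The inverse of `norm ε`, not of ε itself.
      ε⁻¹ = proj₁ (invertible (norm ε) (^-≉0 (suc s) ε≉0))

      -- k is chosen so that k N(ε) + 1 = N(ε + 1). Then the roots in g 0 and g ε are 1 and ε + 1,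
      -- and both values of g equal 1.
      r k : Carrier
      k = (norm (ε + 1#) + 1#) * ε⁻¹
      r = root k

      k*norm-ε : k * norm ε ≈ norm (ε + 1#) + 1#
      k*norm-ε = trans (*-assoc _ _ _) (trans (*-congˡ (trans (*-comm _ _) (proj₂ (invertible (norm ε) (^-≉0 (suc s) ε≉0))))) (*-identityʳ _))

      -- k = 1 would mean N(ε + 1) + 1 = N(ε), that is ε^s = ε. The inequality excludes points of
      -- the curve with y = 0 on the line, where the equation is (k + 1) N(x) = 0.
      k+1≉0 : ¬ k + 1# ≈ 0#
      k+1≉0 p = ε^s≉ε (+-cancel⇒≈ (begin
        ε ^ s + ε                                             ≈⟨ solve 2 (λ n t → t := n :+ (n :+ t :+ con true :+ con true)) refl (norm ε) (ε ^ s + ε) ⟩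
        norm ε + (norm ε + (ε ^ s + ε) + 1# + 1#)             ≈⟨ +-congˡ (+-congʳ (norm-+1 ε)) ⟨
        norm ε + (norm (ε + 1#) + 1#)                         ≈⟨ +-congˡ k*norm-ε ⟨
        norm ε + k * norm ε                                   ≈⟨ solve 2 (λ k n → n :+ k :* n := (k :+ con true) :* n) refl k (norm ε) ⟩
        (k + 1#) * norm ε                                     ≈⟨ trans (*-congʳ p) (zeroˡ _) ⟩
        0# ∎))

      g : Carrier → Carrier
      g x = root (k * norm x + 1#) + x

      g-cong : ∀ {x y} → x ≈ y → g x ≈ g y
      g-cong x≈y = +-cong (root-≈ (trans (+-congʳ (*-congˡ (norm-cong x≈y))) (sym (norm-root _)))) x≈y

      g0≈gε : g 0# ≈ g ε
      g0≈gε = begin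
        root (k * norm 0# + 1#) + 0#   ≈⟨ +-identityʳ _ ⟩
        root (k * norm 0# + 1#)        ≈⟨ root-≈ {1#} (trans (+-congʳ (trans (*-congˡ norm-0) (zeroʳ k))) (trans (+-identityˡ 1#) (sym norm-1))) ⟩
        1#                             ≈⟨ solve 1 (λ ε → con true := (ε :+ con true) :+ ε) refl ε ⟩
        (ε + 1#) + ε                   ≈⟨ +-congʳ (root-≈ {ε + 1#} (trans (+-congʳ k*norm-ε) (solve 1 (λ n → n :+ con true :+ con true := n) refl (norm (ε + 1#))))) ⟨
        root (k * norm ε + 1#) + ε ∎

      hit? : ∀ m → Dec (∃ λ x → g x ≈ m)
      hit? m = any? {P = λ x → g x ≈ m} (λ x≈x′ p → trans (g-cong (sym x≈x′)) p) (λ x → g x ≟ m)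

      missed : ∃ λ m → ¬ ∃ λ x → g x ≈ m
      missed = [ (λ hit → contradiction (sym (surjective⇒injective {g} g-cong hit {0#} {ε} g0≈gε)) ε≉0) , id ]′
        (∀⊎∃¬ {P = λ m → ∃ λ x → g x ≈ m} (λ m≈m′ (x , p) → x , trans p m≈m′) hit?)

    surjective⇒external : ∃ λ r → ∃ λ a → ∃ λ m → External r a m
    surjective⇒external = r , 1# , m , external
      where
      m = proj₁ missed

      no-point : ∀ z → ¬ k * norm z + 1# ≈ norm (z + m)
      no-point z p = proj₂ missed (z , trans (+-congʳ (root-≈ p)) (solve 2 (λ z m → z :+ m :+ z := m) refl z m))

      external : External r 1# m
      external x y p = ^≈0⇒≈0 (suc s) (*-cancel-≉0 k+1≉0 (begin
        (k + 1#) * norm x            ≈⟨ solve 2 (λ k n → (k :+ con true) :* n := k :* n :+ con false :+ n) refl k (norm x) ⟩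
        k * norm x + 0# + norm x     ≈⟨ +-cong (+-congˡ (trans (norm-cong y≈0) norm-0))
                                          (norm-cong (trans (+-cong (*-identityˡ x) (trans (*-congˡ y≈0) (zeroʳ m))) (+-identityʳ x))) ⟨
        k * norm x + norm y + norm (1# * x + m * y)  ≈⟨ p′ ⟩
        0# ∎)) , y≈0
        where
        p′ : k * norm x + norm y + norm (1# * x + m * y) ≈ 0#
        p′ = trans (+-congʳ (+-congʳ (sym (trans (norm-* r x) (*-congʳ (norm-root k)))))) p
        -- A point with y ≠ 0 can be scaled to y = 1, and then x would solve g x = m.
        y≈0 : y ≈ 0#
        y≈0 = decidable-stable (y ≟ 0#) λ y≉0 → let w , yw≈1 = invertible y y≉0 in no-point (x * w) (begin
          k * norm (x * w) + 1#                     ≈⟨ +-cong (trans (*-congˡ (norm-* x w)) (sym (*-assoc _ _ _)))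
                                                         (trans (sym norm-1) (trans (norm-cong (sym yw≈1)) (norm-* y w))) ⟩
          k * norm x * norm w + norm y * norm w     ≈⟨ distribʳ _ _ _ ⟨
          (k * norm x + norm y) * norm w            ≈⟨ *-congʳ (+-cancel⇒≈ p′) ⟩
          norm (1# * x + m * y) * norm w            ≈⟨ norm-* _ _ ⟨
          norm ((1# * x + m * y) * w)               ≈⟨ norm-cong (solve 4 (λ x m y w → (con true :* x :+ m :* y) :* w := x :* w :+ m :* (y :* w)) refl x m y w) ⟩
          norm (x * w + m * (y * w))                ≈⟨ norm-cong (+-congˡ (trans (*-congˡ yw≈1) (*-identityʳ m))) ⟩
          norm (x * w + m) ∎)

  external-line : ∃ λ r → ∃ λ a → ∃ λ m → External r a m
  external-line = [ surjective⇒external ∘ 1+norms⇒surjective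
                  , (λ (a , ¬norm) → 1# , a , 0# , non-norm⇒external ¬norm) ]′
    (∀⊎∃¬ {P = λ a → IsNorm (1# + norm a)} (λ a≈a′ (x , p) → x , trans p (+-congˡ (norm-cong a≈a′))) (λ a → isNorm? (1# + norm a)))

  -- Together with (1,1,0) and (1,0,1), which lie on x + y + z = 0, such a point shows that the
  -- curve spans its plane. If N(x) = N(y) for some x ≠ y, the point (x,y,0) serves. Otherwise N is
  -- bijective and (x,ε,1) with N(x) = 1 + N(ε) serves, since x = ε + 1 would give ε^s = ε.
  curve-point-off-line : ∃ λ x → ∃ λ y → ∃ λ z → norm x + norm y + norm z ≈ 0# × ¬ x + y + z ≈ 0#
  curve-point-off-line
    with any? {P = λ x → ∃ λ y → norm x ≈ norm y × ¬ x ≈ y}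
              (λ x≈x′ (y , p , q) → y , trans (norm-cong (sym x≈x′)) p , λ r → q (trans x≈x′ r))
              (λ x → any? (λ y≈y′ (p , q) → trans p (norm-cong y≈y′) , λ r → q (trans r (sym y≈y′))) (λ y → norm x ≟ norm y ×-dec ¬? (x ≟ y)))
  ... | yes (x , y , p , x≉y) = x , y , 0# , trans (+-cong (≈⇒+≈0 p) norm-0) (+-identityʳ 0#) ,
          λ q → x≉y (+-cancel⇒≈ (trans (sym (+-identityʳ _)) q))
  ... | no ¬collision with x , p ← injective⇒surjective {norm} (λ {x} {y} p → decidable-stable (x ≟ y) (λ x≉y → ¬collision (x , y , p , x≉y))) (1# + norm ε) =
    x , ε , 1# , (begin
      norm x + norm ε + norm 1#        ≈⟨ +-cong (+-congʳ p) norm-1 ⟩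
      1# + norm ε + norm ε + 1#        ≈⟨ solve 1 (λ n → con true :+ n :+ n :+ con true := con false) refl (norm ε) ⟩
      0# ∎) , λ q → ε^s≉ε (+-cancel⇒≈ (begin
      ε ^ s + ε                                          ≈⟨ solve 2 (λ n t → t := (con true :+ n) :+ (n :+ t :+ con true)) refl (norm ε) (ε ^ s + ε) ⟩
      (1# + norm ε) + (norm ε + (ε ^ s + ε) + 1#)        ≈⟨ +-cong (sym p) (sym (norm-+1 ε)) ⟩
      norm x + norm (ε + 1#)                             ≈⟨ ≈⇒+≈0 (norm-cong (+-cancel⇒≈ (trans (sym (+-assoc _ _ _)) q))) ⟩
      0# ∎))

-- Components over F_q, and directions along which the equation is additive.

module Subfield {c ℓ} (e f : ℕ) (e≡ : e ≡ suc (f ℕ.+ f)) (K : FiniteField c ℓ ((2 ℕ.^ e) ℕ.^ 2))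
                  (ε : FiniteField.Carrier K) (admissible : Hypersurface.Admissible e K ε) where
  open FiniteField K hiding (zero)
  open CommutativeRing commutativeRing using (setoid)
  open SetoidReasoning setoid
  open Exp commutativeSemiring
  open Hypersurface e K using (q; σ; 𝔽q)
  open FieldProperties K
  open CharacteristicTwo commutativeRing (characteristicTwo {e ℕ.* 2} (ℕ.^-*-assoc 2 e 2))
  open Equation e f e≡ K
  open Arithmetic e f e≡ K ε admissible using (ε^q≈ε+1; ^-comm)

  x^q^q≈x : ∀ x → (x ^ q) ^ q ≈ x
  x^q^q≈x x = trans (^-assocʳ x q q) (trans (^-congʳ x (≡.cong (q ℕ.*_) (≡.sym (ℕ.*-identityʳ q)))) (fermat x))

  𝔽q-0 : 𝔽q 0#
  𝔽q-0 = 0^q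

  𝔽q-1 : 𝔽q 1#
  𝔽q-1 = 1^ refl q

  𝔽q-+ : ∀ {x y} → 𝔽q x → 𝔽q y → 𝔽q (x + y)
  𝔽q-+ {x} {y} x∈ y∈ = trans (frobenius e x y) (+-cong x∈ y∈)

  𝔽q-* : ∀ {x y} → 𝔽q x → 𝔽q y → 𝔽q (x * y)
  𝔽q-* {x} {y} x∈ y∈ = trans (^-distrib-* x y q) (*-cong x∈ y∈)

  𝔽q-^ : ∀ n {x} → 𝔽q x → 𝔽q (x ^ n)
  𝔽q-^ n {x} x∈ = trans (^-comm x n q) (^-congˡ n x∈)

  𝔽q-inverse : ∀ {x y} → x * y ≈ 1# → 𝔽q x → 𝔽q y
  𝔽q-inverse {x} {y} xy≈1 x∈ = *-cancelˡ-≉0 x≉0 (begin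
    x * y ^ q      ≈⟨ *-congʳ x∈ ⟨
    x ^ q * y ^ q  ≈⟨ ^-distrib-* x y q ⟨
    (x * y) ^ q    ≈⟨ trans (^-congˡ q xy≈1) 𝔽q-1 ⟩
    1#             ≈⟨ xy≈1 ⟨
    x * y ∎)
    where
    x≉0 : ¬ x ≈ 0#
    x≉0 p = 1≉0 (trans (sym xy≈1) (trans (*-congʳ p) (zeroˡ y)))

  trace-cong : ∀ {x y} → x ≈ y → trace x ≈ trace y
  trace-cong p = +-cong (^-congˡ q p) p

  trace-+ : ∀ x y → trace (x + y) ≈ trace x + trace y
  trace-+ x y = trans (+-congʳ (frobenius e x y))
    (solve 4 (λ a b x y → (a :+ b) :+ (x :+ y) := (a :+ x) :+ (b :+ y)) refl (x ^ q) (y ^ q) x y)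

  trace-* : ∀ {t} → 𝔽q t → ∀ x → trace (t * x) ≈ t * trace x
  trace-* {t} t∈ x = trans (+-congʳ (trans (^-distrib-* t x q) (*-congʳ t∈))) (sym (distribˡ t _ x))

  trace-𝔽q : ∀ {t} → 𝔽q t → trace t ≈ 0#
  trace-𝔽q = ≈⇒+≈0

  trace≈0⇒𝔽q : ∀ {x} → trace x ≈ 0# → 𝔽q x
  trace≈0⇒𝔽q = +-cancel⇒≈

  trace-ε : trace ε ≈ 1#
  trace-ε = trans (+-congʳ ε^q≈ε+1) (solve 1 (λ ε → ε :+ con true :+ ε := con true) refl ε)

  trace∈𝔽q : ∀ x → 𝔽q (trace x)
  trace∈𝔽q x = trans (frobenius e (x ^ q) x) (trans (+-congʳ (x^q^q≈x x)) (+-comm x (x ^ q)))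

  co-cong : ∀ {x y} → x ≈ y → co ε x ≈ co ε y
  co-cong p = +-cong p (*-congʳ (trace-cong p))

  co-+ : ∀ x y → co ε (x + y) ≈ co ε x + co ε y
  co-+ x y = trans (+-congˡ (*-congʳ (trace-+ x y)))
    (solve 5 (λ x y a b ε → x :+ y :+ (a :+ b) :* ε := (x :+ a :* ε) :+ (y :+ b :* ε)) refl x y (trace x) (trace y) ε)

  co-* : ∀ {t} → 𝔽q t → ∀ x → co ε (t * x) ≈ t * co ε x
  co-* {t} t∈ x = trans (+-congˡ (*-congʳ (trace-* t∈ x))) (solve 4 (λ t x a ε → t :* x :+ t :* a :* ε := t :* (x :+ a :* ε)) refl t x (trace x) ε)

  co-𝔽q : ∀ {t} → 𝔽q t → co ε t ≈ t
  co-𝔽q {t} t∈ = trans (+-congˡ (trans (*-congʳ (trace-𝔽q t∈)) (zeroˡ ε))) (+-identityʳ t)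

  co-ε : co ε ε ≈ 0#
  co-ε = ≈⇒+≈0 (sym (trans (*-congʳ trace-ε) (*-identityˡ ε)))

  co∈𝔽q : ∀ x → 𝔽q (co ε x)
  co∈𝔽q x = trace≈0⇒𝔽q (begin
    trace (x + trace x * ε)          ≈⟨ trace-+ x (trace x * ε) ⟩
    trace x + trace (trace x * ε)    ≈⟨ +-congˡ (trans (trace-* (trace∈𝔽q x) ε) (trans (*-congˡ trace-ε) (*-identityʳ _))) ⟩
    trace x + trace x                ≈⟨ x+x≈0 _ ⟩
    0# ∎)

  decompose : ∀ x → x ≈ co ε x + trace x * ε
  decompose x = solve 2 (λ x a → x := x :+ a :+ a) refl x (trace x * ε)

  gamma∈𝔽q : ∀ x → 𝔽q (gamma ε x)
  gamma∈𝔽q x = 𝔽q-+ (𝔽q-+ (𝔽q-^ (σ ℕ.+ 2) (co∈𝔽q x)) (𝔽q-^ σ (trace∈𝔽q x))) (𝔽q-* (co∈𝔽q x) (trace∈𝔽q x))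

  -- Γ_ε is F_q-affine, up to a Frobenius twist, in the direction ε F_q.
  gamma-translate : ∀ {b} → 𝔽q b → ∀ p → gamma ε (p + b * ε) ≈ gamma ε p + (b ^ σ + b * co ε p)
  gamma-translate {b} b∈ p = begin
    co ε (p + b * ε) ^ (σ ℕ.+ 2) + trace (p + b * ε) ^ σ + co ε (p + b * ε) * trace (p + b * ε)
      ≈⟨ +-cong (+-cong (^-congˡ (σ ℕ.+ 2) co≈) (trans (^-congˡ σ trace≈) (frobenius ((e ℕ.+ 1) ℕ./ 2) (trace p) b))) (*-cong co≈ trace≈) ⟩
    co ε p ^ (σ ℕ.+ 2) + (trace p ^ σ + b ^ σ) + co ε p * (trace p + b)
      ≈⟨ solve 6 (λ c s t u b v → c :+ (s :+ u) :+ v :* (t :+ b) := (c :+ s :+ v :* t) :+ (u :+ b :* v)) refl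
           (co ε p ^ (σ ℕ.+ 2)) (trace p ^ σ) (trace p) (b ^ σ) b (co ε p) ⟩
    gamma ε p + (b ^ σ + b * co ε p) ∎
    where
    co≈ : co ε (p + b * ε) ≈ co ε p
    co≈ = trans (co-+ p (b * ε)) (trans (+-congˡ (trans (co-* b∈ ε) (trans (*-congˡ co-ε) (zeroʳ b)))) (+-identityʳ _))
    trace≈ : trace (p + b * ε) ≈ trace p + b
    trace≈ = trans (trace-+ p (b * ε)) (+-congˡ (trans (trace-* b∈ ε) (trans (*-congˡ trace-ε) (*-identityʳ b))))

  0^σ : ∀ {x} → x ≈ 0# → x ^ σ ≈ 0#
  0^σ {x} p = trans (^-congʳ x σ≡2s) (trans (^-homo-* x s (s ℕ.+ 0)) (trans (*-congʳ (x^s p)) (zeroˡ _)))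
    where
    x^s : ∀ {x} → x ≈ 0# → x ^ s ≈ 0#
    x^s p with s | ℕ.m^n>0 2 f
    ... | suc k | _ = 0^suc p k

  -- If S ≠ 0 the slope z + l can be made 0, leaving a σ-th root; otherwise it can be made 1.
  solvable : ∀ {S l} → 𝔽q S → 𝔽q l → ∃ λ z → 𝔽q z × (∀ v → 𝔽q v → ∃ λ t → 𝔽q t × (t * S) ^ σ + t * (z + l) ≈ v)
  solvable {S} {l} S∈ l∈ with S ≟ 0#
  ... | yes S≈0 = l + 1# , 𝔽q-+ l∈ 𝔽q-1 , λ v v∈ → v , v∈ , (begin
    (v * S) ^ σ + v * (l + 1# + l)   ≈⟨ +-congʳ (0^σ (trans (*-congˡ S≈0) (zeroʳ v))) ⟩
    0# + v * (l + 1# + l)            ≈⟨ solve 2 (λ v l → con false :+ v :* (l :+ con true :+ l) := v) refl v l ⟩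
    v ∎)
  -- With the slope cancelled, t = v^s / S works: (v^s)^σ = v^(2 s²) = v^q = v.
  ... | no S≉0 with k , Sk≈1 ← invertible S S≉0 = l , l∈ , λ v v∈ → v ^ s * k , 𝔽q-* (𝔽q-^ s v∈) (𝔽q-inverse Sk≈1 S∈) , (begin
    (v ^ s * k * S) ^ σ + v ^ s * k * (l + l)   ≈⟨ +-cong (^-congˡ σ (trans (*-assoc _ k S) (trans (*-congˡ (trans (*-comm k S) Sk≈1)) (*-identityʳ _))))
                                                      (trans (*-congˡ (x+x≈0 l)) (zeroʳ _)) ⟩
    (v ^ s) ^ σ + 0#                            ≈⟨ +-identityʳ _ ⟩
    (v ^ s) ^ σ                                 ≈⟨ ^-assocʳ v s σ ⟩
    v ^ (s ℕ.* σ)                               ≈⟨ ^-congʳ v (≡.trans (≡.cong (s ℕ.*_) σ≡2s) (≡.trans (s*2s s) (≡.sym q≡2ss))) ⟩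
    v ^ q                                       ≈⟨ v∈ ⟩
    v ∎)
    where
    s*2s : ∀ s → s ℕ.* (2 ℕ.* s) ≡ 2 ℕ.* (s ℕ.* s)
    s*2s s = ≡.trans (≡.sym (ℕ.*-assoc s 2 s)) (≡.trans (≡.cong (ℕ._* s) (ℕ.*-comm s 2)) (ℕ.*-assoc 2 s s))

  dot : (a b c x y z : Carrier) → Carrier
  dot a b c x y z = a * x + b * y + c * z

  dot-cong : ∀ {a b c x y z a′ b′ c′ x′ y′ z′} → a ≈ a′ → b ≈ b′ → c ≈ c′ → x ≈ x′ → y ≈ y′ → z ≈ z′ →
    dot a b c x y z ≈ dot a′ b′ c′ x′ y′ z′
  dot-cong a b c x y z = +-cong (+-cong (*-cong a x) (*-cong b y)) (*-cong c z)

  -- Translation by ε β stays inside the translates of the plane a₁ x + a₂ y + a₃ z = 0 and obeys gamma-translate.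
  record Direction (a₁ a₂ a₃ : Carrier) : Set (c Level.⊔ ℓ) where
    field
      β₁ β₂ β₃ : Carrier
      β₁∈      : 𝔽q β₁
      β₂∈      : 𝔽q β₂
      β₃∈      : 𝔽q β₃
      parallel : dot a₁ a₂ a₃ β₁ β₂ β₃ ≈ 0#
      -- Expresses that (a₁,a₂,a₃) and β are linearly independent: the base point can be put on any
      -- prescribed parallel plane while the slope z is still free.
      onto     : ∀ γ z → ∃ λ p₁ → ∃ λ p₂ → ∃ λ p₃ → dot a₁ a₂ a₃ p₁ p₂ p₃ ≈ γ × dot β₁ β₂ β₃ p₁ p₂ p₃ ≈ z
  open Direction

  direction-swap₁₂ : ∀ {a b c} → Direction a b c → Direction b a c
  direction-swap₁₂ {a} {b} {c} d = record
    { β₁ = β₂ d ; β₂ = β₁ d ; β₃ = β₃ d ; β₁∈ = β₂∈ d ; β₂∈ = β₁∈ d ; β₃∈ = β₃∈ d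
    ; parallel = trans (+-congʳ (+-comm _ _)) (parallel d)
    ; onto = λ γ z → let p₁ , p₂ , p₃ , p , r = onto d γ z in
        p₂ , p₁ , p₃ , trans (+-congʳ (+-comm _ _)) p , trans (+-congʳ (+-comm _ _)) r
    }

  direction-swap₁₃ : ∀ {a b c} → Direction a b c → Direction c b a
  direction-swap₁₃ {a} {b} {c} d = record
    { β₁ = β₃ d ; β₂ = β₂ d ; β₃ = β₁ d ; β₁∈ = β₃∈ d ; β₂∈ = β₂∈ d ; β₃∈ = β₁∈ d
    ; parallel = trans (reverse _ _ _) (parallel d)
    ; onto = λ γ z → let p₁ , p₂ , p₃ , p , r = onto d γ z in
        p₃ , p₂ , p₁ , trans (reverse _ _ _) p , trans (reverse _ _ _) r
    }
    where
    reverse : ∀ x y z → z + y + x ≈ x + y + z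
    reverse = solve 3 (λ x y z → z :+ y :+ x := x :+ y :+ z) refl

  direction-scale : ∀ {a b c a′ b′ c′} k → ¬ k ≈ 0# → k * a ≈ a′ → k * b ≈ b′ → k * c ≈ c′ → Direction a b c → Direction a′ b′ c′
  direction-scale {a} {b} {c} {a′} {b′} {c′} k k≉0 pa pb pc d with m , km≈1 ← invertible k k≉0 = record
    { β₁ = β₁ d ; β₂ = β₂ d ; β₃ = β₃ d ; β₁∈ = β₁∈ d ; β₂∈ = β₂∈ d ; β₃∈ = β₃∈ d
    ; parallel = trans (scale (β₁ d) (β₂ d) (β₃ d)) (trans (*-congˡ (parallel d)) (zeroʳ k))
    ; onto = λ γ z → let p₁ , p₂ , p₃ , p , r = onto d (m * γ) z in
        p₁ , p₂ , p₃ , trans (scale p₁ p₂ p₃) (trans (*-congˡ p) (trans (sym (*-assoc k m γ)) (trans (*-congʳ km≈1) (*-identityˡ γ)))) , r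
    }
    where
    scale : ∀ x y z → dot a′ b′ c′ x y z ≈ k * dot a b c x y z
    scale x y z = trans (dot-cong (sym pa) (sym pb) (sym pc) refl refl refl)
      (solve 7 (λ k a b c x y z → k :* a :* x :+ k :* b :* y :+ k :* c :* z := k :* (a :* x :+ b :* y :+ c :* z)) refl k a b c x y z)

  module _ (m n : Carrier) where

    -- The two alternatives concern the 2 × 2 minors of (1,m,n) and β in columns 1, 2 and 1, 3.
    -- Whichever is non-zero, the third coordinate is set to 0 and Cramer's rule gives the other
    -- two.
    direction-from : ∀ β₁ β₂ β₃ → 𝔽q β₁ → 𝔽q β₂ → 𝔽q β₃ → dot 1# m n β₁ β₂ β₃ ≈ 0# →
      ¬ β₁ * m + β₂ ≈ 0# ⊎ ¬ β₁ * n + β₃ ≈ 0# → Direction 1# m n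
    direction-from b₁ b₂ b₃ b₁∈ b₂∈ b₃∈ par minor≉0 = record
      { β₁ = b₁ ; β₂ = b₂ ; β₃ = b₃ ; β₁∈ = b₁∈ ; β₂∈ = b₂∈ ; β₃∈ = b₃∈ ; parallel = par
      ; onto = λ γ z → [ (λ k≉0 → let w , kw≈1 = invertible _ k≉0 ; y = (z + b₁ * γ) * w in
            γ + m * y , y , 0#
          , solve 4 (λ γ m n y → con true :* (γ :+ m :* y) :+ m :* y :+ n :* con false := γ) refl γ m n y
          , (begin
              dot b₁ b₂ b₃ (γ + m * y) y 0#
                ≈⟨ solve 6 (λ b₁ b₂ b₃ γ m y → b₁ :* (γ :+ m :* y) :+ b₂ :* y :+ b₃ :* con false := b₁ :* γ :+ (b₁ :* m :+ b₂) :* y) refl b₁ b₂ b₃ γ m y ⟩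
              b₁ * γ + (b₁ * m + b₂) * y
                ≈⟨ cancel kw≈1 ⟩
              z ∎))
        , (λ k≉0 → let w , kw≈1 = invertible _ k≉0 ; y = (z + b₁ * γ) * w in
            γ + n * y , 0# , y
          , solve 4 (λ γ m n y → con true :* (γ :+ n :* y) :+ m :* con false :+ n :* y := γ) refl γ m n y
          , (begin
              dot b₁ b₂ b₃ (γ + n * y) 0# y
                ≈⟨ solve 6 (λ b₁ b₂ b₃ γ n y → b₁ :* (γ :+ n :* y) :+ b₂ :* con false :+ b₃ :* y := b₁ :* γ :+ (b₁ :* n :+ b₃) :* y) refl b₁ b₂ b₃ γ n y ⟩
              b₁ * γ + (b₁ * n + b₃) * y
                ≈⟨ cancel kw≈1 ⟩
              z ∎)) ]′ minor≉0
      }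
      where
      cancel : ∀ {u k w z} → k * w ≈ 1# → u + k * ((z + u) * w) ≈ z
      cancel {u} {k} {w} {z} kw≈1 = begin
        u + k * ((z + u) * w)     ≈⟨ solve 4 (λ u k w z → u :+ k :* ((z :+ u) :* w) := u :+ (k :* w) :* (z :+ u)) refl u k w z ⟩
        u + (k * w) * (z + u)     ≈⟨ +-congˡ (*-congʳ kw≈1) ⟩
        u + 1# * (z + u)          ≈⟨ solve 2 (λ u z → u :+ con true :* (z :+ u) := z) refl u z ⟩
        z ∎

    -- Over F_q the condition β₁ + m β₂ + n β₃ = 0 splits into components. The ε-part, tr(m) β₂ +
    -- tr(n) β₃ = 0, is solved by β₂ = tr(n), β₃ = tr(m), and the other part then determines β₁ = b.
    direction-irrational : ¬ trace m ≈ 0# ⊎ ¬ trace n ≈ 0# → Direction 1# m n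
    direction-irrational irrational = direction-from b tn tm b∈ (trace∈𝔽q n) (trace∈𝔽q m)
      (trans (dot-cong refl (decompose m) (decompose n) refl refl refl)
        (solve 5 (λ cm tm cn tn ε → con true :* (cm :* tn :+ cn :* tm) :+ (cm :+ tm :* ε) :* tn :+ (cn :+ tn :* ε) :* tm := con false) refl
          (co ε m) tm (co ε n) tn ε))
      minor≉0
      where
      tm = trace m
      tn = trace n
      b = co ε m * tn + co ε n * tm
      b∈ : 𝔽q b
      b∈ = 𝔽q-+ (𝔽q-* (co∈𝔽q m) (trace∈𝔽q n)) (𝔽q-* (co∈𝔽q n) (trace∈𝔽q m))

      trace-minor : ∀ {x t} → 𝔽q t → b * x + t ≈ 0# → b * trace x ≈ 0#
      trace-minor {x} {t} t∈ p = begin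
        b * trace x                ≈⟨ trans (+-congˡ (trace-𝔽q t∈)) (+-identityʳ _) ⟨
        b * trace x + trace t      ≈⟨ trans (trace-+ _ t) (+-congʳ (trace-* b∈ x)) ⟨
        trace (b * x + t)          ≈⟨ trans (trace-cong p) (trace-𝔽q 𝔽q-0) ⟩
        0# ∎

      -- If b = 0 the minors are tr(n) and tr(m). If b ≠ 0, taking traces of the two vanishing
      -- minors again gives tr(m) = tr(n) = 0.
      not-both : b * m + tn ≈ 0# → ¬ b * n + tm ≈ 0#
      not-both p r with b ≟ 0#
      ... | yes b≈0 = [ (λ ¬q → ¬q (drop r)) , (λ ¬q → ¬q (drop p)) ]′ irrational
        where
        drop : ∀ {x t} → b * x + t ≈ 0# → t ≈ 0#
        drop p = trans (sym (trans (+-congʳ (trans (*-congʳ b≈0) (zeroˡ _))) (+-identityˡ _))) p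
      ... | no b≉0 = [ (λ ¬q → ¬q (*-cancel-≉0 b≉0 (trace-minor (trace∈𝔽q n) p)))
                     , (λ ¬q → ¬q (*-cancel-≉0 b≉0 (trace-minor (trace∈𝔽q m) r))) ]′ irrational

      minor≉0 : ¬ b * m + tn ≈ 0# ⊎ ¬ b * n + tm ≈ 0#
      minor≉0 with b * m + tn ≟ 0#
      ... | yes p = inj₂ (not-both p)
      ... | no ¬p = inj₁ ¬p

    -- When m and n lie in F_q, β must be orthogonal to (1,m,n) without being proportional to it,
    -- although (1,m,n) may be orthogonal to itself. The choices are (0,1,0) for m = 0, (0,0,1) for
    -- n = 0, and (n,0,1) when neither vanishes.
    direction-1mn : Direction 1# m n
    direction-1mn with trace m ≟ 0# | trace n ≟ 0# | m ≟ 0# | n ≟ 0#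
    ... | yes _ | yes _ | yes m≈0 | _ = direction-from 0# 1# 0# 𝔽q-0 𝔽q-1 𝔽q-0
            (trans (dot-cong refl m≈0 refl refl refl refl) (solve 1 (λ n → con true :* con false :+ con false :* con true :+ n :* con false := con false) refl n))
            (inj₁ λ p → 1≉0 (trans (solve 1 (λ m → con true := con false :* m :+ con true) refl m) p))
    ... | yes _ | yes trn | no m≉0 | yes n≈0 = direction-from 0# 0# 1# 𝔽q-0 𝔽q-0 𝔽q-1
            (trans (dot-cong refl refl n≈0 refl refl refl) (solve 1 (λ m → con true :* con false :+ m :* con false :+ con false :* con true := con false) refl m))
            (inj₂ λ p → 1≉0 (trans (solve 1 (λ n → con true := con false :* n :+ con true) refl n) p))
    ... | yes _ | yes trn | no m≉0 | no n≉0 = direction-from n 0# 1# (trace≈0⇒𝔽q trn) 𝔽q-0 𝔽q-1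
            (solve 2 (λ m n → con true :* n :+ m :* con false :+ n :* con true := con false) refl m n)
            (inj₁ λ p → *-≉0 n≉0 m≉0 (trans (sym (+-identityʳ _)) p))
    ... | no trm | _ | _ | _ = direction-irrational (inj₁ trm)
    ... | yes _ | no trn | _ | _ = direction-irrational (inj₂ trn)

  direction-pivot : ∀ {a b c} → ¬ a ≈ 0# → Direction a b c
  direction-pivot {a} {b} {c} a≉0 with w , aw≈1 ← invertible a a≉0 =
    direction-scale a a≉0 (*-identityʳ a) (cancel b) (cancel c) (direction-1mn (w * b) (w * c))
    where
    cancel : ∀ x → a * (w * x) ≈ x
    cancel x = trans (sym (*-assoc a w x)) (trans (*-congʳ aw≈1) (*-identityˡ x))

  direction : ∀ a b c → ¬ a ≈ 0# ⊎ ¬ b ≈ 0# ⊎ ¬ c ≈ 0# → Direction a b c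
  direction a b c (inj₁ a≉0)        = direction-pivot a≉0
  direction a b c (inj₂ (inj₁ b≉0)) = direction-swap₁₂ (direction-pivot b≉0)
  direction a b c (inj₂ (inj₂ c≉0)) = direction-swap₁₃ (direction-pivot c≉0)

-- Sections of the hypersurface by subspaces.

module Sections {c ℓ} (e f : ℕ) (e≡ : e ≡ suc (f ℕ.+ f)) (K : FiniteField c ℓ ((2 ℕ.^ e) ℕ.^ 2))
                  (ε : FiniteField.Carrier K) (admissible : Hypersurface.Admissible e K ε) where
  open FiniteField K hiding (zero)
  open CommutativeRing commutativeRing using (setoid)
  open SetoidReasoning setoid
  open Exp commutativeSemiring
  open Hypersurface e K
  open FieldProperties K
  open LinearAlgebra K
  open CharacteristicTwo commutativeRing (characteristicTwo {e ℕ.* 2} (ℕ.^-*-assoc 2 e 2))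
  open Equation e f e≡ K
  open Arithmetic e f e≡ K ε admissible
  open Subfield e f e≡ K ε admissible
  open Vector using ([]; _∷_)

  gamma-cong : ∀ {x y} → x ≈ y → gamma ε x ≈ gamma ε y
  gamma-cong p = +-cong (+-cong (^-congˡ (σ ℕ.+ 2) (co-cong p)) (^-congˡ σ (trace-cong p))) (*-cong (co-cong p) (trace-cong p))

  affine∈𝒱 : ∀ (P : Point 4) → coordinates P 0F ≈ 1# →
    trace (coordinates P 4F) ≈ gamma ε (coordinates P 1F) + gamma ε (coordinates P 2F) + gamma ε (coordinates P 3F) → 𝒱 4 ε P
  affine∈𝒱 P P₀≈1 p = lift (trace⇒affine ε≉0 {coordinates P} P₀≈1 p)

  infinite∈𝒱 : ∀ (P : Point 4) → coordinates P 0F ≈ 0# →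
    norm (coordinates P 1F) + norm (coordinates P 2F) + norm (coordinates P 3F) ≈ 0# → 𝒱 4 ε P
  infinite∈𝒱 P P₀≈0 p = lift (norms⇒infinite ε≉0 {coordinates P} P₀≈0 p)

  𝒱⇒norms : ∀ (P : Point 4) → coordinates P 0F ≈ 0# → 𝒱 4 ε P →
    norm (coordinates P 1F) + norm (coordinates P 2F) + norm (coordinates P 3F) ≈ 0#
  𝒱⇒norms P P₀≈0 P∈𝒱 = infinite⇒norms ε≉0 {coordinates P} P₀≈0 (lower P∈𝒱)

  -- The shift changes the sum of the `gamma` terms by (t S)^σ + t Σ bᵢ co(pᵢ), where S = b₁ + b₂ +
  -- b₃. By F_q-linearity of `co` the last sum is co(z) = z. The last coordinate moves too and adds
  -- t · trace(ε w), whence the slope z + trace(ε w).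
  translated-equation : ∀ {b₁ b₂ b₃ z t} (p₁ p₂ p₃ y w : Carrier) → 𝔽q b₁ → 𝔽q b₂ → 𝔽q b₃ → 𝔽q z → 𝔽q t →
    dot b₁ b₂ b₃ p₁ p₂ p₃ ≈ z →
    (t * (b₁ + b₂ + b₃)) ^ σ + t * (z + trace (ε * w)) ≈ trace y + (gamma ε p₁ + gamma ε p₂ + gamma ε p₃) →
    trace (y + t * ε * w) ≈ gamma ε (p₁ + t * ε * b₁) + gamma ε (p₂ + t * ε * b₂) + gamma ε (p₃ + t * ε * b₃)
  translated-equation {b₁} {b₂} {b₃} {z} {t} p₁ p₂ p₃ y w b₁∈ b₂∈ b₃∈ z∈ t∈ dot≈z solved = begin
    trace (y + t * ε * w)
      ≈⟨ trans (trace-+ y _) (+-congˡ (trans (trace-cong (*-assoc t ε w)) (trace-* t∈ (ε * w)))) ⟩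
    trace y + t * l
      ≈⟨ solve 6 (λ y t l g z s → y :+ t :* l := (y :+ g) :+ (g :+ (s :+ t :* z)) :+ (s :+ t :* (z :+ l))) refl (trace y) t l G z S^ ⟩
    (trace y + G) + (G + (S^ + t * z)) + (S^ + t * (z + l))
      ≈⟨ +-congˡ solved ⟩
    (trace y + G) + (G + (S^ + t * z)) + (trace y + G)
      ≈⟨ solve 2 (λ a b → a :+ b :+ a := b) refl (trace y + G) (G + (S^ + t * z)) ⟩
    G + (S^ + t * z)
      ≈⟨ +-congˡ (+-cong (trans (^-congˡ σ (solve 4 (λ t a b c → t :* (a :+ b :+ c) := t :* a :+ t :* b :+ t :* c) refl t b₁ b₂ b₃))
            (trans (frobenius h (t * b₁ + t * b₂) (t * b₃)) (+-congʳ (frobenius h (t * b₁) (t * b₂))))) (*-congˡ z≈)) ⟩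
    G + (((t * b₁) ^ σ + (t * b₂) ^ σ + (t * b₃) ^ σ) + t * dot b₁ b₂ b₃ (co ε p₁) (co ε p₂) (co ε p₃))
      ≈⟨ solve 13 (λ g₁ g₂ g₃ s₁ s₂ s₃ t b₁ b₂ b₃ c₁ c₂ c₃ →
           (g₁ :+ g₂ :+ g₃) :+ ((s₁ :+ s₂ :+ s₃) :+ t :* (b₁ :* c₁ :+ b₂ :* c₂ :+ b₃ :* c₃)) :=
           (g₁ :+ (s₁ :+ t :* b₁ :* c₁)) :+ (g₂ :+ (s₂ :+ t :* b₂ :* c₂)) :+ (g₃ :+ (s₃ :+ t :* b₃ :* c₃))) refl
           (gamma ε p₁) (gamma ε p₂) (gamma ε p₃) ((t * b₁) ^ σ) ((t * b₂) ^ σ) ((t * b₃) ^ σ) t b₁ b₂ b₃ (co ε p₁) (co ε p₂) (co ε p₃) ⟩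
    (gamma ε p₁ + ((t * b₁) ^ σ + t * b₁ * co ε p₁)) + (gamma ε p₂ + ((t * b₂) ^ σ + t * b₂ * co ε p₂)) + (gamma ε p₃ + ((t * b₃) ^ σ + t * b₃ * co ε p₃))
      ≈⟨ +-cong (+-cong (translate p₁ b₁∈) (translate p₂ b₂∈)) (translate p₃ b₃∈) ⟨
    gamma ε (p₁ + t * ε * b₁) + gamma ε (p₂ + t * ε * b₂) + gamma ε (p₃ + t * ε * b₃) ∎
    where
    h = (e ℕ.+ 1) ℕ./ 2
    l = trace (ε * w)
    G = gamma ε p₁ + gamma ε p₂ + gamma ε p₃
    S^ = (t * (b₁ + b₂ + b₃)) ^ σ
    translate : ∀ p {b} → 𝔽q b → gamma ε (p + t * ε * b) ≈ gamma ε p + ((t * b) ^ σ + t * b * co ε p)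
    translate p {b} b∈ = trans (gamma-cong (solve 4 (λ p t ε b → p :+ t :* ε :* b := p :+ (t :* b) :* ε) refl p t ε b)) (gamma-translate (𝔽q-* t∈ b∈) p)
    z≈ : z ≈ dot b₁ b₂ b₃ (co ε p₁) (co ε p₂) (co ε p₃)
    z≈ = begin
      z                                     ≈⟨ co-𝔽q z∈ ⟨
      co ε z                                ≈⟨ co-cong dot≈z ⟨
      co ε (dot b₁ b₂ b₃ p₁ p₂ p₃)          ≈⟨ trans (co-+ _ (b₃ * p₃)) (+-congʳ (co-+ (b₁ * p₁) (b₂ * p₂))) ⟩
      co ε (b₁ * p₁) + co ε (b₂ * p₂) + co ε (b₃ * p₃)   ≈⟨ +-cong (+-cong (co-* b₁∈ p₁) (co-* b₂∈ p₂)) (co-* b₃∈ p₃) ⟩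
      _ ∎

  -- Only the first four coordinates of the lift are prescribed. The last one, given by U, enters
  -- the equation to be solved.
  Lifts : Subspace 4 → Carrier → Carrier → Carrier → Carrier → Set _
  Lifts U γ a b c = ∀ y₀ y₁ y₂ y₃ → γ * y₀ + dot a b c y₁ y₂ y₃ ≈ 0# →
    ∃ λ u → member U u × u 0F ≈ y₀ × u 1F ≈ y₁ × u 2F ≈ y₂ × u 3F ≈ y₃

  -- The order of the choices matters. The lift `w` of the direction fixes trace(ε w₄), which
  -- decides the slope parameter z. The base point is then taken on the given plane with β · p = z,
  -- and its lift fixes the right-hand side v. Only t remains, and it is found by `solvable`.
  affine-point : (U : Subspace 4) → ∀ γ a b c → ¬ a ≈ 0# ⊎ ¬ b ≈ 0# ⊎ ¬ c ≈ 0# → Lifts U γ a b c →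
    ∃ λ (P : Point 4) → member U (coordinates P) × 𝒱 4 ε P × coordinates P 0F ≈ 1# ×
      dot a b c (coordinates P 1F) (coordinates P 2F) (coordinates P 3F) ≈ γ
  affine-point U γ a b c ≉0 lifts = P , P∈U , P∈𝒱 , P₀≈1 , P∈plane
    where
    open Direction (direction a b c ≉0)
    direction-lift = lifts 0# β₁ β₂ β₃ (trans (+-congʳ (zeroʳ γ)) (trans (+-identityˡ _) parallel))
    w = proj₁ direction-lift
    w∈U = proj₁ (proj₂ direction-lift)
    w₀ = proj₁ (proj₂ (proj₂ direction-lift))
    w₁ = proj₁ (proj₂ (proj₂ (proj₂ direction-lift)))
    w₂ = proj₁ (proj₂ (proj₂ (proj₂ (proj₂ direction-lift))))
    w₃ = proj₂ (proj₂ (proj₂ (proj₂ (proj₂ direction-lift))))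
    slope = solvable (𝔽q-+ (𝔽q-+ β₁∈ β₂∈) β₃∈) (trace∈𝔽q (ε * w 4F))
    z = proj₁ slope
    z∈ = proj₁ (proj₂ slope)
    base = onto γ z
    p₁ = proj₁ base
    p₂ = proj₁ (proj₂ base)
    p₃ = proj₁ (proj₂ (proj₂ base))
    p∈plane = proj₁ (proj₂ (proj₂ (proj₂ base)))
    β·p≈z = proj₂ (proj₂ (proj₂ (proj₂ base)))
    base-lift = lifts 1# p₁ p₂ p₃ (≈⇒+≈0 (trans (*-identityʳ γ) (sym p∈plane)))
    u = proj₁ base-lift
    u∈U = proj₁ (proj₂ base-lift)
    u₀ = proj₁ (proj₂ (proj₂ base-lift))
    u₁ = proj₁ (proj₂ (proj₂ (proj₂ base-lift)))
    u₂ = proj₁ (proj₂ (proj₂ (proj₂ (proj₂ base-lift))))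
    u₃ = proj₂ (proj₂ (proj₂ (proj₂ (proj₂ base-lift))))
    v∈ = 𝔽q-+ (trace∈𝔽q (u 4F)) (𝔽q-+ (𝔽q-+ (gamma∈𝔽q p₁) (gamma∈𝔽q p₂)) (gamma∈𝔽q p₃))
    solution = proj₂ (proj₂ slope) _ v∈
    t = proj₁ solution
    t∈ = proj₁ (proj₂ solution)

    P₀≈1 : u 0F + t * ε * w 0F ≈ 1#
    P₀≈1 = trans (+-cong u₀ (trans (*-congˡ w₀) (zeroʳ _))) (+-identityʳ 1#)

    P : Point 4
    P = record { coordinates = u +ᵥ (t * ε) *ᵥ w ; nonzero = λ ≋0 → 1≉0 (trans (sym P₀≈1) (≋0 0F)) }

    P∈U : member U (coordinates P)
    P∈U = LinearSubspace.+-closed U u∈U (LinearSubspace.*-closed U (t * ε) w∈U)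

    P∈𝒱 : 𝒱 4 ε P
    P∈𝒱 = affine∈𝒱 P P₀≈1 (trans
      (translated-equation p₁ p₂ p₃ (u 4F) (w 4F) β₁∈ β₂∈ β₃∈ z∈ t∈ β·p≈z (proj₂ (proj₂ solution)))
      (sym (+-cong (+-cong (gamma-cong (+-cong u₁ (*-congˡ w₁))) (gamma-cong (+-cong u₂ (*-congˡ w₂)))) (gamma-cong (+-cong u₃ (*-congˡ w₃))))))

    P∈plane : dot a b c (u 1F + t * ε * w 1F) (u 2F + t * ε * w 2F) (u 3F + t * ε * w 3F) ≈ γ
    P∈plane = begin
      dot a b c (u 1F + t * ε * w 1F) (u 2F + t * ε * w 2F) (u 3F + t * ε * w 3F)
        ≈⟨ dot-cong refl refl refl (+-cong u₁ (*-congˡ w₁)) (+-cong u₂ (*-congˡ w₂)) (+-cong u₃ (*-congˡ w₃)) ⟩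
      dot a b c (p₁ + t * ε * β₁) (p₂ + t * ε * β₂) (p₃ + t * ε * β₃)
        ≈⟨ solve 10 (λ a b c x y z k β₁ β₂ β₃ → a :* (x :+ k :* β₁) :+ b :* (y :+ k :* β₂) :+ c :* (z :+ k :* β₃) :=
             (a :* x :+ b :* y :+ c :* z) :+ k :* (a :* β₁ :+ b :* β₂ :+ c :* β₃)) refl a b c p₁ p₂ p₃ (t * ε) β₁ β₂ β₃ ⟩
      dot a b c p₁ p₂ p₃ + t * ε * dot a b c β₁ β₂ β₃
        ≈⟨ +-cong p∈plane (trans (*-congˡ parallel) (zeroʳ _)) ⟩
      γ + 0# ≈⟨ +-identityʳ γ ⟩
      γ ∎

  norms-0 : ∀ {x y z} → x ≈ 0# → y ≈ 0# → z ≈ 0# → norm x + norm y + norm z ≈ 0#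
  norms-0 x≈0 y≈0 z≈0 = trans (+-cong (+-cong (0^suc x≈0 s) (0^suc y≈0 s)) (0^suc z≈0 s)) (trans (+-identityʳ _) (+-identityʳ 0#))

  -- A non-zero vector supported on the last coordinate represents the vertex, a point of 𝒱. Hence a
  -- subspace missing 𝒱 is projected injectively from the vertex.
  vertex∉ : (U : Subspace 4) → (∀ P → member U (coordinates P) → ¬ 𝒱 4 ε P) →
    ∀ u → member U u → (∀ i → u (inject₁ i) ≈ 0#) → ∀ i → u i ≈ 0#
  vertex∉ U empty u u∈U u≈0 i = decidable-stable (u i ≟ 0#) λ uᵢ≉0 →
    let P = record { coordinates = u ; nonzero = λ u≋0 → uᵢ≉0 (u≋0 i) }
    in empty P u∈U (infinite∈𝒱 P (u≈0 0F) (norms-0 (u≈0 1F) (u≈0 2F) (u≈0 3F)))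

  some≉0⊎all≈0 : ∀ a b c → (¬ a ≈ 0# ⊎ ¬ b ≈ 0# ⊎ ¬ c ≈ 0#) ⊎ (a ≈ 0# × b ≈ 0# × c ≈ 0#)
  some≉0⊎all≈0 a b c with a ≟ 0# | b ≟ 0# | c ≟ 0#
  ... | no a≉0 | _      | _      = inj₁ (inj₁ a≉0)
  ... | yes _  | no b≉0 | _      = inj₁ (inj₂ (inj₁ b≉0))
  ... | yes _  | yes _  | no c≉0 = inj₁ (inj₂ (inj₂ c≉0))
  ... | yes p  | yes r  | yes s  = inj₂ (p , r , s)

  •-inject₁ : (ψ : Vector Carrier 4) (v : Vector Carrier 5) → ψ • (v ∘ inject₁) ≈ ψ 0F * v 0F + dot (ψ 1F) (ψ 2F) (ψ 3F) (v 1F) (v 2F) (v 3F)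
  •-inject₁ ψ v = solve 4 (λ a b c d → a :+ (b :+ (c :+ (d :+ con false))) := a :+ (b :+ c :+ d)) refl
    (ψ 0F * v 0F) (ψ 1F * v 1F) (ψ 2F * v 2F) (ψ 3F * v 3F)

  -- No plane misses the hypersurface.

  module Plane {U : Subspace 4} {b : Vector (Vector Carrier 5) 3} (basis : IsBasis U b)
               (empty : ∀ P → member U (coordinates P) → ¬ 𝒱 4 ε P) where

    open IsBasis basis using (members) renaming (independent to b-independent)

    projected-independent : Independent (λ j → b j ∘ inject₁)
    projected-independent a p = b-independent a (vertex∉ U empty (combination a b) (combination∈ U a members) p)

    -- ψ is an equation of the plane in PG(3,q²) obtained by projection from the vertex.
    system = homogeneousSystem {3} {4} ℕ.≤-refl (λ j → b j ∘ inject₁)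
    ψ : Vector Carrier 4
    ψ = proj₁ system
    k : Fin 4
    k = proj₁ (proj₁ (proj₂ system))
    ψk≉0 : ¬ ψ k ≈ 0#
    ψk≉0 = proj₂ (proj₁ (proj₂ system))

    ψ-annihilates : ∀ a → ψ • (combination a b ∘ inject₁) ≈ 0#
    ψ-annihilates a = lower (combination∈ (annihilator ψ inject₁) a {b} (λ j → lift (proj₂ (proj₂ system) j)))

    -- Since ψ k ≠ 0, a vector killed by ψ is determined by its coordinates other than k. Three rows
    -- therefore suffice to express y by the three projected basis vectors.
    lifts : Lifts U (ψ 0F) (ψ 1F) (ψ 2F) (ψ 3F)
    lifts y₀ y₁ y₂ y₃ p = combination a b , combination∈ U a members , a↦y 0F , a↦y 1F , a↦y 2F , a↦y 3F
      where
      y : Vector Carrier 4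
      y = y₀ ∷ y₁ ∷ y₂ ∷ y₃ ∷ []
      y∷b : Vector (Vector Carrier 4) 4
      y∷b = y ∷ (λ j → b j ∘ inject₁)
      in-kernel : ∀ j → member (annihilator {4} {4} ψ id) (y∷b j)
      in-kernel zero    = lift (trans (solve 4 (λ a b c d → a :+ (b :+ (c :+ (d :+ con false))) := a :+ (b :+ c :+ d)) refl
        (ψ 0F * y₀) (ψ 1F * y₁) (ψ 2F * y₂) (ψ 3F * y₃)) p)
      in-kernel (suc j) = lift (proj₂ (proj₂ system) j)
      determined : ∀ x → (∀ i → combination x y∷b (punchIn k i) ≈ 0#) → ∀ i → combination x y∷b i ≈ 0#
      determined x rows i with k Fin.≟ i
      ... | no k≢i     = ≡.subst (λ i → combination x y∷b i ≈ 0#) (Fin.punchIn-punchOut k≢i) (rows (punchOut k≢i))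
      ... | yes ≡.refl = *-cancel-≉0 ψk≉0 (trans
              (sym (sum-single +-commutativeMonoid (λ i → ψ i * combination x y∷b i) k
                (λ j j≢k → let k≢j = j≢k ∘ ≡.sym in trans (*-congˡ (≡.subst (λ i → combination x y∷b i ≈ 0#) (Fin.punchIn-punchOut k≢j) (rows (punchOut k≢j)))) (zeroʳ (ψ j)))))
              (lower (combination∈ (annihilator {4} {4} ψ id) x {y∷b} in-kernel)))
      solution = preimage (λ j → b j ∘ inject₁) projected-independent y (punchIn k) ℕ.≤-refl determined
      a = proj₁ solution
      a↦y = proj₂ solution

    affine-case : ¬ ψ 1F ≈ 0# ⊎ ¬ ψ 2F ≈ 0# ⊎ ¬ ψ 3F ≈ 0# → ⊥
    affine-case ≉0 = meets (affine-point U (ψ 0F) (ψ 1F) (ψ 2F) (ψ 3F) ≉0 lifts)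
      where
      meets : (∃ λ (P : Point 4) → member U (coordinates P) × 𝒱 4 ε P × _) → ⊥
      meets (P , P∈U , P∈𝒱 , _) = empty P P∈U P∈𝒱

    -- A plane at infinity meets the lines over the point (1 , 1 , 0) of the curve.
    infinite-case : ψ 1F ≈ 0# × ψ 2F ≈ 0# × ψ 3F ≈ 0# → ⊥
    infinite-case (ψ₁≈0 , ψ₂≈0 , ψ₃≈0) = empty P (combination∈ U a members)
      (infinite∈𝒱 P u₀≈0 (trans (+-cong (≈⇒+≈0 (norm-cong u₁≈u₂)) (0^suc u₃≈0 s)) (+-identityʳ 0#)))
      where
      condition : Fin 2 → Vector Carrier 3
      condition 0F j = b j 1F + b j 2F
      condition 1F j = b j 3F
      point-system = homogeneousSystem ℕ.≤-refl condition
      a = proj₁ point-system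
      u = combination a b
      u₁≈u₂ : u 1F ≈ u 2F
      u₁≈u₂ = +-cancel⇒≈ (trans
        (solve 9 (λ a₀ a₁ a₂ x₀ x₁ x₂ y₀ y₁ y₂ → (a₀ :* x₀ :+ (a₁ :* x₁ :+ (a₂ :* x₂ :+ con false))) :+ (a₀ :* y₀ :+ (a₁ :* y₁ :+ (a₂ :* y₂ :+ con false))) :=
             a₀ :* (x₀ :+ y₀) :+ (a₁ :* (x₁ :+ y₁) :+ (a₂ :* (x₂ :+ y₂) :+ con false))) refl
          (a 0F) (a 1F) (a 2F) (b 0F 1F) (b 1F 1F) (b 2F 1F) (b 0F 2F) (b 1F 2F) (b 2F 2F))
        (proj₂ (proj₂ point-system) 0F))
      u₃≈0 : u 3F ≈ 0#
      u₃≈0 = proj₂ (proj₂ point-system) 1F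
      ψ₀≉0 : ¬ ψ 0F ≈ 0#
      ψ₀≉0 ψ₀≈0 = ψk≉0 (ψ≈0 k)
        where
        ψ≈0 : ∀ k → ψ k ≈ 0#
        ψ≈0 0F = ψ₀≈0
        ψ≈0 1F = ψ₁≈0
        ψ≈0 2F = ψ₂≈0
        ψ≈0 3F = ψ₃≈0
      u₀≈0 : u 0F ≈ 0#
      u₀≈0 = *-cancel-≉0 ψ₀≉0 (begin
        ψ 0F * u 0F                                                          ≈⟨ trans (+-congˡ (dot-cong ψ₁≈0 ψ₂≈0 ψ₃≈0 refl refl refl))
          (solve 4 (λ p x y z → p :+ (con false :* x :+ con false :* y :+ con false :* z) := p) refl (ψ 0F * u 0F) (u 1F) (u 2F) (u 3F)) ⟨
        ψ 0F * u 0F + dot (ψ 1F) (ψ 2F) (ψ 3F) (u 1F) (u 2F) (u 3F)          ≈⟨ •-inject₁ ψ u ⟨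
        ψ • (u ∘ inject₁)                                                    ≈⟨ ψ-annihilates a ⟩
        0# ∎)
      P : Point 4
      P = record { coordinates = u ; nonzero = λ u≋0 →
        proj₂ (proj₁ (proj₂ point-system)) (b-independent a u≋0 (proj₁ (proj₁ (proj₂ point-system)))) }

    contradictory : ⊥
    contradictory = [ affine-case , infinite-case ]′ (some≉0⊎all≈0 (ψ 1F) (ψ 2F) (ψ 3F))

  -- Every hyperplane is spanned by its section.

  module Hyperplane (U : Subspace 4) {b : Vector (Vector Carrier 5) 4} (basis : IsBasis U b)
                    {d} {g : Vector (Vector Carrier 5) d} (span : IsBasis ⟨ U ∩ 𝒱 4 ε ⟩ g) where

    open IsBasis basis using (members) renaming (independent to b-independent)

    Spanned : Vector Carrier 5 → Set _
    Spanned = Span (U ∩ 𝒱 4 ε)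

    Vertex : Set _
    Vertex = ∃ λ u → member U u × (∀ i → u (inject₁ i) ≈ 0#) × u 4F ≈ 1#

    module NoVertex (no-vertex : ¬ Vertex) where

      projected-independent : Independent (λ j → b j ∘ inject₁)
      projected-independent a p = b-independent a u≋0
        where
        u : Vector Carrier 5
        u = combination a b
        u₄≈0 : u 4F ≈ 0#
        u₄≈0 = decidable-stable (u 4F ≟ 0#) λ u₄≉0 → let k , u₄k≈1 = invertible (u 4F) u₄≉0 in
          no-vertex (k *ᵥ u , LinearSubspace.*-closed U k (combination∈ U a members) ,
            (λ i → trans (*-congˡ (p i)) (zeroʳ k)) , trans (*-comm k (u 4F)) u₄k≈1)
        u≋0 : ∀ i → u i ≈ 0#
        u≋0 0F = p 0F
        u≋0 1F = p 1F
        u≋0 2F = p 2F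
        u≋0 3F = p 3F
        u≋0 4F = u₄≈0

      lifts : ∀ γ a b c → Lifts U γ a b c
      lifts _ _ _ _ y₀ y₁ y₂ y₃ _ = combination a b , combination∈ U a members , a↦y 0F , a↦y 1F , a↦y 2F , a↦y 3F
        where
        solution = preimage (λ j → b j ∘ inject₁) projected-independent (y₀ ∷ y₁ ∷ y₂ ∷ y₃ ∷ []) id ℕ.≤-refl (λ _ p → p)
        a = proj₁ solution
        a↦y = proj₂ solution

      -- If d < 4, some functional ψ of the first four coordinates kills the section; but 𝒱 has points with ψ = 1 in U.
      not-small : ¬ d ℕ.< 4
      not-small d<4 = [ affine-case , infinite-case ]′ (some≉0⊎all≈0 (ψ 1F) (ψ 2F) (ψ 3F))
        where
        system = homogeneousSystem d<4 (λ j → g j ∘ inject₁)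
        ψ : Vector Carrier 4
        ψ = proj₁ system
        k : Fin 4
        k = proj₁ (proj₁ (proj₂ system))
        ψk≉0 : ¬ ψ k ≈ 0#
        ψk≉0 = proj₂ (proj₁ (proj₂ system))

        ψ-annihilates : ∀ v → Spanned v → ψ 0F * v 0F + dot (ψ 1F) (ψ 2F) (ψ 3F) (v 1F) (v 2F) (v 3F) ≈ 0#
        ψ-annihilates v v∈ = annihilated (IsBasis.generates span v v∈)
          where
          annihilated : (∃ λ a → ∀ i → v i ≈ combination a g i) → ψ 0F * v 0F + dot (ψ 1F) (ψ 2F) (ψ 3F) (v 1F) (v 2F) (v 3F) ≈ 0#
          annihilated (a , v≋) = trans (sym (•-inject₁ ψ v)) (lower (LinearSubspace.resp-≋ (annihilator ψ inject₁) {combination a g} {v} (λ i → sym (v≋ i))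
            (combination∈ (annihilator ψ inject₁) a {g} (λ j → lift (proj₂ (proj₂ system) j)))))

        affine-case : ¬ ψ 1F ≈ 0# ⊎ ¬ ψ 2F ≈ 0# ⊎ ¬ ψ 3F ≈ 0# → ⊥
        -- The level ψ₀ + 1 makes ψ equal to 1 at the point found, whose X₀ is 1.
        affine-case ≉0 = meets (affine-point U (ψ 0F + 1#) (ψ 1F) (ψ 2F) (ψ 3F) ≉0 (lifts _ _ _ _))
          where
          meets : (∃ λ (P : Point 4) → member U (coordinates P) × 𝒱 4 ε P × coordinates P 0F ≈ 1# ×
            dot (ψ 1F) (ψ 2F) (ψ 3F) (coordinates P 1F) (coordinates P 2F) (coordinates P 3F) ≈ ψ 0F + 1#) → ⊥
          meets (P , P∈U , P∈𝒱 , P₀≈1 , ψP) = 1≉0 (begin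
            1#                           ≈⟨ solve 1 (λ x → con true := x :* con true :+ (x :+ con true)) refl (ψ 0F) ⟩
            ψ 0F * 1# + (ψ 0F + 1#)      ≈⟨ +-cong (*-congˡ P₀≈1) ψP ⟨
            _                            ≈⟨ ψ-annihilates (coordinates P) (point P (P∈U , P∈𝒱)) ⟩
            0# ∎)

        infinite-case : ψ 1F ≈ 0# × ψ 2F ≈ 0# × ψ 3F ≈ 0# → ⊥
        -- Here ψ is a multiple of X₀, so any affine point of the section is a contradiction; one is
        -- taken in x₃ = 0.
        infinite-case (ψ₁≈0 , ψ₂≈0 , ψ₃≈0) = meets (affine-point U 0# 0# 0# 1# (inj₂ (inj₂ 1≉0)) (lifts _ _ _ _))
          where
          meets : (∃ λ (P : Point 4) → member U (coordinates P) × 𝒱 4 ε P × coordinates P 0F ≈ 1# × _) → ⊥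
          meets (P , P∈U , P∈𝒱 , P₀≈1 , _) = ψk≉0 (ψ≈0 k)
            where
            ψ≈0 : ∀ k → ψ k ≈ 0#
            ψ≈0 0F = begin
              ψ 0F                           ≈⟨ solve 4 (λ p x y z → p := p :* con true :+ (con false :* x :+ con false :* y :+ con false :* z)) refl
                                                  (ψ 0F) (coordinates P 1F) (coordinates P 2F) (coordinates P 3F) ⟩
              ψ 0F * 1# + dot 0# 0# 0# (coordinates P 1F) (coordinates P 2F) (coordinates P 3F)
                                             ≈⟨ +-cong (*-congˡ P₀≈1) (dot-cong ψ₁≈0 ψ₂≈0 ψ₃≈0 refl refl refl) ⟨
              _                              ≈⟨ ψ-annihilates (coordinates P) (point P (P∈U , P∈𝒱)) ⟩
              0# ∎
            ψ≈0 1F = ψ₁≈0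
            ψ≈0 2F = ψ₂≈0
            ψ≈0 3F = ψ₃≈0

    -- Over each affine point of the projection from the vertex lies a point of 𝒱.
    module Cone (v : Vertex) {u₁ : Vector Carrier 5} (u₁∈U : member U u₁) (u₁0≈1 : u₁ 0F ≈ 1#) where
      e∞ = proj₁ v
      e∞∈U = proj₁ (proj₂ v)
      e∞≈0 = proj₁ (proj₂ (proj₂ v))
      e∞≈1 = proj₂ (proj₂ (proj₂ v))

      e∞-spanned : Spanned e∞
      e∞-spanned = point P (e∞∈U , infinite∈𝒱 P (e∞≈0 0F) (norms-0 (e∞≈0 1F) (e∞≈0 2F) (e∞≈0 3F)))
        where
        P : Point 4
        P = record { coordinates = e∞ ; nonzero = λ ≋0 → 1≉0 (trans (sym e∞≈1) (≋0 4F)) }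

      -- Moving u towards the vertex by k = t ε adds t to the trace of the last coordinate, where t
      -- is exactly the defect of the equation at u. Since the vertex lies in the section, the shift
      -- can be undone inside the span.
      affine-spanned : ∀ {u} → member U u → u 0F ≈ 1# → Spanned u
      affine-spanned {u} u∈U u₀≈1 = resp (λ i → solve 3 (λ u k e → u :+ k :* e :+ k :* e := u) refl (u i) k (e∞ i))
        (plus (point P (LinearSubspace.+-closed U u∈U (LinearSubspace.*-closed U k e∞∈U) , affine∈𝒱 P P₀≈1 equation′)) (scale k e∞-spanned))
        where
        G = gamma ε (u 1F) + gamma ε (u 2F) + gamma ε (u 3F)
        t = trace (u 4F) + G
        k = t * ε
        t∈ : 𝔽q t
        t∈ = 𝔽q-+ (trace∈𝔽q (u 4F)) (𝔽q-+ (𝔽q-+ (gamma∈𝔽q (u 1F)) (gamma∈𝔽q (u 2F))) (gamma∈𝔽q (u 3F)))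
        unchanged : ∀ i → u (inject₁ i) + k * e∞ (inject₁ i) ≈ u (inject₁ i)
        unchanged i = trans (+-congˡ (trans (*-congˡ (e∞≈0 i)) (zeroʳ k))) (+-identityʳ _)
        P₀≈1 : u 0F + k * e∞ 0F ≈ 1#
        P₀≈1 = trans (unchanged 0F) u₀≈1
        P : Point 4
        P = record { coordinates = u +ᵥ k *ᵥ e∞ ; nonzero = λ ≋0 → 1≉0 (trans (sym P₀≈1) (≋0 0F)) }
        equation′ : trace (u 4F + k * e∞ 4F) ≈ gamma ε (u 1F + k * e∞ 1F) + gamma ε (u 2F + k * e∞ 2F) + gamma ε (u 3F + k * e∞ 3F)
        equation′ = begin
          trace (u 4F + k * e∞ 4F)       ≈⟨ trace-cong (+-congˡ (trans (*-congˡ e∞≈1) (*-identityʳ k))) ⟩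
          trace (u 4F + t * ε)           ≈⟨ trans (trace-+ (u 4F) (t * ε)) (+-congˡ (trans (trace-* t∈ ε) (trans (*-congˡ trace-ε) (*-identityʳ t)))) ⟩
          trace (u 4F) + (trace (u 4F) + G)  ≈⟨ solve 2 (λ t g → t :+ (t :+ g) := g) refl (trace (u 4F)) G ⟩
          G                              ≈⟨ +-cong (+-cong (gamma-cong (unchanged 1F)) (gamma-cong (unchanged 2F))) (gamma-cong (unchanged 3F)) ⟨
          _ ∎

      -- The vectors with X₀ = 1 generate U: adding (1 + u₀) u₁ normalises u.
      all-spanned : ∀ {u} → member U u → Spanned u
      all-spanned {u} u∈U = resp (λ i → solve 3 (λ u k w → u :+ k :* w :+ k :* w := u) refl (u i) k (u₁ i))
        (plus (affine-spanned (LinearSubspace.+-closed U u∈U (LinearSubspace.*-closed U k u₁∈U))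
                 (trans (+-congˡ (*-congˡ u₁0≈1)) (solve 1 (λ x → x :+ (con true :+ x) :* con true := con true) refl (u 0F))))
              (scale k (affine-spanned u₁∈U u₁0≈1)))
        where k = 1# + u 0F

      large : 4 ℕ.≤ d
      large = independent⇒≤ span b (λ j → all-spanned (members j)) b-independent

    module Infinite (b₀≈0 : ∀ j → b j 0F ≈ 0#) where

      ∈U : ∀ v → v 0F ≈ 0# → member U v
      ∈U v v₀≈0 = LinearSubspace.resp-≋ U {combination a b} {v} a↦v (combination∈ U a members)
        where
        b′ : Vector (Vector Carrier 4) 4
        b′ j = b j ∘ suc
        combination₀ : ∀ a → combination a b 0F ≈ 0#
        combination₀ a = sum-zero +-commutativeMonoid (λ j → trans (*-congˡ (b₀≈0 j)) (zeroʳ (a j)))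
        b′-independent : Independent b′
        b′-independent a p = b-independent a λ { zero → combination₀ a ; (suc i) → p i }
        solution = preimage b′ b′-independent (v ∘ suc) id ℕ.≤-refl (λ _ p → p)
        a = proj₁ solution
        a↦v : ∀ i → combination a b i ≈ v i
        a↦v zero    = trans (combination₀ a) (sym v₀≈0)
        a↦v (suc i) = proj₂ solution i

      module _ (x y z : Carrier) (xyz∈ : norm x + norm y + norm z ≈ 0#) (x+y+z≉0 : ¬ x + y + z ≈ 0#) where

        -- Three non-collinear points of the curve at infinity, and the vertex of the cone over it.
        points : Vector (Vector Carrier 5) 4
        points 0F = 0# ∷ 1# ∷ 1# ∷ 0# ∷ 0# ∷ []
        points 1F = 0# ∷ 1# ∷ 0# ∷ 1# ∷ 0# ∷ []
        points 2F = 0# ∷ x ∷ y ∷ z ∷ 0# ∷ []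
        points 3F = 0# ∷ 0# ∷ 0# ∷ 0# ∷ 1# ∷ []

        points-spanned : ∀ j → Spanned (points j)
        points-spanned j = spanned-point j
          where
          infinite : (v : Vector Carrier 5) → v 0F ≈ 0# → (¬ ∀ i → v i ≈ 0#) → norm (v 1F) + norm (v 2F) + norm (v 3F) ≈ 0# → Spanned v
          infinite v v₀≈0 v≉0 p = point P (∈U v v₀≈0 , infinite∈𝒱 P v₀≈0 p)
            where
            P : Point 4
            P = record { coordinates = v ; nonzero = v≉0 }
          spanned-point : ∀ j → Spanned (points j)
          spanned-point 0F = infinite (points 0F) refl (λ ≋0 → 1≉0 (≋0 1F)) (trans (+-cong (x+x≈0 (norm 1#)) norm-0) (+-identityʳ 0#))
          spanned-point 1F = infinite (points 1F) refl (λ ≋0 → 1≉0 (≋0 1F)) (trans (+-congʳ (trans (+-congˡ norm-0) (+-identityʳ _))) (x+x≈0 (norm 1#)))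
          spanned-point 2F = infinite (points 2F) refl (λ ≋0 → x+y+z≉0 (trans (+-cong (+-cong (≋0 1F) (≋0 2F)) (≋0 3F)) (trans (+-identityʳ _) (+-identityʳ 0#)))) xyz∈
          spanned-point 3F = infinite (points 3F) refl (λ ≋0 → 1≉0 (≋0 4F)) (norms-0 refl refl refl)

        points-independent : Independent points
        points-independent a p = a≈0
          where
          a₀+ : a 0F + a 1F + a 2F * x ≈ 0#
          a₀+ = trans (solve 5 (λ a b c d x → a :+ b :+ c :* x := a :* con true :+ (b :* con true :+ (c :* x :+ (d :* con false :+ con false)))) refl
            (a 0F) (a 1F) (a 2F) (a 3F) x) (p 1F)
          a₀ : a 0F + a 2F * y ≈ 0#
          a₀ = trans (solve 5 (λ a b c d x → a :+ c :* x := a :* con true :+ (b :* con false :+ (c :* x :+ (d :* con false :+ con false)))) refl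
            (a 0F) (a 1F) (a 2F) (a 3F) y) (p 2F)
          a₁ : a 1F + a 2F * z ≈ 0#
          a₁ = trans (solve 5 (λ a b c d x → b :+ c :* x := a :* con false :+ (b :* con true :+ (c :* x :+ (d :* con false :+ con false)))) refl
            (a 0F) (a 1F) (a 2F) (a 3F) z) (p 3F)
          -- The functional x + y + z kills (1,1,0) and (1,0,1), so applying it to the relation
          -- isolates the third coefficient.
          a₂≈0 : a 2F ≈ 0#
          a₂≈0 = *-cancel-≉0 x+y+z≉0 (begin
            (x + y + z) * a 2F    ≈⟨ solve 6 (λ a b c x y z → (x :+ y :+ z) :* c := (a :+ b :+ c :* x) :+ (a :+ c :* y) :+ (b :+ c :* z)) refl
                                       (a 0F) (a 1F) (a 2F) x y z ⟩
            (a 0F + a 1F + a 2F * x) + (a 0F + a 2F * y) + (a 1F + a 2F * z)  ≈⟨ +-cong (+-cong a₀+ a₀) a₁ ⟩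
            0# + 0# + 0#          ≈⟨ trans (+-identityʳ _) (+-identityʳ 0#) ⟩
            0# ∎)
          drop : ∀ {u w} → u + a 2F * w ≈ 0# → u ≈ 0#
          drop {u} {w} q = trans (sym (trans (+-congˡ (trans (*-congʳ a₂≈0) (zeroˡ w))) (+-identityʳ u))) q
          a≈0 : ∀ j → a j ≈ 0#
          a≈0 0F = drop a₀
          a≈0 1F = drop a₁
          a≈0 2F = a₂≈0
          a≈0 3F = trans (solve 4 (λ a b c d → d := a :* con false :+ (b :* con false :+ (c :* con false :+ (d :* con true :+ con false)))) refl
            (a 0F) (a 1F) (a 2F) (a 3F)) (p 4F)

        large : 4 ℕ.≤ d
        large = independent⇒≤ span points points-spanned points-independent

    -- If no basis vector has X₀ ≠ 0, U is the hyperplane at infinity. Otherwise membership of the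
    -- vertex is never decided: under d < 4, `Cone` shows that the vertex is not in U, and
    -- `NoVertex` then refutes d < 4.
    large : 4 ℕ.≤ d
    large with Fin.any? (λ j → ¬? (b j 0F ≟ 0#))
    ... | no all≈0 = infinite curve-point-off-line
      where
      infinite : (∃ λ x → ∃ λ y → ∃ λ z → norm x + norm y + norm z ≈ 0# × ¬ x + y + z ≈ 0#) → 4 ℕ.≤ d
      infinite (x , y , z , xyz∈ , ≉0) = Infinite.large (λ j → decidable-stable (b j 0F ≟ 0#) (λ p → all≈0 (j , p))) x y z xyz∈ ≉0
    ... | yes (j , b₀≉0) = decidable-stable (4 ℕ.≤? d) λ d≱4 →
      NoVertex.not-small (λ v → d≱4 (Cone.large v
        (LinearSubspace.*-closed U (proj₁ (invertible (b j 0F) b₀≉0)) (members j))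
        (trans (*-comm _ _) (proj₂ (invertible (b j 0F) b₀≉0))))) (ℕ.≰⇒> d≱4)

  open import Data.Integer.Base using (+_; -[1+_])

  section-≥ : ∀ {n d k} → n ≡ + d ℤ.- + 1 → k ℕ.≤ d → + k ℤ.- + 1 ℤ.≤ n
  section-≥ ≡.refl k≤d = ℤ.+-monoˡ-≤ (ℤ.- + 1) (ℤ.+≤+ k≤d)

  dim⇒size : ∀ {k d} → + k ≡ + d ℤ.- + 1 → d ≡ suc k
  dim⇒size {d = suc d} p = ≡.cong suc (≡.sym (ℤ.+-injective p))

  -- Sections attaining the minima.

  module ExternalLine {r a m} (external : External r a m) where

    v₁ v₂ v₃ : Vector Carrier 5
    v₁ = 0# ∷ r ∷ 0# ∷ a ∷ 0# ∷ []
    v₂ = 0# ∷ 0# ∷ 1# ∷ m ∷ 0# ∷ []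
    v₃ = 0# ∷ 0# ∷ 0# ∷ 0# ∷ 1# ∷ []

    line : Vector (Vector Carrier 5) 2
    line = v₁ ∷ v₂ ∷ []

    plane : Vector (Vector Carrier 5) 3
    plane = v₁ ∷ v₂ ∷ v₃ ∷ []

    plane-vanishes : ∀ x (v : Vector Carrier 5) → (∀ i → v i ≈ combination x plane i) →
      norm (v 1F) + norm (v 2F) + norm (v 3F) ≈ 0# → x 0F ≈ 0# × x 1F ≈ 0#
    plane-vanishes x v v≋ p = external (x 0F) (x 1F) (trans (+-cong (+-cong
      (norm-cong (trans (solve 4 (λ r x y z → r :* x := x :* r :+ (y :* con false :+ (z :* con false :+ con false))) refl r (x 0F) (x 1F) (x 2F)) (sym (v≋ 1F))))
      (norm-cong (trans (solve 3 (λ x y z → y := x :* con false :+ (y :* con true :+ (z :* con false :+ con false))) refl (x 0F) (x 1F) (x 2F)) (sym (v≋ 2F)))))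
      (norm-cong (trans (solve 5 (λ a m x y z → a :* x :+ m :* y := x :* a :+ (y :* m :+ (z :* con false :+ con false))) refl a m (x 0F) (x 1F) (x 2F)) (sym (v≋ 3F))))) p)

    plane₀≈0 : ∀ x → combination x plane 0F ≈ 0#
    plane₀≈0 x = solve 3 (λ x y z → x :* con false :+ (y :* con false :+ (z :* con false :+ con false)) := con false) refl (x 0F) (x 1F) (x 2F)

    -- The zero vector satisfies the equation of the curve, so externality already makes the first
    -- two coefficients vanish; the last coordinate gives the third.
    plane-independent : Independent plane
    plane-independent x p = λ { 0F → proj₁ xy≈0 ; 1F → proj₂ xy≈0
      ; 2F → trans (solve 3 (λ x y z → z := x :* con false :+ (y :* con false :+ (z :* con true :+ con false))) refl (x 0F) (x 1F) (x 2F)) (p 4F) }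
      where
      xy≈0 : x 0F ≈ 0# × x 1F ≈ 0#
      xy≈0 = plane-vanishes x (λ _ → 0#) (λ i → sym (p i)) (norms-0 refl refl refl)

    extend : Vector Carrier 2 → Vector Carrier 3
    extend x = x 0F ∷ x 1F ∷ 0# ∷ []

    line⊂plane : ∀ x i → combination x line i ≈ combination (extend x) plane i
    line⊂plane x i = +-congˡ (+-congˡ (sym (trans (+-identityʳ _) (zeroˡ (v₃ i)))))

    line-independent : Independent line
    line-independent x p = λ { 0F → extend≈0 0F ; 1F → extend≈0 1F }
      where
      extend≈0 : ∀ i → extend x i ≈ 0#
      extend≈0 = plane-independent (extend x) (λ i → trans (sym (line⊂plane x i)) (p i))

    v₃-axis : Vector (Vector Carrier 5) 1
    v₃-axis _ = v₃

    plane-section : ∀ P → (spanned plane ∩ 𝒱 4 ε) P → member (spanned v₃-axis) (coordinates P)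
    plane-section P ((x , P≋) , P∈𝒱) = (λ _ → x 2F) , λ i → trans (P≋ i) (trans
      (+-cong (trans (*-congʳ (proj₁ xy≈0)) (zeroˡ (v₁ i))) (+-congʳ (trans (*-congʳ (proj₂ xy≈0)) (zeroˡ (v₂ i)))))
      (trans (+-identityˡ _) (+-identityˡ _)))
      where
      xy≈0 : x 0F ≈ 0# × x 1F ≈ 0#
      xy≈0 = plane-vanishes x (coordinates P) P≋ (𝒱⇒norms P (trans (P≋ 0F) (plane₀≈0 x)) P∈𝒱)

    line-section : ∀ P → ¬ (spanned line ∩ 𝒱 4 ε) P
    line-section P ((x , P≋) , P∈𝒱) = Point.nonzero P (λ i → trans (P≋′ i) (zero-combination {a = extend x} plane
      (λ { 0F → proj₁ xy≈0 ; 1F → proj₂ xy≈0 ; 2F → refl }) i))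
      where
      P≋′ : ∀ i → coordinates P i ≈ combination (extend x) plane i
      P≋′ i = trans (P≋ i) (line⊂plane x i)
      xy≈0 : x 0F ≈ 0# × x 1F ≈ 0#
      xy≈0 = plane-vanishes (extend x) (coordinates P) P≋′ (𝒱⇒norms P (trans (P≋′ 0F) (plane₀≈0 (extend x))) P∈𝒱)

    line-section-basis : IsBasis ⟨ spanned line ∩ 𝒱 4 ε ⟩ []
    line-section-basis = record
      { members     = λ ()
      ; independent = λ _ _ ()
      ; generates   = λ v v∈ → span-least (spanned []) (λ P P∈ → contradiction P∈ (line-section P)) v∈
      }

    v₃-spanned : Span (spanned plane ∩ 𝒱 4 ε) v₃
    v₃-spanned = point P (IsBasis.members (spanned-basis {b = plane} plane-independent) 2F , infinite∈𝒱 P refl (norms-0 refl refl refl))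
      where
      P : Point 4
      P = record { coordinates = v₃ ; nonzero = λ ≋0 → 1≉0 (≋0 4F) }

    plane-section-basis : IsBasis ⟨ spanned plane ∩ 𝒱 4 ε ⟩ v₃-axis
    plane-section-basis = record
      { members     = λ _ → v₃-spanned
      ; independent = v₃-independent
      ; generates   = λ v v∈ → span-least (spanned v₃-axis) plane-section v∈
      }
      where
      v₃-independent : Independent v₃-axis
      v₃-independent x p 0F = trans (solve 1 (λ x → x := x :* con true :+ con false) refl (x 0F)) (p 4F)

    line-dimension : SectionDim 1 (𝒱 4 ε) (-[1+ 0 ])
    line-dimension = spanned line , (2 , (line , spanned-basis {b = line} line-independent) , ≡.refl) , (0 , ([] , line-section-basis) , ≡.refl)

    plane-dimension : SectionDim 2 (𝒱 4 ε) (+ 0)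
    plane-dimension = spanned plane , (3 , (plane , spanned-basis {b = plane} plane-independent) , ≡.refl) , (1 , (v₃-axis , plane-section-basis) , ≡.refl)

  -- The hyperplane X₁ = 0 and its points (1,0,0,0,0), (1,0,1,0,ε), (1,0,0,1,ε), (0,0,0,0,1) of 𝒱.
  module CoordinateHyperplane where

    X₁≈0 : Subspace 4
    X₁≈0 = record
      { member   = λ v → Level.Lift c (v 1F ≈ 0#)
      ; resp-≋   = λ v≋w (lift p) → lift (trans (sym (v≋w 1F)) p)
      ; 0-closed = lift refl
      ; +-closed = λ (lift p) (lift r) → lift (trans (+-cong p r) (+-identityʳ 0#))
      ; *-closed = λ a (lift p) → lift (trans (*-congˡ p) (zeroʳ a))
      }

    units : Vector (Vector Carrier 5) 4
    units 0F = 1# ∷ 0# ∷ 0# ∷ 0# ∷ 0# ∷ []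
    units 1F = 0# ∷ 0# ∷ 1# ∷ 0# ∷ 0# ∷ []
    units 2F = 0# ∷ 0# ∷ 0# ∷ 1# ∷ 0# ∷ []
    units 3F = 0# ∷ 0# ∷ 0# ∷ 0# ∷ 1# ∷ []

    module _ (a : Vector Carrier 4) where
      units₀ : combination a units 0F ≈ a 0F
      units₀ = solve 4 (λ a b c d → a :* con true :+ (b :* con false :+ (c :* con false :+ (d :* con false :+ con false))) := a) refl (a 0F) (a 1F) (a 2F) (a 3F)
      units₁ : combination a units 1F ≈ 0#
      units₁ = solve 4 (λ a b c d → a :* con false :+ (b :* con false :+ (c :* con false :+ (d :* con false :+ con false))) := con false) refl (a 0F) (a 1F) (a 2F) (a 3F)
      units₂ : combination a units 2F ≈ a 1F
      units₂ = solve 4 (λ a b c d → a :* con false :+ (b :* con true :+ (c :* con false :+ (d :* con false :+ con false))) := b) refl (a 0F) (a 1F) (a 2F) (a 3F)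
      units₃ : combination a units 3F ≈ a 2F
      units₃ = solve 4 (λ a b c d → a :* con false :+ (b :* con false :+ (c :* con true :+ (d :* con false :+ con false))) := c) refl (a 0F) (a 1F) (a 2F) (a 3F)
      units₄ : combination a units 4F ≈ a 3F
      units₄ = solve 4 (λ a b c d → a :* con false :+ (b :* con false :+ (c :* con false :+ (d :* con true :+ con false))) := d) refl (a 0F) (a 1F) (a 2F) (a 3F)

    units-independent : Independent units
    units-independent a p = λ { 0F → trans (sym (units₀ a)) (p 0F) ; 1F → trans (sym (units₂ a)) (p 2F)
                              ; 2F → trans (sym (units₃ a)) (p 3F) ; 3F → trans (sym (units₄ a)) (p 4F) }

    coordinates-of : Vector Carrier 5 → Vector Carrier 4
    coordinates-of v 0F = v 0F
    coordinates-of v 1F = v 2F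
    coordinates-of v 2F = v 3F
    coordinates-of v 3F = v 4F

    units-coordinates : ∀ v → v 1F ≈ 0# → ∀ i → v i ≈ combination (coordinates-of v) units i
    units-coordinates v v₁≈0 0F = sym (units₀ (coordinates-of v))
    units-coordinates v v₁≈0 1F = trans v₁≈0 (sym (units₁ (coordinates-of v)))
    units-coordinates v v₁≈0 2F = sym (units₂ (coordinates-of v))
    units-coordinates v v₁≈0 3F = sym (units₃ (coordinates-of v))
    units-coordinates v v₁≈0 4F = sym (units₄ (coordinates-of v))

    units-members : ∀ j → member X₁≈0 (units j)
    units-members 0F = lift refl
    units-members 1F = lift refl
    units-members 2F = lift refl
    units-members 3F = lift refl

    gamma-0 : gamma ε 0# ≈ 0#
    gamma-0 = begin
      co ε 0# ^ (σ ℕ.+ 2) + trace 0# ^ σ + co ε 0# * trace 0#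
        ≈⟨ +-cong (+-cong (trans (^-congˡ (σ ℕ.+ 2) (co-𝔽q 𝔽q-0)) (trans (^-homo-* 0# σ 2) (trans (*-congʳ (0^σ refl)) (zeroˡ _)))) (0^σ (trace-𝔽q 𝔽q-0)))
             (trans (*-congˡ (trace-𝔽q 𝔽q-0)) (zeroʳ _)) ⟩
      0# + 0# + 0#    ≈⟨ trans (+-identityʳ _) (+-identityʳ 0#) ⟩
      0# ∎

    gamma-1 : gamma ε 1# ≈ 1#
    gamma-1 = begin
      co ε 1# ^ (σ ℕ.+ 2) + trace 1# ^ σ + co ε 1# * trace 1#
        ≈⟨ +-cong (+-cong (1^ (co-𝔽q 𝔽q-1) (σ ℕ.+ 2)) (0^σ (trace-𝔽q 𝔽q-1))) (trans (*-congˡ (trace-𝔽q 𝔽q-1)) (zeroʳ _)) ⟩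
      1# + 0# + 0#    ≈⟨ trans (+-identityʳ _) (+-identityʳ 1#) ⟩
      1# ∎

    SpannedByPoints : Vector Carrier 5 → Set _
    SpannedByPoints = Span (X₁≈0 ∩ 𝒱 4 ε)

    affine-spanned : ∀ v → v 0F ≈ 1# → v 1F ≈ 0# → trace (v 4F) ≈ gamma ε (v 1F) + gamma ε (v 2F) + gamma ε (v 3F) → SpannedByPoints v
    affine-spanned v v₀≈1 v₁≈0 p = point P (lift v₁≈0 , affine∈𝒱 P v₀≈1 p)
      where
      P : Point 4
      P = record { coordinates = v ; nonzero = λ ≋0 → 1≉0 (trans (sym v₀≈1) (≋0 0F)) }

    units-spanned₀ : SpannedByPoints (units 0F)
    units-spanned₀ = affine-spanned (units 0F) refl refl (trans (trace-𝔽q 𝔽q-0)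
      (sym (trans (+-cong (+-cong gamma-0 gamma-0) gamma-0) (trans (+-identityʳ _) (+-identityʳ 0#)))))

    units-spanned₃ : SpannedByPoints (units 3F)
    units-spanned₃ = point P (lift refl , infinite∈𝒱 P refl (norms-0 refl refl refl))
      where
      P : Point 4
      P = record { coordinates = units 3F ; nonzero = λ ≋0 → 1≉0 (≋0 4F) }

    vanishing-sum : 1# + 1# + ε * 0# ≈ 0#
    vanishing-sum = solve 1 (λ ε → con true :+ con true :+ ε :* con false := con false) refl ε

    +0+ε0 : ∀ x → x + 0# + ε * 0# ≈ x
    +0+ε0 x = solve 2 (λ x ε → x :+ con false :+ ε :* con false := x) refl x ε

    ε+0+ε1≈0 : ε + 0# + ε * 1# ≈ 0#
    ε+0+ε1≈0 = solve 1 (λ ε → ε :+ con false :+ ε :* con true := con false) refl ε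

    units-spanned : ∀ j → SpannedByPoints (units j)
    units-spanned 0F = units-spanned₀
    -- (1,0,1,0,ε) is on 𝒱 because trace(ε) = 1 = gamma(1). Adding (1,0,0,0,0) and ε times the
    -- vertex leaves the unit vector.
    units-spanned 1F = resp
      (λ { 0F → vanishing-sum ; 1F → +0+ε0 0# ; 2F → +0+ε0 1# ; 3F → +0+ε0 0#
         ; 4F → ε+0+ε1≈0 })
      (plus (plus (affine-spanned (1# ∷ 0# ∷ 1# ∷ 0# ∷ ε ∷ []) refl refl (trans trace-ε
        (sym (trans (+-cong (+-cong gamma-0 gamma-1) gamma-0) (trans (+-identityʳ _) (+-identityˡ 1#)))))) units-spanned₀) (scale ε units-spanned₃))
    units-spanned 2F = resp
      (λ { 0F → vanishing-sum ; 1F → +0+ε0 0# ; 2F → +0+ε0 0# ; 3F → +0+ε0 1#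
         ; 4F → ε+0+ε1≈0 })
      (plus (plus (affine-spanned (1# ∷ 0# ∷ 0# ∷ 1# ∷ ε ∷ []) refl refl (trans trace-ε
        (sym (trans (+-cong (+-cong gamma-0 gamma-0) gamma-1) (trans (+-congʳ (+-identityʳ _)) (+-identityˡ 1#)))))) units-spanned₀) (scale ε units-spanned₃))
    units-spanned 3F = units-spanned₃

    units-basis : IsBasis X₁≈0 units
    units-basis = record { members = units-members ; independent = units-independent ; generates = λ v (lift p) → coordinates-of v , units-coordinates v p }

    section-basis : IsBasis ⟨ X₁≈0 ∩ 𝒱 4 ε ⟩ units
    section-basis = record
      { members     = units-spanned
      ; independent = units-independent
      ; generates   = λ v v∈ → coordinates-of v , units-coordinates v (lower (span-least X₁≈0 (λ P (P∈ , _) → P∈) v∈))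
      }

    dimension : SectionDim 3 (𝒱 4 ε) (+ 3)
    dimension = X₁≈0 , (4 , (units , units-basis) , ≡.refl) , (4 , (units , section-basis) , ≡.refl)

  line-minimum : ∀ n → SectionDim 1 (𝒱 4 ε) n → -[1+ 0 ] ℤ.≤ n
  line-minimum n (_ , _ , (d , _ , n≡)) = section-≥ {d = d} n≡ ℕ.z≤n

  plane-minimum : ∀ n → SectionDim 2 (𝒱 4 ε) n → + 0 ℤ.≤ n
  plane-minimum n (U , (d , (b , basis) , d≡) , (zero , (g , span) , n≡)) = contradiction (dim⇒size {2} {d} d≡) (not-plane basis)
    where
    not-plane : ∀ {d b} → IsBasis {d = d} U b → ¬ d ≡ 3
    -- A section whose span has an empty basis contains no point, since its coordinates would be an
    -- empty combination.
    not-plane basis ≡.refl = Plane.contradictory basis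
      (λ P P∈U P∈𝒱 → Point.nonzero P (proj₂ (IsBasis.generates span (coordinates P) (point P (P∈U , P∈𝒱)))))
  plane-minimum n (U , _ , (suc d , _ , n≡)) = section-≥ {d = suc d} n≡ (ℕ.s≤s ℕ.z≤n)

  hyperplane-minimum : ∀ n → SectionDim 3 (𝒱 4 ε) n → + 3 ℤ.≤ n
  hyperplane-minimum n (U , (d , (b , basis) , d≡) , (d′ , (g , span) , n≡)) = section-≥ {d = d′} n≡ (large basis (dim⇒size {3} {d} d≡))
    where
    large : ∀ {d b} → IsBasis {d = d} U b → d ≡ 4 → 4 ℕ.≤ d′
    large basis ≡.refl = Hyperplane.large U basis span

  cutting-gaps : (∃ λ r → ∃ λ a → ∃ λ m → External r a m) →
    CuttingGap 1 (𝒱 4 ε) (+ 2) × CuttingGap 2 (𝒱 4 ε) (+ 2) × CuttingGap 3 (𝒱 4 ε) (+ 0)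
  cutting-gaps (_ , _ , _ , external) =
    (-[1+ 0 ] , (ExternalLine.line-dimension external , line-minimum) , ≡.refl) ,
    (+ 0 , (ExternalLine.plane-dimension external , plane-minimum) , ≡.refl) ,
    (+ 3 , (CoordinateHyperplane.dimension , hyperplane-minimum) , ≡.refl)

odd⇒≡1+f+f : ∀ e → 2 ∤ e → ∃ λ f → e ≡ suc (f ℕ.+ f)
odd⇒≡1+f+f zero          2∤e = contradiction (divides 0 ≡.refl) 2∤e
odd⇒≡1+f+f (suc zero)    2∤e = 0 , ≡.refl
odd⇒≡1+f+f (suc (suc e)) 2∤e with f , ≡.refl ← odd⇒≡1+f+f e (λ { (divides k ≡.refl) → 2∤e (divides (suc k) ≡.refl) }) =
  suc f , ≡.cong (2 ℕ.+_) (≡.sym (ℕ.+-suc f f))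

open import Data.Integer.Base using (+_)
open import Data.Nat.Base using (_≤_; _^_)

proposition4p10 :
    ∀ {c ℓ : Level} (e : ℕ) → 3 ≤ e → 2 ∤ e →
    (K : FiniteField c ℓ ((2 ^ e) ^ 2)) →
    let open FiniteField K using (Carrier)
        open Hypersurface e K
    in
    (ε : Carrier) → Admissible ε →
    CuttingGap 1 (𝒱 4 ε) (+ 2) ×
    CuttingGap 2 (𝒱 4 ε) (+ 2) ×
    CuttingGap 3 (𝒱 4 ε) (+ 0)
proposition4p10 e _ 2∤e K ε admissible = Sections.cutting-gaps e f e≡ K ε admissible (Arithmetic.external-line e f e≡ K ε admissible)
  where
  f = proj₁ (odd⇒≡1+f+f e 2∤e)
  e≡ = proj₂ (odd⇒≡1+f+f e 2∤e)
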